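{- Let $a$, $b$, $c$ be positive integers with $c$ even. Then for all integers $p,q\geq1$ and all $x,y,z\in\mathbb{R}$, \begin{align*} a^{1-p}b^{1-q}S^{(2)}_{p,q}(a,b,c:x,y,z) &=-\frac{q}{2}\sum_{j=0}^{p}\binom{p}{j}a^{1-j}c^{1+j-p-q}S^{(1)}_{p+q-j,j}(c,-a,b:z,x,y)\\ &\quad-\frac{p}{2}\sum_{h=0}^{q}\binom{q}{h}(-1)^{h}b^{1-h}c^{1+h-p-q}S^{(1)}_{p+q-h,h}(c,b,a:z,-y,x). \end{align*}
   Context: $B_n(x)$ is the $n$th Bernoulli polynomial ($\frac{te^{xt}}{e^t-1}=\sum B_n(x)\frac{t^n}{n!}$) and $\mathcal{B}_n(x)=B_n(x-[x])$ the $n$th Bernoulli function ($[x]$ the largest integer $\le x$; $\mathcal{B}_0\equiv1$). $E_n(x)$ is the $n$th Euler polynomial ($\frac{2e^{xt}}{e^t+1}=\sum E_n(x)\frac{t^n}{n!}$), and the Euler function $\mathcal{E}_n$ ($n\ge0$) is defined by $\mathcal{E}_n(x)=E_n(x)$ for $0\le x<1$ and $\mathcal{E}_n(x+m)=(-1)^m\mathcal{E}_n(x)$ for $m\in\mathbb{Z}$. For integers $a,b$, a positive integer $c$, and real $x,y,z$ define, for integers $p\ge1$, $q\ge0$, $$S^{(1)}_{p,q}(a,b,c:x,y,z)=\sum_{\mu=0}^{c-1}\mathcal{E}_{p-1}\Big(a\frac{\mu+z}{c}+x\Big)\mathcal{B}_{q}\Big(b\frac{\mu+z}{c}+y\Big),$$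 and, for integers $p,q\ge1$, $$S^{(2)}_{p,q}(a,b,c:x,y,z)=\sum_{\mu=0}^{c-1}(-1)^{\mu}\mathcal{B}_{p}\Big(a\frac{\mu+z}{c}+x\Big)\mathcal{B}_{q}\Big(b\frac{\mu+z}{c}+y\Big).$$ -}

module Defs where

open import Algebra.Bundles using (CommutativeRing)
open import Algebra.Structures using (IsCommutativeRing)
import Algebra.Definitions.RawMonoid as RawMonoidDefinitions
import Algebra.Properties.Ring as RingProperties
import Algebra.Properties.Semiring.Exp as SemiringExp
import Algebra.Properties.Semiring.Sum as SemiringSum
open import Data.Fin using (Fin; zero; suc; toℕ)
open import Data.Integer as ℤ using (ℤ; -[1+_])
import Data.Integer.Properties as ℤ
open import Data.Nat as ℕ using (ℕ; zero; suc; _∸_; _!)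
import Data.Nat.Properties as ℕ
open import Data.Product using (∃; ∃-syntax; _×_; _,_; proj₁; proj₂)
open import Data.Vec using (Vec; []; _∷_; lookup)
open import Data.Sum using (inj₁; inj₂)
open import Data.Empty using (⊥-elim)
open import Level using (Level; _⊔_) renaming (suc to lsuc)
open import Relation.Binary.Core using (Rel)
open import Relation.Binary.Structures using (IsDecTotalOrder)
open import Relation.Binary.PropositionalEquality as ≡ using (_≡_)
open import Relation.Nullary using (¬_; yes; no)

-- The real numbers, axiomatised as a Cauchy-complete Archimedean ordered field.
-- The order is decidable, as it is classically; this is what makes the integer
-- part a function.
record Reals (r ℓ₁ ℓ₂ : Level) : Set (lsuc (r ⊔ ℓ₁ ⊔ ℓ₂)) where
  infix  8 _⁻¹
  infix  8 -_
  infixl 7 _*_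
  infixl 6 _+_
  infix  4 _≈_ _≤_
  field
    ℝ   : Set r
    _≈_ : Rel ℝ ℓ₁
    _≤_ : Rel ℝ ℓ₂
    _+_ : ℝ → ℝ → ℝ
    _*_ : ℝ → ℝ → ℝ
    -_  : ℝ → ℝ
    0#  : ℝ
    1#  : ℝ
    -- The value at 0# is unspecified.
    _⁻¹ : ℝ → ℝ

    isCommutativeRing : IsCommutativeRing _≈_ _+_ _*_ -_ 0# 1#
    0≉1               : ¬ (0# ≈ 1#)
    *-inverseʳ        : ∀ x → ¬ (x ≈ 0#) → x * x ⁻¹ ≈ 1#

    isDecTotalOrder   : IsDecTotalOrder _≈_ _≤_
    +-monoˡ-≤         : ∀ z {x y} → x ≤ y → x + z ≤ y + z
    *-nonNeg          : ∀ {x y} → 0# ≤ x → 0# ≤ y → 0# ≤ x * y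

  commutativeRing : CommutativeRing r ℓ₁
  commutativeRing = record { isCommutativeRing = isCommutativeRing }

  open CommutativeRing commutativeRing public
    using (_-_; semiring)

  open SemiringExp semiring public using (_^_)
  open SemiringSum semiring public using (sum; sum-syntax; sum⁺-syntax)

  fromℕ : ℕ → ℝ
  fromℕ n = RawMonoidDefinitions._×_ (CommutativeRing.+-rawMonoid commutativeRing) n 1#

  IsCauchy : (ℕ → ℝ) → Set (r ⊔ ℓ₁ ⊔ ℓ₂)
  IsCauchy s = ∀ ε → 0# ≤ ε → ¬ (ε ≈ 0#) →
    ∃[ N ] (∀ m n → N ℕ.≤ m → N ℕ.≤ n → s m ≤ s n + ε)

  _ConvergesTo_ : (ℕ → ℝ) → ℝ → Set (r ⊔ ℓ₁ ⊔ ℓ₂)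
  s ConvergesTo l = ∀ ε → 0# ≤ ε → ¬ (ε ≈ 0#) →
    ∃[ N ] (∀ n → N ℕ.≤ n → (s n ≤ l + ε) × (l ≤ s n + ε))

  field
    archimedean : ∀ x → ∃[ n ] (x ≤ fromℕ n)
    complete    : ∀ s → IsCauchy s → ∃[ l ] (s ConvergesTo l)

  fromℤ : ℤ → ℝ
  fromℤ (ℤ.+ n)  = fromℕ n
  fromℤ -[1+ n ] = - fromℕ (suc n)

  infixl 7 _/_
  _/_ : ℝ → ℝ → ℝ
  x / y = x * y ⁻¹

  infixr 8 _^ℤ_
  _^ℤ_ : ℝ → ℤ → ℝ
  x ^ℤ (ℤ.+ n)  = x ^ n
  x ^ℤ -[1+ n ] = (x ^ suc n) ⁻¹

module OrderProperties {r ℓ₁ ℓ₂ : Level} (R : Reals r ℓ₁ ℓ₂) where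
  open Reals R
  open CommutativeRing commutativeRing
    using (sym; trans; refl; +-congˡ; +-congʳ; *-identityˡ; +-identityˡ; +-identityʳ;
           -‿inverseʳ; -‿inverseˡ; -‿cong; +-assoc; +-comm; ring)
  open IsDecTotalOrder isDecTotalOrder
    using (total; antisym; _≤?_; ≤-respʳ-≈; ≤-respˡ-≈)
    renaming (reflexive to ≤-reflexive; trans to ≤-trans)
  open RingProperties ring using (-‿distribˡ-*; -‿involutive)

  x≤0⇒0≤-x : ∀ {x} → x ≤ 0# → 0# ≤ - x
  x≤0⇒0≤-x {x} x≤0 =
    ≤-respʳ-≈ (+-identityˡ _) (≤-respˡ-≈ (-‿inverseʳ x) (+-monoˡ-≤ (- x) x≤0))

  0≤1 : 0# ≤ 1#
  0≤1 with total 0# 1#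
  ... | inj₁ 0≤1 = 0≤1
  ... | inj₂ 1≤0 = ≤-respʳ-≈ -1*-1≈1 (*-nonNeg (x≤0⇒0≤-x 1≤0) (x≤0⇒0≤-x 1≤0))
    where
    -1*-1≈1 : - 1# * - 1# ≈ 1#
    -1*-1≈1 = trans (sym (-‿distribˡ-* 1# (- 1#)))
              (trans (-‿cong (*-identityˡ (- 1#)))
                     (-‿involutive 1#))

  x≤1+x : ∀ x → x ≤ 1# + x
  x≤1+x x = ≤-respˡ-≈ (+-identityˡ x) (+-monoˡ-≤ x 0≤1)

  1+x≰x : ∀ x → ¬ (1# + x ≤ x)
  1+x≰x x 1+x≤x = 0≉1 (antisym 0≤1
    (≤-respˡ-≈ (trans (+-assoc 1# x (- x)) (trans (+-congˡ (-‿inverseʳ x)) (+-identityʳ 1#)))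
      (≤-respʳ-≈ (-‿inverseʳ x) (+-monoˡ-≤ (- x) 1+x≤x))))

  fromℕ-mono : ∀ {m n} → m ℕ.≤ n → fromℕ m ≤ fromℕ n
  fromℕ-mono {n = zero}  ℕ.z≤n = ≤-reflexive refl
  fromℕ-mono {n = suc n} ℕ.z≤n = ≤-trans (fromℕ-mono {n = n} ℕ.z≤n) (x≤1+x _)
  fromℕ-mono (ℕ.s≤s m≤n) =
    ≤-respˡ-≈ (+-comm _ 1#) (≤-respʳ-≈ (+-comm _ 1#) (+-monoˡ-≤ 1# (fromℕ-mono m≤n)))

  fromℕ-cancel-≤ : ∀ {m n} → fromℕ m ≤ fromℕ n → m ℕ.≤ n
  fromℕ-cancel-≤ {m} {n} p with m ℕ.≤? n
  ... | yes m≤n = m≤n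
  ... | no  m≰n = ⊥-elim (1+x≰x (fromℕ n) (≤-trans (fromℕ-mono (ℕ.≰⇒> m≰n)) p))

  fromℕ-suc≉0 : ∀ n → ¬ (fromℕ (suc n) ≈ 0#)
  fromℕ-suc≉0 n eq with fromℕ-cancel-≤ {suc n} {0} (≤-reflexive eq)
  ... | ()

  fromℕ-!≉0 : ∀ n → ¬ (fromℕ (n !) ≈ 0#)
  fromℕ-!≉0 n eq with n ! | ℕ.1≤n! n
  ... | suc k | _ = fromℕ-suc≉0 k eq

  IsIntegerPart : ℝ → ℤ → Set ℓ₂
  IsIntegerPart x m = (fromℤ m ≤ x) × (∀ k → fromℤ k ≤ x → k ℤ.≤ m)

  private
    neg-≤ : ∀ n {x} → - x ≤ fromℕ n → fromℤ (ℤ.- (ℤ.+ n)) ≤ x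
    neg-≤ n {x} p = ≤-respˡ-≈ (fromℤ-neg n) -n≤x
      where
      fromℤ-neg : ∀ n → - fromℕ n ≈ fromℤ (ℤ.- (ℤ.+ n))
      fromℤ-neg zero    = trans (sym (+-identityˡ _)) (-‿inverseʳ 0#)
      fromℤ-neg (suc n) = refl
      0≤n+x : 0# ≤ fromℕ n + x
      0≤n+x = ≤-respˡ-≈ (-‿inverseˡ x) (+-monoˡ-≤ x p)
      -n≤x : - fromℕ n ≤ x
      -n≤x = ≤-respˡ-≈ (+-identityˡ _)
        (≤-respʳ-≈ (trans (+-congʳ (+-comm _ x))
                     (trans (+-assoc x _ _) (trans (+-congˡ (-‿inverseʳ _)) (+-identityʳ x))))
          (+-monoˡ-≤ (- fromℕ n) 0≤n+x))

    searchDown : ∀ x fuel m → fromℤ (m ℤ.- ℤ.+ fuel) ≤ x →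
                 (∀ k → fromℤ k ≤ x → k ℤ.≤ m) → ∃ (IsIntegerPart x)
    searchDown x zero m low up =
      m , ≡.subst (λ i → fromℤ i ≤ x) (ℤ.+-identityʳ m) low , up
    searchDown x (suc fuel) m low up with fromℤ m ≤? x
    ... | yes m≤x = m , m≤x , up
    ... | no  m≰x = searchDown x fuel (ℤ.pred m)
          (≡.subst (λ i → fromℤ i ≤ x) (step m fuel) low)
          λ k k≤x → ℤ.i<j⇒i≤pred[j] (ℤ.≤∧≢⇒< (up k k≤x) λ { ≡.refl → m≰x k≤x })
      where
      step : ∀ m n → m ℤ.- ℤ.+ suc n ≡ ℤ.pred m ℤ.- ℤ.+ n
      step m n = ≡.trans (ℤ.minus-suc m n) (≡.sym (ℤ.+-assoc -[1+ 0 ] m (ℤ.- ℤ.+ n)))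

  integerPart : ∀ x → ∃ (IsIntegerPart x)
  integerPart x with archimedean x | archimedean (- x)
  ... | n , x≤n | l , -x≤l = searchDown x (n ℕ.+ l) (ℤ.+ n)
        (≡.subst (λ i → fromℤ i ≤ x) (≡.sym (n-[n+l] n l)) (neg-≤ l -x≤l)) up
    where
    n-[n+l] : ∀ n l → ℤ.+ n ℤ.- ℤ.+ (n ℕ.+ l) ≡ ℤ.- (ℤ.+ l)
    n-[n+l] n l = ≡.trans (≡.cong (λ i → ℤ.+ n ℤ.+ i) (ℤ.neg-distrib-+ (ℤ.+ n) (ℤ.+ l)))
      (≡.trans (≡.sym (ℤ.+-assoc (ℤ.+ n) (ℤ.- ℤ.+ n) (ℤ.- ℤ.+ l)))
      (≡.trans (≡.cong (ℤ._+ (ℤ.- ℤ.+ l)) (ℤ.+-inverseʳ (ℤ.+ n))) (ℤ.+-identityˡ _)))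
    up : ∀ k → fromℤ k ≤ x → k ℤ.≤ ℤ.+ n
    up (ℤ.+ k)  k≤x = ℤ.+≤+ (fromℕ-cancel-≤ (≤-trans k≤x x≤n))
    up -[1+ k ] _   = ℤ.-≤+

module PowerSeries {r ℓ₁ ℓ₂ : Level} (R : Reals r ℓ₁ ℓ₂) where
  open Reals R

  Series : Set r
  Series = ℕ → ℝ

  infix 4 _≋_
  _≋_ : Series → Series → Set ℓ₁
  f ≋ g = ∀ n → f n ≈ g n

  infixl 7 _⊛_ _⊘_ _·_
  infixl 6 _⊕_ _⊖_

  _⊕_ _⊖_ : Series → Series → Series
  (f ⊕ g) n = f n + g n
  (f ⊖ g) n = f n - g n

  _·_ : ℝ → Series → Series
  (x · f) n = x * f n

  _⊛_ : Series → Series → Series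
  (f ⊛ g) n = ∑[ i ≤ n ] (f (toℕ i) * g (n ∸ toℕ i))

  one : Series
  one zero    = 1#
  one (suc _) = 0#

  t⊛ : Series → Series
  t⊛ f zero    = 0#
  t⊛ f (suc n) = f n

  -- Division by t; meaningful only when the constant term vanishes.
  t⁻¹⊛ : Series → Series
  t⁻¹⊛ f n = f (suc n)

  -- The coefficients q(n−1), …, q(0), in this order, of the quotient q of f by g,
  -- each q(k) obtained by solving f(k) = g(0) q(k) + g(1) q(k−1) + … + g(k) q(0).
  quotientPrefix : Series → Series → (n : ℕ) → Vec ℝ n
  quotientCoeff  : Series → Series → ℕ → ℝ
  quotientPrefix f g zero    = []
  quotientPrefix f g (suc n) = quotientCoeff f g n ∷ quotientPrefix f g n
  quotientCoeff f g n =
    (f n - (∑[ i < n ] (g (suc (toℕ i)) * lookup (quotientPrefix f g n) i))) / g 0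

  -- The quotient of formal power series; meaningful when g 0 ≉ 0#.
  _⊘_ : Series → Series → Series
  f ⊘ g = quotientCoeff f g

  -- exp x = e^{xt}
  exp : ℝ → Series
  exp x n = x ^ n / fromℕ (n !)

  -- egf s = Σ sₙ tⁿ / n!
  egf : (ℕ → ℝ) → Series
  egf s n = s n / fromℕ (n !)

module BernoulliEuler {r ℓ₁ ℓ₂ : Level} (R : Reals r ℓ₁ ℓ₂) where
  open Reals R
  open OrderProperties R using (integerPart)
  open PowerSeries R

  floor : ℝ → ℤ
  floor x = proj₁ (integerPart x)

  -- t e^{xt} / (e^t − 1) = e^{xt} / ((e^t − 1) / t), where (e^t − 1) / t has
  -- invertible constant term.  See bernoulli-egf below.
  bernoulli : ℕ → ℝ → ℝ
  bernoulli n x = fromℕ (n !) * (exp x ⊘ t⁻¹⊛ (exp 1# ⊖ one)) n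

  -- 2 e^{xt} / (e^t + 1).  See euler-egf below.
  euler : ℕ → ℝ → ℝ
  euler n x = fromℕ (n !) * (fromℕ 2 · exp x ⊘ (exp 1# ⊕ one)) n

  bernoulliFun : ℕ → ℝ → ℝ
  bernoulliFun n x = bernoulli n (x - fromℤ (floor x))

  -- The unique function agreeing with euler n on [0,1) and satisfying
  -- f (x + m) = (−1)^m f x for every integer m.
  eulerFun : ℕ → ℝ → ℝ
  eulerFun n x = (- 1#) ^ℤ floor x * euler n (x - fromℤ (floor x))

  -- Used only for p ≥ 1, so that p ∸ 1 is the true difference, and c ≥ 1.
  S⁽¹⁾ : (p q : ℕ) (a b : ℤ) (c : ℕ) (x y z : ℝ) → ℝ
  S⁽¹⁾ p q a b c x y z = ∑[ μ < c ] (
    eulerFun (p ∸ 1) (fromℤ a * ((fromℕ (toℕ μ) + z) / fromℕ c) + x)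
      * bernoulliFun q (fromℤ b * ((fromℕ (toℕ μ) + z) / fromℕ c) + y))

  S⁽²⁾ : (p q : ℕ) (a b : ℤ) (c : ℕ) (x y z : ℝ) → ℝ
  S⁽²⁾ p q a b c x y z = ∑[ μ < c ] (
    (- 1#) ^ toℕ μ
      * bernoulliFun p (fromℤ a * ((fromℕ (toℕ μ) + z) / fromℕ c) + x)
      * bernoulliFun q (fromℤ b * ((fromℕ (toℕ μ) + z) / fromℕ c) + y))

module GeneratingFunctions {r ℓ₁ ℓ₂ : Level} (R : Reals r ℓ₁ ℓ₂) where
  open Reals R
  open OrderProperties R
  open PowerSeries R
  open BernoulliEuler R
  open CommutativeRing commutativeRing
    using (sym; trans; refl; reflexive; +-cong; +-congˡ; +-congʳ; *-congˡ; *-congʳ; *-comm; *-assoc;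
           *-identityˡ; *-identityʳ; +-identityˡ; +-identityʳ; -‿inverseʳ; -‿inverseˡ;
           +-assoc; zeroˡ)
  open SemiringSum semiring using (sum-cong-≋; sum-cong-≗)

  ⊛-congˡ : ∀ f {g h} → g ≋ h → f ⊛ g ≋ f ⊛ h
  ⊛-congˡ f g≋h n = sum-cong-≋ {suc n} λ i → *-congˡ {f (toℕ i)} (g≋h (n ∸ toℕ i))

  lookup-quotientPrefix : ∀ f g n (i : Fin n) →
    lookup (quotientPrefix f g n) i ≡ (f ⊘ g) (n ∸ suc (toℕ i))
  lookup-quotientPrefix f g (suc n) zero    = ≡.refl
  lookup-quotientPrefix f g (suc n) (suc i) = lookup-quotientPrefix f g n i

  ⊛-⊘ : ∀ f g → ¬ (g 0 ≈ 0#) → g ⊛ (f ⊘ g) ≋ f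
  ⊛-⊘ f g g₀≉0 n =
    trans (+-cong head≈ (sym tail≈))
      (trans (+-assoc _ _ _) (trans (+-congˡ (-‿inverseˡ _)) (+-identityʳ _)))
    where
    S : ℝ
    S = ∑[ i < n ] (g (suc (toℕ i)) * lookup (quotientPrefix f g n) i)
    head≈ : g 0 * ((f n - S) / g 0) ≈ f n - S
    head≈ = trans (*-comm _ _) (trans (*-assoc _ _ _)
      (trans (*-congˡ (trans (*-comm _ _) (*-inverseʳ _ g₀≉0))) (*-identityʳ _)))
    tail≈ : S ≈ (∑[ i < n ] (g (suc (toℕ i)) * (f ⊘ g) (n ∸ suc (toℕ i))))
    tail≈ = reflexive (sum-cong-≗ {n} λ i →
      ≡.cong (g (suc (toℕ i)) *_) (lookup-quotientPrefix f g n i))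

  egf-! : ∀ s → egf (λ n → fromℕ (n !) * s n) ≋ s
  egf-! s n = trans (*-congʳ (*-comm _ _)) (trans (*-assoc _ _ _)
    (trans (*-congˡ (*-inverseʳ _ (fromℕ-!≉0 n))) (*-identityʳ _)))

  1#^n≈1 : ∀ n → 1# ^ n ≈ 1#
  1#^n≈1 zero    = refl
  1#^n≈1 (suc n) = trans (*-identityˡ _) (1#^n≈1 n)

  1/1≈1 : fromℕ 1 ⁻¹ ≈ 1#
  1/1≈1 = trans (sym (*-identityˡ _)) (trans (*-congʳ (sym (+-identityʳ 1#)))
    (*-inverseʳ (fromℕ 1) (fromℕ-suc≉0 0)))

  exp₀≈1 : ∀ x → exp x 0 ≈ 1#
  exp₀≈1 x = trans (*-identityˡ _) 1/1≈1

  bernoulli-egf : ∀ x → (exp 1# ⊖ one) ⊛ egf (λ n → bernoulli n x) ≋ t⊛ (exp x)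
  bernoulli-egf x n = trans (⊛-congˡ (exp 1# ⊖ one) (egf-! q) n) (shifted n)
    where
    q : Series
    q = exp x ⊘ t⁻¹⊛ (exp 1# ⊖ one)
    head≈0 : ∀ y → (exp 1# ⊖ one) 0 * y ≈ 0#
    head≈0 y = trans (*-congʳ (trans (+-congʳ (exp₀≈1 1#)) (-‿inverseʳ 1#))) (zeroˡ y)
    const≈1 : t⁻¹⊛ (exp 1# ⊖ one) 0 ≈ 1#
    const≈1 = trans (+-cong (trans (*-congˡ 1/1≈1) (trans (*-identityʳ _) (1#^n≈1 1)))
                            (trans (sym (+-identityˡ _)) (-‿inverseʳ 0#)))
                    (+-identityʳ 1#)
    shifted : (exp 1# ⊖ one) ⊛ q ≋ t⊛ (exp x)
    shifted zero    = trans (+-identityʳ _) (head≈0 _)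
    shifted (suc n) = trans (+-congʳ (head≈0 _)) (trans (+-identityˡ _)
      (⊛-⊘ (exp x) (t⁻¹⊛ (exp 1# ⊖ one)) (λ eq → 0≉1 (trans (sym eq) const≈1)) n))

  euler-egf : ∀ x → (exp 1# ⊕ one) ⊛ egf (λ n → euler n x) ≋ fromℕ 2 · exp x
  euler-egf x n = trans (⊛-congˡ (exp 1# ⊕ one) (egf-! (fromℕ 2 · exp x ⊘ (exp 1# ⊕ one))) n)
    (⊛-⊘ (fromℕ 2 · exp x) (exp 1# ⊕ one) const≉0 n)
    where
    const≉0 : ¬ ((exp 1# ⊕ one) 0 ≈ 0#)
    const≉0 eq = fromℕ-suc≉0 1
      (trans (+-cong (sym (exp₀≈1 1#)) (+-identityʳ 1#)) eq)

{-# OPTIONS --safe #-}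
module Submission where

-- Write F(A,U) = e^{{A}U}/(e^U − 1), where {A} is the fractional part of A.  Since {A−B} is
-- {A} − {B} or {A} − {B} + 1, one has, for all real A and B and without exception at integers,
--   F(A,U) F(B,V) = F(B,U+V) F(A−B,U) − F(A,U+V) F(A−B,−V).
-- Take A = (μ+z)/c + (λ+x)/a and B = (μ+z)/c + (ν+y)/b and sum over μ mod c with the sign (−1)^μ.
-- The difference A − B does not depend on μ, and for c even the signed sum over μ turns the
-- Bernoulli functions of A and B into Euler functions, with a factor U + V that cancels.  Summing
-- over λ mod a and ν mod b and using the multiplication formula for Bernoulli functions gives the
-- reciprocity law.
open import Defs
open import Algebra.Bundles using (CommutativeRing)
import Algebra.Construct.Pointwise as Pointwise
import Algebra.Properties.CommutativeSemigroup as CommutativeSemigroupProperties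
import Algebra.Properties.CommutativeSemiring.Exp as CommutativeSemiringExp
import Algebra.Properties.Ring as RingProperties
import Algebra.Properties.Semiring.Exp as SemiringExp
import Algebra.Properties.Semiring.Mult as SemiringMult
import Algebra.Properties.Semiring.Sum as SemiringSum
import Algebra.Solver.Ring as RingSolver
open import Algebra.Solver.Ring.AlmostCommutativeRing using (_-Raw-AlmostCommutative⟶_; fromCommutativeRing)
import Algebra.Solver.Ring.NaturalCoefficients.Default as SemiringSolver
open import Data.Empty using (⊥-elim)
open import Data.Fin using (Fin; zero; suc; toℕ; opposite)
open import Data.Fin.Permutation using (reverse)
open import Data.Fin.Properties using (toℕ<n; opposite-prop)
open import Data.Integer as ℤ using (ℤ; -[1+_]; +_)
import Data.Integer.Properties as ℤ
open import Data.Maybe using (Maybe; map)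
open import Data.Nat as ℕ using (ℕ; zero; suc; _∸_; _!)
open import Data.Nat.Combinatorics using (_C_; nCk≡n!/k![n-k]!; nCk+nC[k+1]≡[n+1]C[k+1]; k![n∸k]!∣n!; k>n⇒nCk≡0)
open import Data.Nat.Divisibility using (_∣_; divides)
import Data.Nat.DivMod as ℕ
import Data.Nat.Properties as ℕ
open import Data.Product as Product using (_,_; proj₁; proj₂)
open import Data.Sum using (_⊎_; inj₁; inj₂)
open import Level using (Level; _⊔_)
open import Relation.Binary.Consequences using (dec⇒weaklyDec)
open import Relation.Binary.PropositionalEquality as ≡ using (_≡_)
import Relation.Binary.Reasoning.Setoid as SetoidReasoning
open import Relation.Binary.Structures using (IsDecTotalOrder)
open import Relation.Nullary using (¬_; yes; no; contradiction)

-- F has a pole at U = 0, so the identity is never written with quotients. Multiplied by U V (U +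
-- V), it becomes a relation between the power series U F(A,U), whose coefficients are Bernoulli
-- polynomials, and every division turns into the cancellation of a factor. U, V and U + V are
-- cancellable because the coefficients are torsion free; e^U - 1, e^V - 1 and e^{U+V} - 1 are
-- cancellable because they divide them. For a single pair of points the two terms on the right are
-- not separately multiples of U + V. They become so only after the signed sum, which is why U + V
-- is kept until then. Integer points need no exception because the series in -V is treated as a
-- series in V with exponent 1 - {A-B}, a number in (0,1] that is not reduced again. The same change
-- of sign produces (-1)^h. The constant -1/2 has two sources: Euler polynomials satisfy (e^t + 1) E
-- = 2 e^{wt}, and an alternating geometric sum of even length c has numerator 1 - e^{ct}, the
-- negative of the factor e^{ct} - 1 attached to the Bernoulli series.

-- Power series with exponential coefficients

module Hurwitz {k ℓ : Level} (K : CommutativeRing k ℓ) where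
  open CommutativeRing K hiding (zero)
  open SemiringExp semiring using (_^_)
  open CommutativeSemiringExp commutativeSemiring using (^-distrib-*)
  open SemiringMult semiring using (_×_; ×-homo-+; ×-congʳ; ×-congˡ; ×-homo-1)
  open SemiringSum semiring
  open CommutativeSemigroupProperties +-commutativeSemigroup using (interchange; x∙yz≈y∙xz)
  open SetoidReasoning setoid

  -- A sequence f stands for Σ fₙ tⁿ / n!, so that ∂ is d/dt and the product is
  -- determined by its constant term and the Leibniz rule.
  Series : Set k
  Series = ℕ → Carrier

  infix 4 _≋_
  _≋_ : Series → Series → Set ℓ
  f ≋ g = ∀ n → f n ≈ g n

  ∂ : Series → Series
  ∂ f n = f (suc n)

  infixl 6 _⊕_
  _⊕_ : Series → Series → Series
  (f ⊕ g) n = f n + g n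

  infixl 7 _⋆_
  _⋆_ : Series → Series → Series
  (f ⋆ g) zero    = f zero * g zero
  (f ⋆ g) (suc n) = (∂ f ⋆ g) n + (f ⋆ ∂ g) n

  const : Carrier → Series
  const x zero    = x
  const x (suc n) = 0#

  ⋆-cong : ∀ {f f′ g g′} → f ≋ f′ → g ≋ g′ → f ⋆ g ≋ f′ ⋆ g′
  ⋆-cong f≋ g≋ zero    = *-cong (f≋ 0) (g≋ 0)
  ⋆-cong f≋ g≋ (suc n) =
    +-cong (⋆-cong (λ i → f≋ (suc i)) g≋ n) (⋆-cong f≋ (λ i → g≋ (suc i)) n)

  ⋆-comm : ∀ f g → f ⋆ g ≋ g ⋆ f
  ⋆-comm f g zero    = *-comm _ _
  ⋆-comm f g (suc n) = trans (+-comm _ _) (+-cong (⋆-comm f (∂ g) n) (⋆-comm (∂ f) g n))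

  ⋆-distribʳ-⊕ : ∀ h f g → (f ⊕ g) ⋆ h ≋ f ⋆ h ⊕ g ⋆ h
  ⋆-distribʳ-⊕ h f g zero    = distribʳ _ _ _
  ⋆-distribʳ-⊕ h f g (suc n) =
    trans (+-cong (⋆-distribʳ-⊕ h (∂ f) (∂ g) n) (⋆-distribʳ-⊕ (∂ h) f g n))
          (interchange _ _ _ _)

  ⋆-distribˡ-⊕ : ∀ h f g → h ⋆ (f ⊕ g) ≋ h ⋆ f ⊕ h ⋆ g
  ⋆-distribˡ-⊕ h f g n = trans (⋆-comm h (f ⊕ g) n)
    (trans (⋆-distribʳ-⊕ h f g n) (+-cong (⋆-comm f h n) (⋆-comm g h n)))

  ⋆-assoc : ∀ f g h → (f ⋆ g) ⋆ h ≋ f ⋆ (g ⋆ h)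
  ⋆-assoc f g h zero    = *-assoc _ _ _
  ⋆-assoc f g h (suc n) = begin
    ((∂ f ⋆ g ⊕ f ⋆ ∂ g) ⋆ h) n + ((f ⋆ g) ⋆ ∂ h) n
      ≈⟨ +-cong (⋆-distribʳ-⊕ h (∂ f ⋆ g) (f ⋆ ∂ g) n) (⋆-assoc f g (∂ h) n) ⟩
    ((∂ f ⋆ g) ⋆ h) n + ((f ⋆ ∂ g) ⋆ h) n + (f ⋆ (g ⋆ ∂ h)) n
      ≈⟨ +-congʳ (+-cong (⋆-assoc (∂ f) g h n) (⋆-assoc f (∂ g) h n)) ⟩
    (∂ f ⋆ (g ⋆ h)) n + (f ⋆ (∂ g ⋆ h)) n + (f ⋆ (g ⋆ ∂ h)) n
      ≈⟨ +-assoc _ _ _ ⟩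
    (∂ f ⋆ (g ⋆ h)) n + ((f ⋆ (∂ g ⋆ h)) n + (f ⋆ (g ⋆ ∂ h)) n)
      ≈⟨ +-congˡ (⋆-distribˡ-⊕ f (∂ g ⋆ h) (g ⋆ ∂ h) n) ⟨
    (∂ f ⋆ (g ⋆ h)) n + (f ⋆ (∂ g ⋆ h ⊕ g ⋆ ∂ h)) n ∎

  0⋆ : ∀ f → (λ _ → 0#) ⋆ f ≋ (λ _ → 0#)
  0⋆ f zero    = zeroˡ _
  0⋆ f (suc n) = trans (+-cong (0⋆ f n) (0⋆ (∂ f) n)) (+-identityˡ _)

  const⋆ : ∀ x f n → (const x ⋆ f) n ≈ x * f n
  const⋆ x f zero    = refl
  const⋆ x f (suc n) = trans (+-cong (0⋆ f n) (const⋆ x (∂ f) n)) (+-identityˡ _)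

  one⋆ : ∀ f → const 1# ⋆ f ≋ f
  one⋆ f n = trans (const⋆ 1# f n) (*-identityˡ _)

  -- The result is again a commutative ring, so the construction can be applied to it once more;
  -- that is how series in two variables are obtained.
  hurwitzRing : CommutativeRing k ℓ
  hurwitzRing = record
    { Carrier = Series
    ; _≈_     = _≋_
    ; _+_     = _⊕_
    ; _*_     = _⋆_
    ; -_      = λ f n → - f n
    ; 0#      = λ _ → 0#
    ; 1#      = const 1#
    ; isCommutativeRing = record
      { isRing = record
        { +-isAbelianGroup = Pointwise.isAbelianGroup ℕ +-isAbelianGroup
        ; *-cong     = ⋆-cong
        ; *-assoc    = ⋆-assoc
        ; *-identity = one⋆ , λ f n → trans (⋆-comm f (const 1#) n) (one⋆ f n)
        ; distrib    = ⋆-distribˡ-⊕ , ⋆-distribʳ-⊕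
        }
      ; *-comm = ⋆-comm
      }
    }

  scale⋆ : ∀ x f g → (λ n → x * f n) ⋆ g ≋ λ n → x * (f ⋆ g) n
  scale⋆ x f g n = begin
    ((λ n → x * f n) ⋆ g) n  ≈⟨ ⋆-cong (const⋆ x f) (λ _ → refl) n ⟨
    ((const x ⋆ f) ⋆ g) n    ≈⟨ ⋆-assoc (const x) f g n ⟩
    (const x ⋆ (f ⋆ g)) n    ≈⟨ const⋆ x (f ⋆ g) n ⟩
    x * (f ⋆ g) n            ∎

  ⋆scale : ∀ x f g → f ⋆ (λ n → x * g n) ≋ λ n → x * (f ⋆ g) n
  ⋆scale x f g n = trans (⋆-comm f (λ i → x * g i) n)
    (trans (scale⋆ x g f n) (*-congˡ (⋆-comm g f n)))

  const-⋆-const : ∀ x y → const x ⋆ const y ≋ const (x * y)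
  const-⋆-const x y zero    = refl
  const-⋆-const x y (suc n) = trans (const⋆ x (const y) (suc n)) (zeroʳ x)

  t : Series
  t zero    = 0#
  t (suc n) = const 1# n

  -- The factor `suc n` is the price of exponential coefficients: dividing by t is possible exactly
  -- where multiples by positive integers can be cancelled.
  t⋆ : ∀ f n → (t ⋆ f) (suc n) ≈ suc n × f n
  t⋆ f zero    = trans (+-cong (one⋆ f 0) (zeroˡ _)) refl
  t⋆ f (suc n) = +-cong (one⋆ f (suc n)) (t⋆ (∂ f) n)

  exp : Carrier → Series
  exp x n = x ^ n

  -- Both sides have constant term 1 and solve the same equation `∂ f = (x + y) f`.
  exp-+ : ∀ x y → exp x ⋆ exp y ≋ exp (x + y)
  exp-+ x y zero    = *-identityˡ _
  exp-+ x y (suc n) = begin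
    ((λ i → x * exp x i) ⋆ exp y) n + (exp x ⋆ (λ i → y * exp y i)) n
      ≈⟨ +-cong (scale⋆ x (exp x) (exp y) n) (⋆scale y (exp x) (exp y) n) ⟩
    x * (exp x ⋆ exp y) n + y * (exp x ⋆ exp y) n
      ≈⟨ distribʳ _ x y ⟨
    (x + y) * (exp x ⋆ exp y) n
      ≈⟨ *-congˡ (exp-+ x y n) ⟩
    (x + y) * exp (x + y) n ∎

  -- f(t) ↦ f(xt)
  dilate : Carrier → Series → Series
  dilate x f n = x ^ n * f n

  dilate-⋆ : ∀ x f g → dilate x f ⋆ dilate x g ≋ dilate x (f ⋆ g)
  dilate-⋆ x f g zero    =
    trans (*-cong (*-identityˡ _) (*-identityˡ _)) (sym (*-identityˡ _))
  dilate-⋆ x f g (suc n) = begin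
    (∂ (dilate x f) ⋆ dilate x g) n + (dilate x f ⋆ ∂ (dilate x g)) n
      ≈⟨ +-cong (⋆-cong (λ i → *-assoc x _ _) (λ _ → refl) n)
                (⋆-cong (λ _ → refl) (λ i → *-assoc x _ _) n) ⟩
    ((λ i → x * dilate x (∂ f) i) ⋆ dilate x g) n + (dilate x f ⋆ (λ i → x * dilate x (∂ g) i)) n
      ≈⟨ +-cong (scale⋆ x _ _ n) (⋆scale x _ _ n) ⟩
    x * (dilate x (∂ f) ⋆ dilate x g) n + x * (dilate x f ⋆ dilate x (∂ g)) n
      ≈⟨ distribˡ x _ _ ⟨
    x * ((dilate x (∂ f) ⋆ dilate x g) n + (dilate x f ⋆ dilate x (∂ g)) n)
      ≈⟨ *-congˡ (+-cong (dilate-⋆ x (∂ f) g n) (dilate-⋆ x f (∂ g) n)) ⟩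
    x * (x ^ n * (∂ f ⋆ g) n + x ^ n * (f ⋆ ∂ g) n)
      ≈⟨ *-congˡ (distribˡ (x ^ n) _ _) ⟨
    x * (x ^ n * (f ⋆ g) (suc n))
      ≈⟨ *-assoc x _ _ ⟨
    x * x ^ n * (f ⋆ g) (suc n) ∎

  dilate-exp : ∀ x y → dilate x (exp y) ≋ exp (x * y)
  dilate-exp x y n = sym (^-distrib-* x y n)

  dilate-t : ∀ x n → dilate x t n ≈ x * t n
  dilate-t x zero          = trans (*-identityˡ _) (sym (zeroʳ x))
  dilate-t x (suc zero)    = *-congʳ (*-identityʳ x)
  dilate-t x (suc (suc n)) = trans (zeroʳ _) (sym (zeroʳ x))

  binomialSum : Series → Series → Series
  binomialSum f g n = ∑[ i ≤ n ] ((n C toℕ i) × (f (toℕ i) * g (n ∸ toℕ i)))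

  sum-snoc : ∀ (F : ℕ → Carrier) n → ∑[ i ≤ n ] F (toℕ i) ≈ ∑[ i < n ] F (toℕ i) + F n
  sum-snoc F zero    = +-comm _ _
  sum-snoc F (suc n) = trans (+-congˡ (sum-snoc (λ i → F (suc i)) n)) (sym (+-assoc _ _ _))

  -- Pascal's rule splits each coefficient. The part with `n C suc i` absorbs the leading term as
  -- its index 0, and its last term vanishes because `n C suc n` is 0.
  binomialSum-suc : ∀ f g n →
    binomialSum f g (suc n) ≈ binomialSum (∂ f) g n + binomialSum f (∂ g) n
  binomialSum-suc f g n = begin
    (suc n C 0) × (f 0 * g (suc n)) + ∑[ i ≤ n ] ((suc n C suc (toℕ i)) × ∂f*g (toℕ i))
      ≈⟨ +-cong (×-congˡ {f 0 * g (suc n)} {suc n C 0} {n C 0} ≡.refl) (sum-cong-≋ {suc n} λ i →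
           trans (×-congˡ (≡.sym (nCk+nC[k+1]≡[n+1]C[k+1] n (toℕ i))))
                 (×-homo-+ (∂f*g (toℕ i)) (n C toℕ i) (n C suc (toℕ i)))) ⟩
    (n C 0) × (f 0 * g (suc n))
      + ∑[ i ≤ n ] ((n C toℕ i) × ∂f*g (toℕ i) + (n C suc (toℕ i)) × ∂f*g (toℕ i))
      ≈⟨ +-congˡ (∑-distrib-+ {suc n} (λ i → (n C toℕ i) × ∂f*g (toℕ i))
                                      (λ i → (n C suc (toℕ i)) × ∂f*g (toℕ i))) ⟩
    (n C 0) × (f 0 * g (suc n))
      + (binomialSum (∂ f) g n + ∑[ i ≤ n ] ((n C suc (toℕ i)) × ∂f*g (toℕ i)))
      ≈⟨ x∙yz≈y∙xz _ _ _ ⟩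
    binomialSum (∂ f) g n
      + ∑[ i ≤ suc n ] ((n C toℕ i) × (f (toℕ i) * g (suc n ∸ toℕ i)))
      ≈⟨ +-congˡ (sum-snoc (λ i → (n C i) × (f i * g (suc n ∸ i))) (suc n)) ⟩
    binomialSum (∂ f) g n
      + (∑[ i ≤ n ] ((n C toℕ i) × (f (toℕ i) * g (suc n ∸ toℕ i)))
         + (n C suc n) × (f (suc n) * g (suc n ∸ suc n)))
      ≈⟨ +-congˡ (+-cong
           (sum-cong-≋ {suc n} λ i → ×-congʳ (n C toℕ i) (*-congˡ {f (toℕ i)}
             (reflexive (≡.cong g (ℕ.+-∸-assoc 1 {n} {toℕ i} (ℕ.≤-pred (toℕ<n i)))))))
           (×-congˡ {f (suc n) * g (suc n ∸ suc n)} (k>n⇒nCk≡0 (ℕ.n<1+n n)))) ⟩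
    binomialSum (∂ f) g n + (binomialSum f (∂ g) n + 0#)
      ≈⟨ +-congˡ (+-identityʳ _) ⟩
    binomialSum (∂ f) g n + binomialSum f (∂ g) n ∎
    where
    ∂f*g : ℕ → Carrier
    ∂f*g i = f (suc i) * g (n ∸ i)

  ⋆≋binomialSum : ∀ f g → f ⋆ g ≋ binomialSum f g
  ⋆≋binomialSum f g zero    = sym (trans (+-identityʳ _) (×-homo-1 _))
  ⋆≋binomialSum f g (suc n) = trans
    (+-cong (⋆≋binomialSum (∂ f) g n) (⋆≋binomialSum f (∂ g) n))
    (sym (binomialSum-suc f g n))

-- The three-term identity in an abstract commutative ring

module ThreeTerm {k ℓ : Level} (K : CommutativeRing k ℓ) where
  open CommutativeRing K hiding (zero)
  open SemiringSolver commutativeSemiring using (solve; _:+_; _:*_; _:=_; con)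
  open RingProperties ring using (-1*x≈-x; xyx⁻¹≈y; +-cancelʳ)
  open SetoidReasoning setoid

  -- Takes the place of invertibility: the elements e^U - 1 and U have no inverse among power
  -- series.
  Cancellable : Carrier → Set (k ⊔ ℓ)
  Cancellable x = ∀ {y z} → x * y ≈ x * z → y ≈ z

  -- Meant for x = e^t - 1 and z = t, with the Bernoulli series at 0 as the cofactor y.
  cancellable-factor : ∀ {x y z} → x * y ≈ z → Cancellable z → Cancellable x
  cancellable-factor {x} {y} {z} xy≈z cancel {u} {v} xu≈xv = cancel (begin
    z * u        ≈⟨ *-congʳ xy≈z ⟨
    x * y * u    ≈⟨ solve 3 (λ x y u → x :* y :* u := y :* (x :* u)) refl x y u ⟩
    y * (x * u)  ≈⟨ *-congˡ xu≈xv ⟩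
    y * (x * v)  ≈⟨ solve 3 (λ x y u → x :* y :* u := y :* (x :* u)) refl x y v ⟨
    x * y * v    ≈⟨ *-congʳ xy≈z ⟩
    z * v        ∎)

  sub-one-* : ∀ {X b g} → X * b ≈ b + g → (X - 1#) * b ≈ g
  sub-one-* {X} {b} {g} Xb≈b+g = begin
    (X - 1#) * b        ≈⟨ distribʳ b X (- 1#) ⟩
    X * b + - 1# * b    ≈⟨ +-cong Xb≈b+g (-1*x≈-x b) ⟩
    b + g - b           ≈⟨ xyx⁻¹≈y b g ⟩
    g                   ∎

  sub-one-+ : ∀ X → X - 1# + 1# ≈ X
  sub-one-+ X = trans (+-assoc _ _ _) (trans (+-congˡ (-‿inverseˡ 1#)) (+-identityʳ X))

  -- The semiring solver knows no subtraction, so `X - 1#` and `Y - 1#` are made its atoms and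
  -- e^{U+V} - 1 is expressed through them.
  sub-one-product : ∀ X Y → X * Y - 1# ≈ (X - 1#) * (Y - 1#) + (X - 1#) + (Y - 1#)
  sub-one-product X Y = +-cancelʳ 1# _ _ (begin
    X * Y - 1# + 1#                                        ≈⟨ sub-one-+ (X * Y) ⟩
    X * Y                                                  ≈⟨ *-cong (sub-one-+ X) (sub-one-+ Y) ⟨
    (X - 1# + 1#) * (Y - 1# + 1#)
      ≈⟨ solve 2 (λ P Q → (P :+ con 1) :* (Q :+ con 1) := P :* Q :+ P :+ Q :+ con 1)
           refl (X - 1#) (Y - 1#) ⟩
    (X - 1#) * (Y - 1#) + (X - 1#) + (Y - 1#) + 1#         ∎)

  -- P, Q, T stand for e^U − 1, e^V − 1, e^{U+V} − 1; α₁, γ₂, α₂, γ₁, δ₁, δ₂ for e^{αU}, e^{γV},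
  -- e^{αV}, e^{γU}, e^{δU}, e^{(1−δ)V}; and bα, bγ, bαW, bγW, bδ, bδ′ for the Bernoulli series in
  -- U, V, U + V, U + V, U, −V at the points α, γ, α, γ, δ, δ.
  three-term : ∀ {P Q T U V W α₁ γ₂ α₂ γ₁ δ₁ δ₂ bα bγ bαW bγW bδ bδ′} →
    Cancellable P → Cancellable Q → Cancellable T →
    P * bα ≈ U * α₁ → Q * bγ ≈ V * γ₂ →
    T * bαW ≈ W * (α₁ * α₂) → T * bγW ≈ W * (γ₁ * γ₂) →
    P * bδ ≈ U * δ₁ → Q * bδ′ ≈ V * δ₂ →
    Q * (γ₁ * δ₁) * γ₂ + P * (α₂ * δ₂) * α₁ ≈ T * (α₁ * γ₂) →
    W * (bα * bγ) ≈ V * (bδ * bγW) + U * (bαW * bδ′)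
  three-term {P} {Q} {T} {U} {V} {W} {α₁} {γ₂} {α₂} {γ₁} {δ₁} {δ₂} {bα} {bγ} {bαW} {bγW} {bδ} {bδ′}
    cP cQ cT hα hγ hαW hγW hδ hδ′ h = cP (cQ (cT (begin
    -- Multiplied by `T Q P`, every Bernoulli series meets its own denominator and becomes an
    -- exponential; what is left is `U V W` times the hypothesis `h`.
    T * (Q * (P * (W * (bα * bγ))))
      ≈⟨ solve 6 (λ T Q P W a g → T :* (Q :* (P :* (W :* (a :* g)))) := T :* W :* ((P :* a) :* (Q :* g)))
           refl T Q P W bα bγ ⟩
    T * W * ((P * bα) * (Q * bγ))
      ≈⟨ *-congˡ (*-cong hα hγ) ⟩
    T * W * ((U * α₁) * (V * γ₂))
      ≈⟨ solve 6 (λ T W U V a g → T :* W :* ((U :* a) :* (V :* g)) := U :* V :* W :* (T :* (a :* g)))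
           refl T W U V α₁ γ₂ ⟩
    U * V * W * (T * (α₁ * γ₂))
      ≈⟨ *-congˡ h ⟨
    U * V * W * (Q * (γ₁ * δ₁) * γ₂ + P * (α₂ * δ₂) * α₁)
      ≈⟨ lemma₁ ⟩
    V * Q * ((U * δ₁) * (W * (γ₁ * γ₂))) + U * P * ((W * (α₁ * α₂)) * (V * δ₂))
      ≈⟨ +-cong (*-congˡ (*-cong hδ hγW)) (*-congˡ (*-cong hαW hδ′)) ⟨
    V * Q * ((P * bδ) * (T * bγW)) + U * P * ((T * bαW) * (Q * bδ′))
      ≈⟨ lemma₂ ⟩
    T * (Q * (P * (V * (bδ * bγW) + U * (bαW * bδ′)))) ∎)))
    where
    lemma₁ : U * V * W * (Q * (γ₁ * δ₁) * γ₂ + P * (α₂ * δ₂) * α₁) ≈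
             V * Q * ((U * δ₁) * (W * (γ₁ * γ₂))) + U * P * ((W * (α₁ * α₂)) * (V * δ₂))
    lemma₁ = trans (distribˡ _ _ _) (+-cong
      (solve 7 (λ U V W Q γ₁ δ₁ γ₂ → U :* V :* W :* (Q :* (γ₁ :* δ₁) :* γ₂)
                  := V :* Q :* ((U :* δ₁) :* (W :* (γ₁ :* γ₂))))
         refl U V W Q γ₁ δ₁ γ₂)
      (solve 7 (λ U V W P α₂ δ₂ α₁ → U :* V :* W :* (P :* (α₂ :* δ₂) :* α₁)
                  := U :* P :* ((W :* (α₁ :* α₂)) :* (V :* δ₂)))
         refl U V W P α₂ δ₂ α₁))
    lemma₂ : V * Q * ((P * bδ) * (T * bγW)) + U * P * ((T * bαW) * (Q * bδ′)) ≈
             T * (Q * (P * (V * (bδ * bγW) + U * (bαW * bδ′))))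
    lemma₂ = solve 9 (λ T Q P U V d g a d′ →
        V :* Q :* ((P :* d) :* (T :* g)) :+ U :* P :* ((T :* a) :* (Q :* d′))
        := T :* (Q :* (P :* (V :* (d :* g) :+ U :* (a :* d′)))))
      refl T Q P U V bδ bγW bαW bδ′

  module _ {X Y : Carrier} where
    private
      P = X - 1#
      Q = Y - 1#
      T = X * Y - 1#

    -- Case γ + δ = α, where α + (1 - δ) = γ + 1. The identity is XY - 1 = (Y - 1) + (X - 1) Y.
    exponents-no-carry : ∀ {α₁ γ₂ α₂ γ₁ δ₁ δ₂} → γ₁ * δ₁ ≈ α₁ → α₂ * δ₂ ≈ γ₂ * Y →
      Q * (γ₁ * δ₁) * γ₂ + P * (α₂ * δ₂) * α₁ ≈ T * (α₁ * γ₂)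
    exponents-no-carry {α₁} {γ₂} {α₂} {γ₁} {δ₁} {δ₂} γδ≈α αδ≈γY = begin
      Q * (γ₁ * δ₁) * γ₂ + P * (α₂ * δ₂) * α₁
        ≈⟨ +-cong (*-congʳ (*-congˡ γδ≈α))
                  (*-congʳ (*-congˡ (trans αδ≈γY (*-congˡ (sym (sub-one-+ Y)))))) ⟩
      Q * α₁ * γ₂ + P * (γ₂ * (Q + 1#)) * α₁
        ≈⟨ solve 4 (λ P Q α γ → Q :* α :* γ :+ P :* (γ :* (Q :+ con 1)) :* α
                      := (P :* Q :+ P :+ Q) :* (α :* γ)) refl P Q α₁ γ₂ ⟩
      (P * Q + P + Q) * (α₁ * γ₂)
        ≈⟨ *-congʳ (sub-one-product X Y) ⟨
      T * (α₁ * γ₂) ∎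

    -- Case γ + δ = α + 1, where α + (1 - δ) = γ. The surplus exponential moves to the other term:
    -- XY - 1 = (Y - 1) X + (X - 1).
    exponents-carry : ∀ {α₁ γ₂ α₂ γ₁ δ₁ δ₂} → γ₁ * δ₁ ≈ α₁ * X → α₂ * δ₂ ≈ γ₂ →
      Q * (γ₁ * δ₁) * γ₂ + P * (α₂ * δ₂) * α₁ ≈ T * (α₁ * γ₂)
    exponents-carry {α₁} {γ₂} {α₂} {γ₁} {δ₁} {δ₂} γδ≈αX αδ≈γ = begin
      Q * (γ₁ * δ₁) * γ₂ + P * (α₂ * δ₂) * α₁
        ≈⟨ +-cong (*-congʳ (*-congˡ (trans γδ≈αX (*-congˡ (sym (sub-one-+ X))))))
                  (*-congʳ (*-congˡ αδ≈γ)) ⟩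
      Q * (α₁ * (P + 1#)) * γ₂ + P * γ₂ * α₁
        ≈⟨ solve 4 (λ P Q α γ → Q :* (α :* (P :+ con 1)) :* γ :+ P :* γ :* α
                      := (P :* Q :+ P :+ Q) :* (α :* γ)) refl P Q α₁ γ₂ ⟩
      (P * Q + P + Q) * (α₁ * γ₂)
        ≈⟨ *-congʳ (sub-one-product X Y) ⟨
      T * (α₁ * γ₂) ∎

  reflect : ∀ {e e′ d τ t x} → e * e′ ≈ 1# → τ + t ≈ 0# → e′ * d ≈ d + τ * x →
            e * d ≈ d + t * (e * x)
  reflect {e} {e′} {d} {τ} {t} {x} ee′≈1 τ+t≈0 e′d≈ = sym (begin
    d + t * (e * x)
      ≈⟨ +-congʳ (trans (*-congʳ ee′≈1) (*-identityˡ d)) ⟨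
    e * e′ * d + t * (e * x)
      ≈⟨ +-congʳ (trans (*-assoc e e′ d) (*-congˡ e′d≈)) ⟩
    e * (d + τ * x) + t * (e * x)
      ≈⟨ solve 5 (λ e d τ t x → e :* (d :+ τ :* x) :+ t :* (e :* x) := e :* d :+ (τ :+ t) :* (e :* x))
           refl e d τ t x ⟩
    e * d + (τ + t) * (e * x)
      ≈⟨ +-congˡ (trans (*-congʳ τ+t≈0) (zeroˡ _)) ⟩
    e * d + 0#
      ≈⟨ +-identityʳ _ ⟩
    e * d ∎)

-- Two-variable series and the addition formula

-- Series in two variables U (outer) and V (inner).
module Bivariate {k ℓ : Level} (K : CommutativeRing k ℓ) where
  open CommutativeRing K hiding (zero)
  open Hurwitz K
  open SemiringExp semiring using (_^_; ^-congˡ; ^-homo-*)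
  open SemiringMult semiring using (_×_; ×-congʳ)
  open SemiringSum semiring using (sum; sum-syntax; sum⁺-syntax; sum-cong-≋)
  open SetoidReasoning setoid

  private
    module H₁ = CommutativeRing hurwitzRing
    module H₂ = Hurwitz hurwitzRing
    module R₂ = CommutativeRing H₂.hurwitzRing
    module Σ₁ = SemiringSum H₁.semiring
    module Σ₂ = SemiringSum R₂.semiring
    module M₁ = SemiringMult H₁.semiring

  -- `ι₁` and `ι₂` substitute U and V. With exponential coefficients the substitution of U + V
  -- involves no binomial coefficients.
  ι₁ ι₂ σ : Series → H₂.Series
  ι₁ f p     = const (f p)
  ι₂ f       = H₂.const f
  -- f(t) ↦ f(U + V)
  σ  f p q   = f (p ℕ.+ q)

  const-cong : ∀ {x y} → x ≈ y → const x ≋ const y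
  const-cong x≈y zero    = x≈y
  const-cong x≈y (suc n) = refl

  const-+ : ∀ x y → const x ⊕ const y ≋ const (x + y)
  const-+ x y zero    = refl
  const-+ x y (suc n) = +-identityˡ _

  ι₁-cong : ∀ {f g} → f ≋ g → ι₁ f R₂.≈ ι₁ g
  ι₁-cong f≋g p = const-cong (f≋g p)

  ι₁-⋆ : ∀ f g → ι₁ f H₂.⋆ ι₁ g R₂.≈ ι₁ (f ⋆ g)
  ι₁-⋆ f g zero    = const-⋆-const (f 0) (g 0)
  ι₁-⋆ f g (suc p) = H₁.trans (H₁.+-cong (ι₁-⋆ (∂ f) g p) (ι₁-⋆ f (∂ g) p)) (const-+ _ _)

  ι₂-cong : ∀ {f g} → f ≋ g → ι₂ f R₂.≈ ι₂ g
  ι₂-cong f≋g zero    = f≋g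
  ι₂-cong f≋g (suc p) = H₁.refl

  ι₂-⊕ : ∀ f g → ι₂ f R₂.+ ι₂ g R₂.≈ ι₂ (f ⊕ g)
  ι₂-⊕ f g zero    = H₁.refl
  ι₂-⊕ f g (suc p) = H₁.+-identityˡ _

  σ-cong : ∀ {f g} → f ≋ g → σ f R₂.≈ σ g
  σ-cong f≋g p q = f≋g (p ℕ.+ q)

  σ-⋆ : ∀ f g → σ f H₂.⋆ σ g R₂.≈ σ (f ⋆ g)
  σ-⋆ f g zero    q = refl
  σ-⋆ f g (suc p) q = +-cong (σ-⋆ (∂ f) g p q) (σ-⋆ f (∂ g) p q)

  σ-exp : ∀ x → σ (exp x) R₂.≈ ι₁ (exp x) H₂.⋆ ι₂ (exp x)
  σ-exp x p q = sym (begin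
    (ι₁ (exp x) H₂.⋆ ι₂ (exp x)) p q  ≈⟨ H₂.⋆-comm (ι₁ (exp x)) (ι₂ (exp x)) p q ⟩
    (ι₂ (exp x) H₂.⋆ ι₁ (exp x)) p q  ≈⟨ H₂.const⋆ (exp x) (ι₁ (exp x)) p q ⟩
    (exp x ⋆ const (x ^ p)) q         ≈⟨ ⋆-comm (exp x) (const (x ^ p)) q ⟩
    (const (x ^ p) ⋆ exp x) q         ≈⟨ const⋆ (x ^ p) (exp x) q ⟩
    x ^ p * x ^ q                     ≈⟨ ^-homo-* x p q ⟨
    x ^ (p ℕ.+ q)                     ∎)

  ι₁-t : ι₁ t R₂.≈ H₂.t
  ι₁-t zero          zero    = refl
  ι₁-t zero          (suc q) = refl
  ι₁-t (suc zero)    q       = refl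
  ι₁-t (suc (suc p)) zero    = refl
  ι₁-t (suc (suc p)) (suc q) = refl

  σ-t : σ t R₂.≈ H₂.t R₂.+ ι₂ t
  σ-t zero          q = sym (+-identityˡ _)
  σ-t (suc zero)    q = sym (+-identityʳ _)
  σ-t (suc (suc p)) q = sym (+-identityˡ _)

  sum-at : ∀ {m} (F : Fin m → Series) n → Σ₁.sum F n ≈ sum (λ i → F i n)
  sum-at {zero}  F n = refl
  sum-at {suc m} F n = +-congˡ (sum-at (λ i → F (suc i)) n)

  sum-at₂ : ∀ {m} (F : Fin m → H₂.Series) p q → Σ₂.sum F p q ≈ sum (λ i → F i p q)
  sum-at₂ {zero}  F p q = refl
  sum-at₂ {suc m} F p q = +-congˡ (sum-at₂ (λ i → F (suc i)) p q)

  ×-at : ∀ m f n → (m M₁.× f) n ≈ m × f n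
  ×-at zero    f n = refl
  ×-at (suc m) f n = +-congˡ (×-at m f n)

  -- The factor V lowers the second index by one and contributes `suc q`. This is the origin of the
  -- factor q before the first sum of the theorem, and of the index p + q - j - 1 of its Euler
  -- functions.
  coefficient-V : ∀ d g p q →
    (ι₂ t H₂.⋆ (ι₁ d H₂.⋆ σ g)) p (suc q) ≈
    suc q × (∑[ i ≤ p ] ((p C toℕ i) × (d (toℕ i) * g (p ∸ toℕ i ℕ.+ q))))
  coefficient-V d g p q = begin
    (ι₂ t H₂.⋆ (ι₁ d H₂.⋆ σ g)) p (suc q)
      ≈⟨ H₂.const⋆ t (ι₁ d H₂.⋆ σ g) p (suc q) ⟩
    (t ⋆ (ι₁ d H₂.⋆ σ g) p) (suc q)
      ≈⟨ t⋆ ((ι₁ d H₂.⋆ σ g) p) q ⟩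
    suc q × (ι₁ d H₂.⋆ σ g) p q
      ≈⟨ ×-congʳ (suc q) (H₂.⋆≋binomialSum (ι₁ d) (σ g) p q) ⟩
    suc q × H₂.binomialSum (ι₁ d) (σ g) p q
      ≈⟨ ×-congʳ (suc q) (sum-at {suc p}
           (λ i → (p C toℕ i) M₁.× (const (d (toℕ i)) ⋆ σ g (p ∸ toℕ i))) q) ⟩
    suc q × (∑[ i ≤ p ] (((p C toℕ i) M₁.× (const (d (toℕ i)) ⋆ σ g (p ∸ toℕ i))) q))
      ≈⟨ ×-congʳ (suc q) (sum-cong-≋ {suc p} λ i → trans
           (×-at (p C toℕ i) (const (d (toℕ i)) ⋆ σ g (p ∸ toℕ i)) q)
           (×-congʳ (p C toℕ i) (const⋆ (d (toℕ i)) (σ g (p ∸ toℕ i)) q))) ⟩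
    suc q × (∑[ i ≤ p ] ((p C toℕ i) × (d (toℕ i) * g (p ∸ toℕ i ℕ.+ q)))) ∎

  -- The counterpart for the second sum. `ι₁ t` is first recognised as the outer variable, for which
  -- `H₂.t⋆` holds.
  coefficient-U : ∀ f d p q →
    (ι₁ t H₂.⋆ (σ f H₂.⋆ ι₂ d)) (suc p) q ≈
    suc p × (∑[ i ≤ q ] ((q C toℕ i) × (d (toℕ i) * f (p ℕ.+ (q ∸ toℕ i)))))
  coefficient-U f d p q = begin
    (ι₁ t H₂.⋆ (σ f H₂.⋆ ι₂ d)) (suc p) q
      ≈⟨ H₂.⋆-cong ι₁-t (H₂.⋆-comm (σ f) (ι₂ d)) (suc p) q ⟩
    (H₂.t H₂.⋆ (ι₂ d H₂.⋆ σ f)) (suc p) q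
      ≈⟨ H₂.t⋆ (ι₂ d H₂.⋆ σ f) p q ⟩
    (suc p M₁.× (ι₂ d H₂.⋆ σ f) p) q
      ≈⟨ ×-at (suc p) ((ι₂ d H₂.⋆ σ f) p) q ⟩
    suc p × (ι₂ d H₂.⋆ σ f) p q
      ≈⟨ ×-congʳ (suc p) (H₂.const⋆ d (σ f) p q) ⟩
    suc p × (d ⋆ σ f p) q
      ≈⟨ ×-congʳ (suc p) (⋆≋binomialSum d (σ f p) q) ⟩
    suc p × binomialSum d (σ f p) q ∎

  module TorsionFree (torsionFree : ∀ n {x y} → suc n × x ≈ suc n × y → x ≈ y) where
    open ThreeTerm hurwitzRing using () renaming (Cancellable to Cancellable₁)
    open ThreeTerm H₂.hurwitzRing

    t-cancellable : Cancellable₁ t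
    t-cancellable {f} {g} tf≋tg n =
      torsionFree n (trans (sym (t⋆ f n)) (trans (tf≋tg (suc n)) (t⋆ g n)))

    ι₂t-cancellable : Cancellable (ι₂ t)
    ι₂t-cancellable {F} {G} eq p = t-cancellable
      (H₁.trans (H₁.sym (H₂.const⋆ t F p)) (H₁.trans (eq p) (H₂.const⋆ t G p)))

    t₂⋆ : ∀ F p q → (H₂.t H₂.⋆ F) (suc p) q ≈ suc p × F p q
    t₂⋆ F p q = trans (H₂.t⋆ F p q) (×-at (suc p) (F p) q)

    ι₁t-cancellable : Cancellable (ι₁ t)
    ι₁t-cancellable {F} {G} eq p q = torsionFree p (begin
      suc p × F p q            ≈⟨ t₂⋆ F p q ⟨
      (H₂.t H₂.⋆ F) (suc p) q  ≈⟨ H₂.⋆-cong ι₁-t (R₂.refl {F}) (suc p) q ⟨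
      (ι₁ t H₂.⋆ F) (suc p) q  ≈⟨ eq (suc p) q ⟩
      (ι₁ t H₂.⋆ G) (suc p) q  ≈⟨ H₂.⋆-cong ι₁-t (R₂.refl {G}) (suc p) q ⟩
      (H₂.t H₂.⋆ G) (suc p) q  ≈⟨ t₂⋆ G p q ⟩
      suc p × G p q            ∎)

    σt⋆ : ∀ F p q → (σ t H₂.⋆ F) (suc p) q ≈ suc p × F p q + (t ⋆ F (suc p)) q
    σt⋆ F p q = trans (H₂.⋆-cong σ-t (R₂.refl {F}) (suc p) q)
      (trans (H₂.⋆-distribʳ-⊕ F H₂.t (ι₂ t) (suc p) q)
             (+-cong (t₂⋆ F p q) (H₂.const⋆ t F (suc p) q)))

    -- Induction on the power of U: the coefficient of (U + V) F at `suc p` is `suc p × F p` plus V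
    -- times `F (suc p)`. The first part is known by induction, and V is cancellable.
    σt-cancellable : Cancellable (σ t)
    σt-cancellable {F} {G} eq zero    = t-cancellable (eq 0)
    σt-cancellable {F} {G} eq (suc p) = t-cancellable λ q →
      +-cancelˡ (suc p × F p q) _ _ (begin
        suc p × F p q + (t ⋆ F (suc p)) q  ≈⟨ σt⋆ F p q ⟨
        (σ t H₂.⋆ F) (suc p) q             ≈⟨ eq (suc p) q ⟩
        (σ t H₂.⋆ G) (suc p) q             ≈⟨ σt⋆ G p q ⟩
        suc p × G p q + (t ⋆ G (suc p)) q  ≈⟨ +-congʳ (×-congʳ (suc p) (σt-cancellable eq p q)) ⟨
        suc p × F p q + (t ⋆ G (suc p)) q  ∎)
      where open RingProperties ring using (+-cancelˡ)

    -- Everything about Bernoulli polynomials is drawn from this difference equation. It determines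
    -- `b x`, since e^t - 1 is cancellable.
    module AppellBernoulli (b : Carrier → Series)
      (b-difference : ∀ x → exp 1# ⋆ b x ≋ b x ⊕ t ⋆ exp x) where

      dilate-⊕ : ∀ x f g → dilate x (f ⊕ g) ≋ dilate x f ⊕ dilate x g
      dilate-⊕ x f g n = distribˡ (x ^ n) (f n) (g n)

      exp-cong : ∀ {x y} → x ≈ y → exp x ≋ exp y
      exp-cong x≈y n = ^-congˡ n x≈y

      exp-0 : exp 0# ≋ const 1#
      exp-0 zero    = refl
      exp-0 (suc n) = zeroˡ _

      reflected : Carrier → Series
      reflected x = dilate (- 1#) (b x)

      -- The form of B_n(1 - x) = (-1)^n B_n(x) that is needed. At x = 0 the exponent on the right
      -- is 1, in agreement with (-1) B_1(0) = B_1(1).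
      reflected-difference : ∀ x → exp 1# ⋆ reflected x ≋ reflected x ⊕ t ⋆ exp (1# - x)
      reflected-difference x = H₁.trans
        (T₁.reflect {exp 1#} {exp (- 1#)} {reflected x} {dilate (- 1#) t} {t} {exp (- x)}
          (H₁.trans (exp-+ 1# (- 1#)) (H₁.trans (exp-cong (-‿inverseʳ 1#)) exp-0))
          (λ n → trans (+-congʳ (trans (dilate-t (- 1#) n) (-1*x≈-x (t n)))) (-‿inverseˡ (t n)))
          e′d≈)
        (H₁.+-congˡ {reflected x} (H₁.*-congˡ {t} (exp-+ 1# (- x))))
        where
        module T₁ = ThreeTerm hurwitzRing
        open RingProperties ring using (-1*x≈-x)
        e′d≈ : exp (- 1#) ⋆ reflected x ≋ reflected x ⊕ dilate (- 1#) t ⋆ exp (- x)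
        e′d≈ n = begin
          (exp (- 1#) ⋆ reflected x) n
            ≈⟨ ⋆-cong (H₁.trans (exp-cong (sym (*-identityʳ (- 1#))))
                                (H₁.sym (dilate-exp (- 1#) 1#))) (H₁.refl {reflected x}) n ⟩
          (dilate (- 1#) (exp 1#) ⋆ reflected x) n
            ≈⟨ dilate-⋆ (- 1#) (exp 1#) (b x) n ⟩
          dilate (- 1#) (exp 1# ⋆ b x) n
            ≈⟨ *-congˡ (b-difference x n) ⟩
          dilate (- 1#) (b x ⊕ t ⋆ exp x) n
            ≈⟨ dilate-⊕ (- 1#) (b x) (t ⋆ exp x) n ⟩
          reflected x n + dilate (- 1#) (t ⋆ exp x) n
            ≈⟨ +-congˡ (trans (sym (dilate-⋆ (- 1#) t (exp x) n))
                 (⋆-cong (H₁.refl {dilate (- 1#) t})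
                   (H₁.trans (dilate-exp (- 1#) x) (exp-cong (-1*x≈-x x))) n)) ⟩
          reflected x n + (dilate (- 1#) t ⋆ exp (- x)) n ∎

      private
        X Y : H₂.Series
        X = ι₁ (exp 1#)
        Y = ι₂ (exp 1#)

      ι₁-difference : ∀ x → X H₂.⋆ ι₁ (b x) R₂.≈ ι₁ (b x) R₂.+ ι₁ t H₂.⋆ ι₁ (exp x)
      ι₁-difference x = R₂.trans (ι₁-⋆ (exp 1#) (b x)) (R₂.trans (ι₁-cong (b-difference x))
        (R₂.trans (λ p → H₁.sym (const-+ (b x p) ((t ⋆ exp x) p)))
                  (R₂.+-congˡ {ι₁ (b x)} (R₂.sym (ι₁-⋆ t (exp x))))))

      ι₂-difference : ∀ {f x} → exp 1# ⋆ f ≋ f ⊕ t ⋆ exp x →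
                      Y H₂.⋆ ι₂ f R₂.≈ ι₂ f R₂.+ ι₂ t H₂.⋆ ι₂ (exp x)
      ι₂-difference {f} {x} eq = R₂.trans (H₂.const-⋆-const (exp 1#) f) (R₂.trans (ι₂-cong eq)
        (R₂.trans (R₂.sym (ι₂-⊕ f (t ⋆ exp x)))
                  (R₂.+-congˡ {ι₂ f} (R₂.sym (H₂.const-⋆-const t (exp x))))))

      σ-difference : ∀ x → (X H₂.⋆ Y) H₂.⋆ σ (b x) R₂.≈
                           σ (b x) R₂.+ σ t H₂.⋆ (ι₁ (exp x) H₂.⋆ ι₂ (exp x))
      σ-difference x = R₂.trans (R₂.*-congʳ {σ (b x)} (R₂.sym (σ-exp 1#)))
        (R₂.trans (σ-⋆ (exp 1#) (b x)) (R₂.trans (σ-cong (b-difference x))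
        (R₂.+-congˡ {σ (b x)} (R₂.trans (R₂.sym (σ-⋆ t (exp x))) (R₂.*-congˡ {σ t} (σ-exp x))))))

      private
        ι₁-exp-0 : ι₁ (exp 0#) R₂.≈ R₂.1#
        ι₁-exp-0 zero    q       = refl
        ι₁-exp-0 (suc p) zero    = zeroˡ _
        ι₁-exp-0 (suc p) (suc q) = refl

        ι₂-exp-0 : ι₂ (exp 0#) R₂.≈ R₂.1#
        ι₂-exp-0 = ι₂-cong exp-0

        X-1-cancellable : Cancellable (X R₂.- R₂.1#)
        X-1-cancellable = cancellable-factor {X R₂.- R₂.1#} {ι₁ (b 0#)} {ι₁ t}
          (R₂.trans (sub-one-* {X} {ι₁ (b 0#)} (ι₁-difference 0#))
            (R₂.trans (R₂.*-congˡ {ι₁ t} ι₁-exp-0) (R₂.*-identityʳ (ι₁ t))))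
          ι₁t-cancellable

        Y-1-cancellable : Cancellable (Y R₂.- R₂.1#)
        Y-1-cancellable = cancellable-factor {Y R₂.- R₂.1#} {ι₂ (b 0#)} {ι₂ t}
          (R₂.trans (sub-one-* {Y} {ι₂ (b 0#)} (ι₂-difference (b-difference 0#)))
            (R₂.trans (R₂.*-congˡ {ι₂ t} ι₂-exp-0) (R₂.*-identityʳ (ι₂ t))))
          ι₂t-cancellable

        XY-1-cancellable : Cancellable (X H₂.⋆ Y R₂.- R₂.1#)
        XY-1-cancellable = cancellable-factor {X H₂.⋆ Y R₂.- R₂.1#} {σ (b 0#)} {σ t}
          (R₂.trans (sub-one-* {X H₂.⋆ Y} {σ (b 0#)} (σ-difference 0#))
            (R₂.trans (R₂.*-congˡ {σ t} (R₂.trans (R₂.*-cong ι₁-exp-0 ι₂-exp-0) (R₂.*-identityʳ R₂.1#)))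
                      (R₂.*-identityʳ (σ t))))
          σt-cancellable

        fromExponents : ∀ α γ δ →
          (Y R₂.- R₂.1#) H₂.⋆ (ι₁ (exp γ) H₂.⋆ ι₁ (exp δ)) H₂.⋆ ι₂ (exp γ) R₂.+
          (X R₂.- R₂.1#) H₂.⋆ (ι₂ (exp α) H₂.⋆ ι₂ (exp (1# - δ))) H₂.⋆ ι₁ (exp α) R₂.≈
          (X H₂.⋆ Y R₂.- R₂.1#) H₂.⋆ (ι₁ (exp α) H₂.⋆ ι₂ (exp γ)) →
          σ t H₂.⋆ (ι₁ (b α) H₂.⋆ ι₂ (b γ)) R₂.≈
          ι₂ t H₂.⋆ (ι₁ (b δ) H₂.⋆ σ (b γ)) R₂.+ ι₁ t H₂.⋆ (σ (b α) H₂.⋆ ι₂ (reflected δ))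
        fromExponents α γ δ = three-term
          {X R₂.- R₂.1#} {Y R₂.- R₂.1#} {X H₂.⋆ Y R₂.- R₂.1#} {ι₁ t} {ι₂ t} {σ t}
          {ι₁ (exp α)} {ι₂ (exp γ)} {ι₂ (exp α)} {ι₁ (exp γ)} {ι₁ (exp δ)} {ι₂ (exp (1# - δ))}
          {ι₁ (b α)} {ι₂ (b γ)} {σ (b α)} {σ (b γ)} {ι₁ (b δ)} {ι₂ (reflected δ)}
          X-1-cancellable Y-1-cancellable XY-1-cancellable
          (sub-one-* {X} {ι₁ (b α)} (ι₁-difference α))
          (sub-one-* {Y} {ι₂ (b γ)} (ι₂-difference (b-difference γ)))
          (sub-one-* {X H₂.⋆ Y} {σ (b α)} (σ-difference α))
          (sub-one-* {X H₂.⋆ Y} {σ (b γ)} (σ-difference γ))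
          (sub-one-* {X} {ι₁ (b δ)} (ι₁-difference δ))
          (sub-one-* {Y} {ι₂ (reflected δ)} (ι₂-difference (reflected-difference δ)))

      -- No order enters: of the fractional parts only the relation between their sum and α, up to a
      -- carry of 1, is used.
      addition-formula : ∀ α γ δ → γ + δ ≈ α ⊎ γ + δ ≈ α + 1# →
        σ t H₂.⋆ (ι₁ (b α) H₂.⋆ ι₂ (b γ)) R₂.≈
        ι₂ t H₂.⋆ (ι₁ (b δ) H₂.⋆ σ (b γ)) R₂.+ ι₁ t H₂.⋆ (σ (b α) H₂.⋆ ι₂ (reflected δ))
      addition-formula α γ δ (inj₁ γ+δ≈α) = fromExponents α γ δ
        (exponents-no-carry {X} {Y} {ι₁ (exp α)} {ι₂ (exp γ)} {ι₂ (exp α)} {ι₁ (exp γ)} {ι₁ (exp δ)}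
          {ι₂ (exp (1# - δ))}
          (R₂.trans (ι₁-⋆ (exp γ) (exp δ)) (ι₁-cong (H₁.trans (exp-+ γ δ) (exp-cong γ+δ≈α))))
          (R₂.trans (H₂.const-⋆-const (exp α) (exp (1# - δ)))
            (R₂.trans (ι₂-cong (H₁.trans (exp-+ α (1# - δ))
                        (H₁.trans (exp-cong eq) (H₁.sym (exp-+ γ 1#)))))
                      (R₂.sym (H₂.const-⋆-const (exp γ) (exp 1#))))))
        where
        eq : α + (1# - δ) ≈ γ + 1#
        eq = begin
          α + (1# - δ)      ≈⟨ +-cong (sym γ+δ≈α) (+-comm 1# (- δ)) ⟩
          γ + δ + (- δ + 1#)  ≈⟨ +-assoc γ δ _ ⟩
          γ + (δ + (- δ + 1#)) ≈⟨ +-congˡ (+-assoc δ (- δ) 1#) ⟨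
          γ + (δ + - δ + 1#)   ≈⟨ +-congˡ (trans (+-congʳ (-‿inverseʳ δ)) (+-identityˡ 1#)) ⟩
          γ + 1# ∎
      addition-formula α γ δ (inj₂ γ+δ≈α+1) = fromExponents α γ δ
        (exponents-carry {X} {Y} {ι₁ (exp α)} {ι₂ (exp γ)} {ι₂ (exp α)} {ι₁ (exp γ)} {ι₁ (exp δ)}
          {ι₂ (exp (1# - δ))}
          (R₂.trans (ι₁-⋆ (exp γ) (exp δ)) (R₂.trans
            (ι₁-cong (H₁.trans (exp-+ γ δ) (H₁.trans (exp-cong γ+δ≈α+1) (H₁.sym (exp-+ α 1#)))))
            (R₂.sym (ι₁-⋆ (exp α) (exp 1#)))))
          (R₂.trans (H₂.const-⋆-const (exp α) (exp (1# - δ)))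
            (ι₂-cong (H₁.trans (exp-+ α (1# - δ)) (exp-cong eq)))))
        where
        eq : α + (1# - δ) ≈ γ
        eq = begin
          α + (1# - δ)   ≈⟨ +-assoc α 1# (- δ) ⟨
          α + 1# - δ     ≈⟨ +-congʳ γ+δ≈α+1 ⟨
          γ + δ - δ      ≈⟨ +-assoc γ δ (- δ) ⟩
          γ + (δ - δ)    ≈⟨ trans (+-congˡ (-‿inverseʳ δ)) (+-identityʳ γ) ⟩
          γ              ∎

      -- The hypotheses say that the weights make t divide the averages of b (α i) and b (γ i), which
      -- is what allows the factor U + V of the addition formula to be cancelled.
      averaged : ∀ {m} (s α γ : Fin m → Carrier) δ (f g : Series) →
        (∀ i → γ i + δ ≈ α i ⊎ γ i + δ ≈ α i + 1#) →
        (∀ n → sum (λ i → s i * b (α i) n) ≈ (t ⋆ f) n) →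
        (∀ n → sum (λ i → s i * b (γ i) n) ≈ (t ⋆ g) n) →
        ∀ p q → sum (λ i → s i * (b (α i) p * b (γ i) q)) ≈
          (ι₂ t H₂.⋆ (ι₁ (b δ) H₂.⋆ σ g)) p q + (ι₁ t H₂.⋆ (σ f H₂.⋆ ι₂ (reflected δ))) p q
      averaged {m} s α γ δ f g cases hα hγ p q = trans
        (sym (trans (sum-at₂ (λ i → κ (s i) H₂.⋆ (ι₁ (b (α i)) H₂.⋆ ι₂ (b (γ i)))) p q)
                    (sum-cong-≋ λ i → trans (κ⋆ (s i) (ι₁ (b (α i)) H₂.⋆ ι₂ (b (γ i))) p q)
                                            (*-congˡ (ι₁⋆ι₂ (b (α i)) (b (γ i)) p q)))))
        (σt-cancellable {M} {N} W*M p q)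
        where
        module RR = SetoidReasoning R₂.setoid
        κ : Carrier → H₂.Series
        κ x = ι₂ (const x)
        κ⋆ : ∀ x F p q → (κ x H₂.⋆ F) p q ≈ x * F p q
        κ⋆ x F p q = trans (H₂.const⋆ (const x) F p q) (const⋆ x (F p) q)
        ι₁⋆ι₂ : ∀ f g p q → (ι₁ f H₂.⋆ ι₂ g) p q ≈ f p * g q
        ι₁⋆ι₂ f g p q = trans (H₂.⋆-comm (ι₁ f) (ι₂ g) p q) (trans (H₂.const⋆ g (ι₁ f) p q)
          (trans (⋆-comm g (const (f p)) q) (const⋆ (f p) g q)))
        M N : H₂.Series
        M = Σ₂.sum (λ i → κ (s i) H₂.⋆ (ι₁ (b (α i)) H₂.⋆ ι₂ (b (γ i))))
        N = ι₂ t H₂.⋆ (ι₁ (b δ) H₂.⋆ σ g) R₂.+ ι₁ t H₂.⋆ (σ f H₂.⋆ ι₂ (reflected δ))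
        sumσ : ∀ (x : Fin m → Carrier) h → (∀ n → sum (λ i → s i * b (x i) n) ≈ (t ⋆ h) n) →
               Σ₂.sum (λ i → κ (s i) H₂.⋆ σ (b (x i))) R₂.≈ σ t H₂.⋆ σ h
        sumσ x h eq p q = trans (sum-at₂ (λ i → κ (s i) H₂.⋆ σ (b (x i))) p q)
          (trans (sum-cong-≋ λ i → κ⋆ (s i) (σ (b (x i))) p q)
          (trans (eq (p ℕ.+ q)) (sym (σ-⋆ t h p q))))
        open CommutativeSemigroupProperties R₂.*-commutativeSemigroup using (x∙yz≈y∙xz; x∙yz≈xz∙y)
        VD UD : H₂.Series
        VD = ι₂ t H₂.⋆ ι₁ (b δ)
        UD = ι₁ t H₂.⋆ ι₂ (reflected δ)
        -- As δ is the same for all i, the factors `VD` and `UD` come out of the sums. What remains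
        -- are the averages in U + V, which `sumσ` exhibits as multiples of `σ t`.
        W*M : σ t H₂.⋆ M R₂.≈ σ t H₂.⋆ N
        W*M = RR.begin
          σ t H₂.⋆ M
            RR.≈⟨ Σ₂.*-distribˡ-sum (σ t) (λ i → κ (s i) H₂.⋆ (ι₁ (b (α i)) H₂.⋆ ι₂ (b (γ i)))) ⟩
          Σ₂.sum (λ i → σ t H₂.⋆ (κ (s i) H₂.⋆ (ι₁ (b (α i)) H₂.⋆ ι₂ (b (γ i)))))
            RR.≈⟨ Σ₂.sum-cong-≋ (λ i → R₂.trans
                    (x∙yz≈y∙xz (σ t) (κ (s i)) (ι₁ (b (α i)) H₂.⋆ ι₂ (b (γ i))))
                    (R₂.trans (R₂.*-congˡ {κ (s i)} (addition-formula (α i) (γ i) δ (cases i)))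
                    (R₂.trans (R₂.distribˡ (κ (s i)) (ι₂ t H₂.⋆ (ι₁ (b δ) H₂.⋆ σ (b (γ i))))
                                (ι₁ t H₂.⋆ (σ (b (α i)) H₂.⋆ ι₂ (reflected δ))))
                    (R₂.+-cong
                      (R₂.trans (R₂.*-congˡ {κ (s i)} (R₂.sym (R₂.*-assoc (ι₂ t) (ι₁ (b δ)) (σ (b (γ i))))))
                                (x∙yz≈y∙xz (κ (s i)) VD (σ (b (γ i)))))
                      (R₂.trans (R₂.*-congˡ {κ (s i)}
                                  (x∙yz≈xz∙y (ι₁ t) (σ (b (α i))) (ι₂ (reflected δ))))
                                (x∙yz≈y∙xz (κ (s i)) UD (σ (b (α i))))))))) ⟩
          Σ₂.sum (λ i → VD H₂.⋆ (κ (s i) H₂.⋆ σ (b (γ i))) R₂.+ UD H₂.⋆ (κ (s i) H₂.⋆ σ (b (α i))))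
            RR.≈⟨ Σ₂.∑-distrib-+ (λ i → VD H₂.⋆ (κ (s i) H₂.⋆ σ (b (γ i))))
                                 (λ i → UD H₂.⋆ (κ (s i) H₂.⋆ σ (b (α i)))) ⟩
          Σ₂.sum (λ i → VD H₂.⋆ (κ (s i) H₂.⋆ σ (b (γ i)))) R₂.+
          Σ₂.sum (λ i → UD H₂.⋆ (κ (s i) H₂.⋆ σ (b (α i))))
            RR.≈⟨ R₂.+-cong (Σ₂.*-distribˡ-sum VD (λ i → κ (s i) H₂.⋆ σ (b (γ i))))
                            (Σ₂.*-distribˡ-sum UD (λ i → κ (s i) H₂.⋆ σ (b (α i)))) ⟨
          VD H₂.⋆ Σ₂.sum (λ i → κ (s i) H₂.⋆ σ (b (γ i))) R₂.+
          UD H₂.⋆ Σ₂.sum (λ i → κ (s i) H₂.⋆ σ (b (α i)))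
            RR.≈⟨ R₂.+-cong (R₂.*-congˡ {VD} (sumσ γ g hγ)) (R₂.*-congˡ {UD} (sumσ α f hα)) ⟩
          VD H₂.⋆ (σ t H₂.⋆ σ g) R₂.+ UD H₂.⋆ (σ t H₂.⋆ σ f)
            RR.≈⟨ R₂.+-cong (R₂.trans (x∙yz≈y∙xz VD (σ t) (σ g))
                              (R₂.*-congˡ {σ t} (R₂.*-assoc (ι₂ t) (ι₁ (b δ)) (σ g))))
                            (R₂.trans (x∙yz≈y∙xz UD (σ t) (σ f))
                              (R₂.*-congˡ {σ t} (R₂.sym (x∙yz≈xz∙y (ι₁ t) (σ f) (ι₂ (reflected δ)))))) ⟩
          σ t H₂.⋆ (ι₂ t H₂.⋆ (ι₁ (b δ) H₂.⋆ σ g)) R₂.+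
          σ t H₂.⋆ (ι₁ t H₂.⋆ (σ f H₂.⋆ ι₂ (reflected δ)))
            RR.≈⟨ R₂.distribˡ (σ t) (ι₂ t H₂.⋆ (ι₁ (b δ) H₂.⋆ σ g))
                    (ι₁ t H₂.⋆ (σ f H₂.⋆ ι₂ (reflected δ))) ⟨
          σ t H₂.⋆ N RR.∎

-- Geometric sums as quotients by e^t - 1 and e^t + 1

module GeometricQuotients {k ℓ : Level} (K : CommutativeRing k ℓ) where
  open CommutativeRing K hiding (zero)
  open ThreeTerm K
  open SemiringSum semiring
  open RingProperties ring using (+-cancelʳ)
  open SemiringSolver commutativeSemiring using (solve; _:+_; _:*_; _:=_; con)
  open SetoidReasoning setoid
  open Hurwitz K using (sum-snoc)

  sum-shift : ∀ (F : ℕ → Carrier) n →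
    ∑[ i < n ] F (suc (toℕ i)) + F 0 ≈ ∑[ i < n ] F (toℕ i) + F n
  sum-shift F n = trans (+-comm _ _) (sum-snoc F n)

  geometric : ∀ {E} (y : ℕ → Carrier) → (∀ i → E * y i ≈ y (suc i)) → ∀ n →
    E * (∑[ i < n ] y (toℕ i)) + y 0 ≈ ∑[ i < n ] y (toℕ i) + y n
  geometric {E} y Ey n = begin
    E * (∑[ i < n ] y (toℕ i)) + y 0       ≈⟨ +-congʳ (*-distribˡ-sum {n} E (λ i → y (toℕ i))) ⟩
    ∑[ i < n ] (E * y (toℕ i)) + y 0       ≈⟨ +-congʳ (sum-cong-≋ {n} (λ i → Ey (toℕ i))) ⟩
    ∑[ i < n ] y (suc (toℕ i)) + y 0       ≈⟨ sum-shift y n ⟩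
    ∑[ i < n ] y (toℕ i) + y n             ∎

  alternating-geometric : ∀ {E} (y : ℕ → Carrier) → (∀ i → E * y i + y (suc i) ≈ 0#) → ∀ n →
    (E + 1#) * (∑[ i < n ] y (toℕ i)) + y n ≈ y 0
  alternating-geometric {E} y Ey n = begin
    (E + 1#) * S + y n
      ≈⟨ solve 3 (λ E S y → (E :+ con 1) :* S :+ y := E :* S :+ (S :+ y)) refl E S (y n) ⟩
    E * S + (S + y n)
      ≈⟨ +-cong (*-distribˡ-sum {n} E (λ i → y (toℕ i))) (sym (sum-shift y n)) ⟩
    ∑[ i < n ] (E * y (toℕ i)) + (∑[ i < n ] y (suc (toℕ i)) + y 0)
      ≈⟨ +-assoc _ _ _ ⟨
    ∑[ i < n ] (E * y (toℕ i)) + ∑[ i < n ] y (suc (toℕ i)) + y 0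
      ≈⟨ +-congʳ (∑-distrib-+ {n} (λ i → E * y (toℕ i)) (λ i → y (suc (toℕ i)))) ⟨
    ∑[ i < n ] (E * y (toℕ i) + y (suc (toℕ i))) + y 0
      ≈⟨ +-congʳ (trans (sum-cong-≋ {n} (λ i → Ey (toℕ i))) (sum-replicate-zero n)) ⟩
    0# + y 0
      ≈⟨ +-identityˡ _ ⟩
    y 0 ∎
    where
    S : Carrier
    S = ∑[ i < n ] y (toℕ i)

  -- Read X = e^{At}, E = e^t, G the sum of e^{it} over 0 ≤ i < A, D the sum of the dilated
  -- Bernoulli series, and w an exponential. Since (E - 1) G = X - 1, both sides become A t w G
  -- after multiplication by X - 1.
  bernoulli-quotient : ∀ {X E G D A t w b} → Cancellable (X - 1#) →
    X * D ≈ D + A * t * (w * G) → E * G + 1# ≈ G + X → E * b ≈ b + t * w → D ≈ A * b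
  bernoulli-quotient {X} {E} {G} {D} {A} {t} {w} {b} cancel hD hG hb = cancel (begin
    (X - 1#) * D              ≈⟨ sub-one-* hD ⟩
    A * t * (w * G)           ≈⟨ solve 4 (λ A t w G → A :* t :* (w :* G) := A :* G :* (t :* w)) refl A t w G ⟩
    A * G * (t * w)           ≈⟨ *-congˡ (sub-one-* hb) ⟨
    A * G * ((E - 1#) * b)    ≈⟨ solve 4 (λ A G P b → A :* G :* (P :* b) := P :* G :* (A :* b)) refl A G (E - 1#) b ⟩
    (E - 1#) * G * (A * b)    ≈⟨ *-congʳ PG≈ ⟩
    (X - 1#) * (A * b)        ∎)
    where
    PG≈ : (E - 1#) * G ≈ X - 1#
    PG≈ = sub-one-* (begin
      E * G                 ≈⟨ +-cancelʳ 1# _ _ (begin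
        E * G + 1#             ≈⟨ hG ⟩
        G + X                  ≈⟨ +-congˡ (sub-one-+ X) ⟨
        G + (X - 1# + 1#)      ≈⟨ +-assoc _ _ _ ⟨
        G + (X - 1#) + 1#      ∎) ⟩
      G + (X - 1#)          ∎)

  -- Now G is the alternating sum, with (E + 1) G = 1 - X. The factor X - 1 of D therefore
  -- disappears up to sign, and the denominator that remains is the E + 1 of the Euler series.
  euler-quotient : ∀ {X E G D A t w two ε} → Cancellable (X - 1#) → Cancellable (E + 1#) →
    X * D ≈ D + A * t * (w * G) → (E + 1#) * G + X ≈ 1# → (E + 1#) * ε ≈ two * w →
    two * D + A * t * ε ≈ 0#
  euler-quotient {X} {E} {G} {D} {A} {t} {w} {two} {ε} cancel cancel′ hD hG hε =
    cancel (cancel′ (begin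
    (E + 1#) * ((X - 1#) * (two * D + A * t * ε))
      ≈⟨ solve 6 (λ F P two D At ε → F :* (P :* (two :* D :+ At :* ε))
                    := F :* two :* (P :* D) :+ P :* At :* (F :* ε))
           refl (E + 1#) (X - 1#) two D (A * t) ε ⟩
    (E + 1#) * two * ((X - 1#) * D) + (X - 1#) * (A * t) * ((E + 1#) * ε)
      ≈⟨ +-cong (*-congˡ (sub-one-* hD)) (*-congˡ hε) ⟩
    (E + 1#) * two * (A * t * (w * G)) + (X - 1#) * (A * t) * (two * w)
      ≈⟨ solve 6 (λ F P two At w G → F :* two :* (At :* (w :* G)) :+ P :* At :* (two :* w)
                    := two :* At :* w :* (F :* G :+ P))
           refl (E + 1#) (X - 1#) two (A * t) w G ⟩
    two * (A * t) * w * ((E + 1#) * G + (X - 1#))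
      ≈⟨ *-congˡ (trans (sym (+-assoc _ _ _)) (trans (+-congʳ hG) (-‿inverseʳ 1#))) ⟩
    two * (A * t) * w * 0#
      ≈⟨ zeroʳ _ ⟩
    0#
      ≈⟨ trans (*-congˡ (zeroʳ _)) (zeroʳ _) ⟨
    (E + 1#) * ((X - 1#) * 0#) ∎))

-- Multiplication formulas for polynomials

module Distribution {k ℓ : Level} (K : CommutativeRing k ℓ) where
  open CommutativeRing K
  open Hurwitz K
  open SemiringExp semiring using (_^_)
  open SemiringSum semiring using (sum; sum-syntax; sum-cong-≋; *-distribˡ-sum)
  open SemiringMult semiring using (_×_; ×-assoc-*; ×-congʳ)
  open RingProperties ring using (-1*x≈-x; -‿distribˡ-*)
  open CommutativeSemigroupProperties *-commutativeSemigroup using (x∙yz≈y∙xz)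
  open Bivariate K
  private
    module H₁ = CommutativeRing hurwitzRing
    module Σ₁ = SemiringSum H₁.semiring
  open ThreeTerm hurwitzRing using (Cancellable; cancellable-factor; sub-one-*)
  open GeometricQuotients hurwitzRing
  open CommutativeSemigroupProperties H₁.*-commutativeSemigroup
    using () renaming (x∙yz≈y∙xz to ⋆-x∙yz≈y∙xz)

  module WithBernoulli
    (torsionFree : ∀ n {x y} → suc n × x ≈ suc n × y → x ≈ y)
    (b : Carrier → Series) (b-difference : ∀ x → exp 1# ⋆ b x ≋ b x ⊕ t ⋆ exp x)
    where
    open TorsionFree torsionFree
    open AppellBernoulli b b-difference

    const-cancellable : ∀ n → Cancellable (const (suc n × 1#))
    const-cancellable n {f} {g} eq i = torsionFree n (trans (sym (lemma f)) (trans (eq i) (lemma g)))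
      where
      lemma : ∀ h → (const (suc n × 1#) ⋆ h) i ≈ suc n × h i
      lemma h = trans (const⋆ _ h i) (trans (×-assoc-* (suc n) 1# (h i)) (×-congʳ (suc n) (*-identityˡ _)))

    dilate-t≋ : ∀ x → dilate x t ≋ const x ⋆ t
    dilate-t≋ x n = trans (dilate-t x n) (sym (const⋆ x t n))

    dilate-difference : ∀ A x →
      exp A ⋆ dilate A (b x) ≋ dilate A (b x) ⊕ (const A ⋆ t) ⋆ exp (A * x)
    dilate-difference A x = H₁.trans
      (H₁.*-congʳ {dilate A (b x)} (H₁.trans (exp-cong (sym (*-identityʳ A))) (H₁.sym (dilate-exp A 1#))))
      (H₁.trans (dilate-⋆ A (exp 1#) (b x))
      (H₁.trans (λ n → *-congˡ (b-difference x n))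
      (H₁.trans (dilate-⊕ A (b x) (t ⋆ exp x))
      (H₁.+-congˡ {dilate A (b x)} (H₁.trans (H₁.sym (dilate-⋆ A t (exp x)))
        (H₁.*-cong (dilate-t≋ A) (dilate-exp A x)))))))

    -- Dilating the equation of `b 0#` by A shows that e^{At} - 1 divides A t, and both A and t are
    -- cancellable.
    exp-sub-one-cancellable : ∀ a → Cancellable (exp (suc a × 1#) H₁.- H₁.1#)
    exp-sub-one-cancellable a =
      cancellable-factor {exp A H₁.- H₁.1#} {dilate A (b 0#)} {const A ⋆ t}
        (H₁.trans (sub-one-* {exp A} {dilate A (b 0#)} (dilate-difference A 0#))
          (H₁.trans (H₁.*-congˡ {const A ⋆ t} (H₁.trans (exp-cong (zeroʳ A)) exp-0)) (H₁.*-identityʳ _)))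
        (λ {f} {g} eq → t-cancellable (const-cancellable a
          (H₁.trans (H₁.sym (H₁.*-assoc (const A) t f)) (H₁.trans eq (H₁.*-assoc (const A) t g)))))
      where A = suc a × 1#

    -- Congruence of the family `b` is not assumed; it follows from the uniqueness of the solution
    -- of the difference equation.
    b-cong : ∀ {x y} → x ≈ y → b x ≋ b y
    b-cong {x} {y} x≈y = exp-sub-one-cancellable 0
      (H₁.trans (relation x) (H₁.trans (H₁.*-congˡ {t} (exp-cong x≈y)) (H₁.sym (relation y))))
      where
      relation : ∀ x → (exp (1 × 1#) H₁.- H₁.1#) ⋆ b x ≋ t ⋆ exp x
      relation x = sub-one-* {exp (1 × 1#)} {b x}
        (H₁.trans (H₁.*-congʳ {b x} (exp-cong (+-identityʳ 1#))) (b-difference x))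

    -- `Ax` says that `x i` is (i + w)/A without dividing. The weights `s` will be constantly 1 for
    -- the multiplication formula and (-1)^i for the alternating one.
    module _ (A w : Carrier) (x : ℕ → Carrier) (Ax : ∀ i → A * x i ≈ i × 1# + w) (s : ℕ → Carrier) where

      weighted : ∀ m → Series
      weighted m = Σ₁.sum {m} (λ i → const (s (toℕ i)) ⋆ dilate A (b (x (toℕ i))))

      weightedExp : ∀ m → Series
      weightedExp m = Σ₁.sum {m} (λ i → const (s (toℕ i)) ⋆ exp (toℕ i × 1#))

      -- Dilation by A turns the exponent `x i` into i + w, so all summands share the operator
      -- e^{At} and their inhomogeneous terms form a weighted geometric sum.
      weighted-difference : ∀ m →
        exp A ⋆ weighted m ≋ weighted m ⊕ (const A ⋆ t) ⋆ (exp w ⋆ weightedExp m)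
      weighted-difference m = RR.begin
        exp A ⋆ weighted m
          RR.≈⟨ Σ₁.*-distribˡ-sum {m} (exp A) (λ i → S i ⋆ D i) ⟩
        Σ₁.sum {m} (λ i → exp A ⋆ (S i ⋆ D i))
          RR.≈⟨ Σ₁.sum-cong-≋ {m} (λ i → H₁.trans (⋆-x∙yz≈y∙xz (exp A) (S i) (D i))
                  (H₁.trans (H₁.*-congˡ {S i} (dilate-difference A (x (toℕ i))))
                  (H₁.trans (H₁.distribˡ (S i) (D i) ((const A ⋆ t) ⋆ exp (A * x (toℕ i))))
                  (H₁.+-congˡ {S i ⋆ D i} (step i))))) ⟩
        Σ₁.sum {m} (λ i → S i ⋆ D i ⊕ (const A ⋆ t) ⋆ (exp w ⋆ (S i ⋆ exp (toℕ i × 1#))))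
          RR.≈⟨ Σ₁.∑-distrib-+ {m} (λ i → S i ⋆ D i)
                  (λ i → (const A ⋆ t) ⋆ (exp w ⋆ (S i ⋆ exp (toℕ i × 1#)))) ⟩
        weighted m ⊕ Σ₁.sum {m} (λ i → (const A ⋆ t) ⋆ (exp w ⋆ (S i ⋆ exp (toℕ i × 1#))))
          RR.≈⟨ H₁.+-congˡ {weighted m} (H₁.trans
                  (H₁.*-congˡ {const A ⋆ t} (Σ₁.*-distribˡ-sum {m} (exp w) (λ i → S i ⋆ exp (toℕ i × 1#))))
                  (Σ₁.*-distribˡ-sum {m} (const A ⋆ t) (λ i → exp w ⋆ (S i ⋆ exp (toℕ i × 1#))))) ⟨
        weighted m ⊕ (const A ⋆ t) ⋆ (exp w ⋆ weightedExp m) RR.∎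
        where
        module RR = SetoidReasoning H₁.setoid
        S D : Fin m → Series
        S i = const (s (toℕ i))
        D i = dilate A (b (x (toℕ i)))
        step : ∀ i → S i ⋆ ((const A ⋆ t) ⋆ exp (A * x (toℕ i))) ≋
                     (const A ⋆ t) ⋆ (exp w ⋆ (S i ⋆ exp (toℕ i × 1#)))
        step i = H₁.trans (⋆-x∙yz≈y∙xz (S i) (const A ⋆ t) (exp (A * x (toℕ i))))
          (H₁.*-congˡ {const A ⋆ t} (H₁.trans
            (H₁.*-congˡ {S i} (H₁.trans (exp-cong (trans (Ax (toℕ i)) (+-comm _ w)))
                                        (H₁.sym (exp-+ w (toℕ i × 1#)))))
            (⋆-x∙yz≈y∙xz (S i) (exp w) (exp (toℕ i × 1#)))))

      weighted-at : ∀ m n → weighted m n ≈ A ^ n * (∑[ i < m ] (s (toℕ i) * b (x (toℕ i)) n))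
      weighted-at m n = trans (sum-at {m} (λ i → const (s (toℕ i)) ⋆ dilate A (b (x (toℕ i)))) n)
        (trans (sum-cong-≋ {m} λ i → trans (const⋆ (s (toℕ i)) (dilate A (b (x (toℕ i)))) n)
                                           (x∙yz≈y∙xz (s (toℕ i)) (A ^ n) (b (x (toℕ i)) n)))
               (sym (*-distribˡ-sum {m} (A ^ n) (λ i → s (toℕ i) * b (x (toℕ i)) n))))

    exp-suc : ∀ i → exp 1# ⋆ exp (i × 1#) ≋ exp (suc i × 1#)
    exp-suc i = exp-+ 1# (i × 1#)

    -- Raabe's formula for B_n, with the power of the modulus kept on the left to avoid a division.
    multiplication-formula : ∀ a w (x : ℕ → Carrier) → (∀ i → (suc a × 1#) * x i ≈ i × 1# + w) →
      ∀ n → (suc a × 1#) ^ n * (∑[ i < suc a ] (b (x (toℕ i)) n)) ≈ (suc a × 1#) * b w n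
    multiplication-formula a w x Ax n = trans
      (trans (*-congˡ (sum-cong-≋ {suc a} λ i → sym (*-identityˡ (b (x (toℕ i)) n))))
             (sym (weighted-at A w x Ax (λ _ → 1#) (suc a) n)))
      (trans (bernoulli-quotient {exp A} {exp 1#} {weightedExp A w x Ax (λ _ → 1#) (suc a)} {_} {const A} {t}
               {exp w} {b w} (exp-sub-one-cancellable a)
               (weighted-difference A w x Ax (λ _ → 1#) (suc a)) geo (b-difference w) n)
             (const⋆ A (b w) n))
      where
      A = suc a × 1#
      y : ℕ → Series
      y i = const 1# ⋆ exp (i × 1#)
      geo : exp 1# ⋆ weightedExp A w x Ax (λ _ → 1#) (suc a) ⊕ const 1# ≋
            weightedExp A w x Ax (λ _ → 1#) (suc a) ⊕ exp A
      geo = H₁.trans (H₁.+-congˡ {exp 1# ⋆ Σ₁.sum {suc a} (λ i → y (toℕ i))}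
                       (H₁.sym (H₁.trans (one⋆ (exp (0 × 1#))) exp-0)))
        (H₁.trans (geometric {exp 1#} y (λ i → H₁.trans (⋆-x∙yz≈y∙xz (exp 1#) (const 1#) (exp (i × 1#)))
                                        (H₁.*-congˡ {const 1#} (exp-suc i))) (suc a))
                  (H₁.+-congˡ {Σ₁.sum {suc a} (λ i → y (toℕ i))} (one⋆ (exp A))))

    module AppellEuler (ε : Carrier → Series)
      (ε-sum : ∀ x → (exp 1# ⊕ const 1#) ⋆ ε x ≋ const (2 × 1#) ⋆ exp x) where

      exp+1-cancellable : Cancellable (exp 1# ⊕ const 1#)
      exp+1-cancellable = cancellable-factor {exp 1# ⊕ const 1#} {ε 0#} {const (2 × 1#)}
        (H₁.trans (ε-sum 0#) (H₁.trans (H₁.*-congˡ {const (2 × 1#)} exp-0) (H₁.*-identityʳ _)))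
        (const-cancellable 1)

      -- In classical terms, for an even modulus N, the sum of (-1)^i B_n((i + w)/N) is -(n/2)
      -- N^{1-n} E_{n-1}(w). The term with `t ⋆ ε w` carries n E_{n-1}(w).
      alternating-formula : ∀ c w (x : ℕ → Carrier) → (∀ i → (suc c × 1#) * x i ≈ i × 1# + w) →
        (- 1#) ^ suc c ≈ 1# → ∀ n →
        (2 × 1#) * ((suc c × 1#) ^ n * (∑[ i < suc c ] ((- 1#) ^ toℕ i * b (x (toℕ i)) n)))
          + (suc c × 1#) * (t ⋆ ε w) n ≈ 0#
      alternating-formula c w x Ax even n = trans
        (+-cong (trans (*-congˡ (sym (weighted-at N w x Ax s (suc c) n)))
                       (sym (const⋆ (2 × 1#) (weighted N w x Ax s (suc c)) n)))
                (trans (sym (const⋆ N (t ⋆ ε w) n)) (sym (⋆-assoc (const N) t (ε w) n))))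
        (euler-quotient {exp N} {exp 1#} {weightedExp N w x Ax s (suc c)} {weighted N w x Ax s (suc c)}
           {const N} {t} {exp w} {const (2 × 1#)} {ε w}
           (exp-sub-one-cancellable c) exp+1-cancellable
           (weighted-difference N w x Ax s (suc c)) geo (ε-sum w) n)
        where
        N = suc c × 1#
        s : ℕ → Carrier
        s i = (- 1#) ^ i
        y : ℕ → Series
        y i = const (s i) ⋆ exp (i × 1#)
        Ey : ∀ i → exp 1# ⋆ y i ⊕ y (suc i) ≋ λ _ → 0#
        Ey i n = trans
          (+-cong (trans (⋆-x∙yz≈y∙xz (exp 1#) (const (s i)) (exp (i × 1#)) n)
                         (trans (H₁.*-congˡ {const (s i)} (exp-suc i) n) (const⋆ (s i) _ n)))
                  (trans (const⋆ (s (suc i)) _ n)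
                         (trans (*-congʳ (-1*x≈-x (s i))) (sym (-‿distribˡ-* _ _)))))
          (-‿inverseʳ _)
        geo : (exp 1# ⊕ const 1#) ⋆ weightedExp N w x Ax s (suc c) ⊕ exp N ≋ const 1#
        -- Because the number of terms is even, the end term `y (suc c)` is e^{Nt} with sign +.
        geo = H₁.trans (H₁.+-congˡ {(exp 1# ⊕ const 1#) ⋆ Σ₁.sum {suc c} (λ i → y (toℕ i))}
            (λ n → sym (trans (const⋆ (s (suc c)) (exp N) n) (trans (*-congʳ even) (*-identityˡ _)))))
          (H₁.trans (alternating-geometric {exp 1#} y Ey (suc c))
                    (H₁.trans (one⋆ (exp (0 × 1#))) exp-0))

-- The integers inside the reals

module IntegerEmbedding {r ℓ₁ ℓ₂ : Level} (R : Reals r ℓ₁ ℓ₂) where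
  open Reals R
  open CommutativeRing commutativeRing hiding (zero; _+_; _*_; -_; _≈_; 0#; 1#; _-_; semiring)
  open SemiringMult semiring using (×-homo-+)
  open RingProperties ring using (-‿distribˡ-*; -‿involutive; -0#≈0#; -‿+-comm)
  open CommutativeSemigroupProperties +-commutativeSemigroup using (interchange)
  open SetoidReasoning setoid

  fromℤ-⊖ : ∀ m n → fromℤ (m ℤ.⊖ n) ≈ fromℕ m - fromℕ n
  fromℤ-⊖ zero    zero    = sym (-‿inverseʳ 0#)
  fromℤ-⊖ zero    (suc n) = sym (+-identityˡ _)
  fromℤ-⊖ (suc m) zero    = sym (trans (+-congˡ -0#≈0#) (+-identityʳ _))
  fromℤ-⊖ (suc m) (suc n) = begin
    fromℤ (suc m ℤ.⊖ suc n)                  ≡⟨ ≡.cong fromℤ (ℤ.[1+m]⊖[1+n]≡m⊖n m n) ⟩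
    fromℤ (m ℤ.⊖ n)                          ≈⟨ fromℤ-⊖ m n ⟩
    fromℕ m - fromℕ n                        ≈⟨ +-identityˡ _ ⟨
    0# + (fromℕ m - fromℕ n)                 ≈⟨ +-congʳ (-‿inverseʳ 1#) ⟨
    (1# - 1#) + (fromℕ m - fromℕ n)          ≈⟨ interchange _ _ _ _ ⟩
    (1# + fromℕ m) + (- 1# - fromℕ n)        ≈⟨ +-congˡ (-‿+-comm _ _) ⟩
    (1# + fromℕ m) - (1# + fromℕ n)          ∎

  fromℤ-+ : ∀ m n → fromℤ (m ℤ.+ n) ≈ fromℤ m + fromℤ n
  fromℤ-+ (ℤ.+ m)  (ℤ.+ n)  = ×-homo-+ 1# m n
  fromℤ-+ (ℤ.+ m)  -[1+ n ] = fromℤ-⊖ m (suc n)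
  fromℤ-+ -[1+ m ] (ℤ.+ n)  = trans (fromℤ-⊖ n (suc m)) (+-comm _ _)
  fromℤ-+ -[1+ m ] -[1+ n ] = trans
    (-‿cong (trans (reflexive (≡.cong (λ k → fromℕ (suc k)) (≡.sym (ℕ.+-suc m n))))
                   (×-homo-+ 1# (suc m) (suc n))))
    (sym (-‿+-comm _ _))

  fromℤ-neg : ∀ m → fromℤ (ℤ.- m) ≈ - fromℤ m
  fromℤ-neg (ℤ.+ zero)  = sym -0#≈0#
  fromℤ-neg (ℤ.+ suc n) = refl
  fromℤ-neg -[1+ n ]    = sym (-‿involutive _)

  fromℤ-+* : ∀ m n → fromℤ (ℤ.+ m ℤ.* n) ≈ fromℕ m * fromℤ n
  fromℤ-+* zero    n = trans (reflexive (≡.cong fromℤ (ℤ.*-zeroˡ n))) (sym (zeroˡ _))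
  fromℤ-+* (suc m) n = begin
    fromℤ (ℤ.+ suc m ℤ.* n)             ≡⟨ ≡.cong fromℤ (ℤ.suc-* (ℤ.+ m) n) ⟩
    fromℤ (n ℤ.+ ℤ.+ m ℤ.* n)           ≈⟨ fromℤ-+ n (ℤ.+ m ℤ.* n) ⟩
    fromℤ n + fromℤ (ℤ.+ m ℤ.* n)       ≈⟨ +-cong (sym (*-identityˡ _)) (fromℤ-+* m n) ⟩
    1# * fromℤ n + fromℕ m * fromℤ n    ≈⟨ distribʳ _ _ _ ⟨
    (1# + fromℕ m) * fromℤ n            ∎

  fromℤ-* : ∀ m n → fromℤ (m ℤ.* n) ≈ fromℤ m * fromℤ n
  fromℤ-* (ℤ.+ m)  n = fromℤ-+* m n
  fromℤ-* -[1+ m ] n = begin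
    fromℤ (-[1+ m ] ℤ.* n)              ≡⟨ ≡.cong fromℤ (ℤ.neg-distribˡ-* (ℤ.+ suc m) n) ⟨
    fromℤ (ℤ.- (ℤ.+ suc m ℤ.* n))       ≈⟨ fromℤ-neg (ℤ.+ suc m ℤ.* n) ⟩
    - fromℤ (ℤ.+ suc m ℤ.* n)           ≈⟨ -‿cong (fromℤ-+* (suc m) n) ⟩
    - (fromℕ (suc m) * fromℤ n)         ≈⟨ -‿distribˡ-* _ _ ⟩
    - fromℕ (suc m) * fromℤ n           ∎

  private
    morphism : ℤ.+-*-rawRing -Raw-AlmostCommutative⟶ fromCommutativeRing commutativeRing
    morphism = record
      { ⟦_⟧    = fromℤ
      ; +-homo = fromℤ-+
      ; *-homo = fromℤ-*
      ; -‿homo = fromℤ-neg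
      ; 0-homo = refl
      ; 1-homo = +-identityʳ 1#
      }

    weaklyDec : ∀ m n → Maybe (fromℤ m ≈ fromℤ n)
    weaklyDec m n = map (λ eq → reflexive (≡.cong fromℤ eq)) (dec⇒weaklyDec ℤ._≟_ m n)

  open RingSolver ℤ.+-*-rawRing (fromCommutativeRing commutativeRing) morphism weaklyDec public
    using (solve; _:+_; _:*_; :-_; _:-_; _:=_)

-- Integer and fractional parts

module FractionalPart {r ℓ₁ ℓ₂ : Level} (R : Reals r ℓ₁ ℓ₂) where
  open Reals R
  open CommutativeRing commutativeRing hiding (zero; _+_; _*_; -_; _≈_; 0#; 1#; _-_; semiring)
  open OrderProperties R
  open IntegerEmbedding R
  open BernoulliEuler R using (floor)
  open IsDecTotalOrder isDecTotalOrder
    using (total; _≤?_; ≤-respʳ-≈; ≤-respˡ-≈) renaming (trans to ≤-trans)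

  ≤-resp : ∀ {x y x′ y′} → x ≈ x′ → y ≈ y′ → x ≤ y → x′ ≤ y′
  ≤-resp x≈ y≈ x≤y = ≤-respˡ-≈ x≈ (≤-respʳ-≈ y≈ x≤y)

  fromℤ-mono : ∀ {m n} → m ℤ.≤ n → fromℤ m ≤ fromℤ n
  fromℤ-mono {m} {n} m≤n = go (n ℤ.- m) (ℤ.i≤j⇒0≤j-i m≤n) (fromℤ-+ n (ℤ.- m))
    where
    go : ∀ d → ℤ.0ℤ ℤ.≤ d → fromℤ d ≈ fromℤ n + fromℤ (ℤ.- m) → fromℤ m ≤ fromℤ n
    go (ℤ.+ k) _ eq = ≤-resp (+-identityˡ _)
      (trans (+-congʳ (trans eq (+-congˡ (fromℤ-neg m))))
             (solve 2 (λ n m → n :- m :+ m := n) refl (fromℤ n) (fromℤ m)))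
      (+-monoˡ-≤ (fromℤ m) (fromℕ-mono {0} {k} ℕ.z≤n))

  fromℤ-suc : ∀ m → fromℤ (ℤ.suc m) ≈ 1# + fromℤ m
  fromℤ-suc m = trans (fromℤ-+ (ℤ.+ 1) m) (+-congʳ (+-identityʳ 1#))

  frac : ℝ → ℝ
  frac x = x - fromℤ (floor x)

  InUnit : ℝ → Set ℓ₂
  InUnit f = (0# ≤ f) Product.× ¬ (1# ≤ f)

  frac+floor : ∀ x → x ≈ frac x + fromℤ (floor x)
  frac+floor x = solve 2 (λ x n → x := x :- n :+ n) refl x (fromℤ (floor x))

  frac-inUnit : ∀ x → InUnit (frac x)
  frac-inUnit x with integerPart x
  ... | m , m≤x , up =
        ≤-respˡ-≈ (-‿inverseʳ (fromℤ m)) (+-monoˡ-≤ (- fromℤ m) m≤x)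
      , λ 1≤f → ℤ.<-irrefl ≡.refl (ℤ.suc[i]≤j⇒i<j (up (ℤ.suc m)
          (≤-resp (sym (fromℤ-suc m))
                  (solve 2 (λ x n → x :- n :+ n := x) refl x (fromℤ m))
                  (+-monoˡ-≤ (fromℤ m) 1≤f))))

  floor-unique : ∀ {x f} m → x ≈ f + fromℤ m → InUnit f → floor x ≡ m
  floor-unique {x} {f} m x≈f+m (0≤f , 1≰f) with integerPart x
  ... | n , n≤x , up = ℤ.≤-antisym n≤m
        (up m (≤-resp (+-identityˡ _) (sym x≈f+m) (+-monoˡ-≤ (fromℤ m) 0≤f)))
    where
    n≤m : n ℤ.≤ m
    n≤m with n ℤ.≤? m
    ... | yes n≤m = n≤m
    ... | no  n≰m = ⊥-elim (1≰f (≤-resp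
            (trans (+-congʳ (fromℤ-suc m)) (solve 2 (λ one n → one :+ n :- n := one) refl 1# (fromℤ m)))
            (trans (+-congʳ x≈f+m) (solve 2 (λ f n → f :+ n :- n := f) refl f (fromℤ m)))
            (+-monoˡ-≤ (- fromℤ m)
              (≤-trans (fromℤ-mono (ℤ.i<j⇒suc[i]≤j (ℤ.≰⇒> n≰m))) n≤x))))

  frac-unique : ∀ {x f} m → x ≈ f + fromℤ m → InUnit f → frac x ≈ f
  frac-unique {x} {f} m x≈f+m f∈ = trans
    (+-cong x≈f+m (-‿cong (reflexive (≡.cong fromℤ (floor-unique m x≈f+m f∈)))))
    (solve 2 (λ f n → f :+ n :- n := f) refl f (fromℤ m))

  frac-cong : ∀ {x y} → x ≈ y → frac x ≈ frac y
  frac-cong {x} {y} x≈y = frac-unique (floor y) (trans x≈y (frac+floor y)) (frac-inUnit y)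

  -- The sum of two fractional parts lies in [0,2), so it is reduced by 0 or by 1. Used with y = B
  -- and z = A - B, this yields the two cases of `addition-formula`.
  frac-+ : ∀ {x y z} → x ≈ y + z →
           frac y + frac z ≈ frac x ⊎ frac y + frac z ≈ frac x + 1#
  frac-+ {x} {y} {z} x≈y+z with 1# ≤? (frac y + frac z)
  ... | no 1≰g = inj₁ (sym (frac-unique (floor y ℤ.+ floor z)
          (trans x≈y+z (trans (+-cong (frac+floor y) (frac+floor z))
            (trans (solve 4 (λ f m g n → (f :+ m) :+ (g :+ n) := (f :+ g) :+ (m :+ n)) refl
                      (frac y) (fromℤ (floor y)) (frac z) (fromℤ (floor z)))
                   (+-congˡ (sym (fromℤ-+ (floor y) (floor z)))))))
          (0≤g , 1≰g)))
    where
    0≤g : 0# ≤ frac y + frac z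
    0≤g = ≤-trans (proj₁ (frac-inUnit z))
      (≤-respˡ-≈ (+-identityˡ _) (+-monoˡ-≤ (frac z) (proj₁ (frac-inUnit y))))
  ... | yes 1≤g = inj₂ (trans (solve 2 (λ g one → g := g :- one :+ one) refl (frac y + frac z) 1#)
          (+-congʳ (sym (frac-unique (ℤ.suc (floor y ℤ.+ floor z))
            (trans x≈y+z (trans (+-cong (frac+floor y) (frac+floor z))
              (trans (solve 5 (λ f m g n one → (f :+ m) :+ (g :+ n) := (f :+ g :- one) :+ (one :+ (m :+ n))) refl
                        (frac y) (fromℤ (floor y)) (frac z) (fromℤ (floor z)) 1#)
                     (+-congˡ (sym (trans (fromℤ-suc (floor y ℤ.+ floor z))
                                          (+-congˡ (fromℤ-+ (floor y) (floor z)))))))))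
            (≤-respˡ-≈ (-‿inverseʳ 1#) (+-monoˡ-≤ (- 1#) 1≤g) , 1≰g-1)))))
    where
    1≰g-1 : ¬ (1# ≤ frac y + frac z - 1#)
    1≰g-1 1≤g-1 with total (frac y) 1#
    ... | inj₂ 1≤y = proj₂ (frac-inUnit y) 1≤y
    ... | inj₁ y≤1 = proj₂ (frac-inUnit z) (≤-trans 1≤g-1
          (≤-resp (solve 3 (λ y z one → y :+ (z :- one) := y :+ z :- one) refl (frac y) (frac z) 1#)
                  (solve 2 (λ z one → one :+ (z :- one) := z) refl (frac z) 1#)
                  (+-monoˡ-≤ (frac z - 1#) y≤1)))

-- Rearrangement of finite sums

module SumRearrangements {k ℓ : Level} (K : CommutativeRing k ℓ) where
  open CommutativeRing K hiding (zero)
  open SemiringMult semiring using (_×_; ×-congʳ; ×-assoc-*)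
  open SemiringSum semiring
  open CommutativeSemigroupProperties *-commutativeSemigroup using (interchange)
  open SetoidReasoning setoid

  ×≈×1* : ∀ n x → n × x ≈ (n × 1#) * x
  ×≈×1* n x = sym (trans (×-assoc-* n 1# x) (×-congʳ n (*-identityˡ x)))

  sum-product : ∀ {l m n} (s : Fin n → Carrier) (P : Fin l → Fin n → Carrier) (Q : Fin m → Fin n → Carrier) →
    sum (λ i → sum (λ j → sum (λ k → s k * (P i k * Q j k)))) ≈
    sum (λ k → s k * sum (λ i → P i k) * sum (λ j → Q j k))
  sum-product {l} {m} {n} s P Q = begin
    sum (λ i → sum (λ j → sum (λ k → s k * (P i k * Q j k))))
      ≈⟨ sum-cong-≋ {l} (λ i → ∑-comm {m} {n} (λ j k → s k * (P i k * Q j k))) ⟩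
    sum (λ i → sum (λ k → sum (λ j → s k * (P i k * Q j k))))
      ≈⟨ ∑-comm {l} {n} (λ i k → sum (λ j → s k * (P i k * Q j k))) ⟩
    sum (λ k → sum (λ i → sum (λ j → s k * (P i k * Q j k))))
      ≈⟨ sum-cong-≋ {n} (λ k → begin
        sum (λ i → sum (λ j → s k * (P i k * Q j k)))
          ≈⟨ sum-cong-≋ {l} (λ i → trans (sum-cong-≋ {m} (λ j → sym (*-assoc (s k) (P i k) (Q j k))))
                                         (sym (*-distribˡ-sum {m} (s k * P i k) (λ j → Q j k)))) ⟩
        sum (λ i → s k * P i k * sum (λ j → Q j k))
          ≈⟨ *-distribʳ-sum {l} (sum (λ j → Q j k)) (λ i → s k * P i k) ⟨
        sum (λ i → s k * P i k) * sum (λ j → Q j k)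
          ≈⟨ *-congʳ (*-distribˡ-sum {l} (s k) (λ i → P i k)) ⟨
        s k * sum (λ i → P i k) * sum (λ j → Q j k) ∎) ⟩
    sum (λ k → s k * sum (λ i → P i k) * sum (λ j → Q j k)) ∎

  -- `f` does not depend on k. Making k the innermost index isolates a sum of `g` alone, to which a
  -- multiplication formula will apply.
  sum-collect : ∀ {l m n} d (c : Fin n → ℕ) (f : Fin n → Fin l → Carrier) (g : Fin n → Fin l → Fin m → Carrier) →
    sum (λ i → sum (λ k → d × sum (λ j → c j × (g j i k * f j i)))) ≈
    (d × 1#) * sum (λ j → (c j × 1#) * sum (λ i → f j i * sum (λ k → g j i k)))
  sum-collect {l} {m} {n} d c f g = begin
    sum (λ i → sum (λ k → d × sum (λ j → c j × (g j i k * f j i))))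
      ≈⟨ sum-cong-≋ {l} (λ i → inner i) ⟩
    sum (λ i → (d × 1#) * sum (λ j → (c j × 1#) * (f j i * G j i)))
      ≈⟨ *-distribˡ-sum {l} (d × 1#) (λ i → sum (λ j → (c j × 1#) * (f j i * G j i))) ⟨
    (d × 1#) * sum (λ i → sum (λ j → (c j × 1#) * (f j i * G j i)))
      ≈⟨ *-congˡ (∑-comm {l} {n} (λ i j → (c j × 1#) * (f j i * G j i))) ⟩
    (d × 1#) * sum (λ j → sum (λ i → (c j × 1#) * (f j i * G j i)))
      ≈⟨ *-congˡ (sum-cong-≋ {n} (λ j → *-distribˡ-sum {l} (c j × 1#) (λ i → f j i * G j i))) ⟨
    (d × 1#) * sum (λ j → (c j × 1#) * sum (λ i → f j i * G j i)) ∎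
    where
    G : Fin n → Fin l → Carrier
    G j i = sum (λ k → g j i k)
    inner : ∀ i → sum (λ k → d × sum (λ j → c j × (g j i k * f j i))) ≈
                  (d × 1#) * sum (λ j → (c j × 1#) * (f j i * G j i))
    inner i = begin
      sum (λ k → d × sum (λ j → c j × (g j i k * f j i)))
        ≈⟨ sum-cong-≋ {m} (λ k → trans (×≈×1* d (sum (λ j → c j × (g j i k * f j i))))
             (*-congˡ (sum-cong-≋ {n} (λ j → trans (×≈×1* (c j) (g j i k * f j i))
                (trans (*-congˡ (*-comm (g j i k) (f j i))) (sym (*-assoc (c j × 1#) (f j i) (g j i k)))))))) ⟩
      sum (λ k → (d × 1#) * sum (λ j → (c j × 1#) * f j i * g j i k))
        ≈⟨ *-distribˡ-sum {m} (d × 1#) (λ k → sum (λ j → (c j × 1#) * f j i * g j i k)) ⟨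
      (d × 1#) * sum (λ k → sum (λ j → (c j × 1#) * f j i * g j i k))
        ≈⟨ *-congˡ (∑-comm {m} {n} (λ k j → (c j × 1#) * f j i * g j i k)) ⟩
      (d × 1#) * sum (λ j → sum (λ k → (c j × 1#) * f j i * g j i k))
        ≈⟨ *-congˡ (sum-cong-≋ {n} (λ j → trans (sym (*-distribˡ-sum {m} ((c j × 1#) * f j i) (λ k → g j i k)))
                                                (*-assoc (c j × 1#) (f j i) (G j i)))) ⟩
      (d × 1#) * sum (λ j → (c j × 1#) * (f j i * G j i)) ∎

  sum-scale : ∀ {n} α β (F H : Fin n → Carrier) →
    sum (λ i → α * F i * (β * H i)) ≈ α * β * sum (λ i → F i * H i)
  sum-scale {n} α β F H = trans
    (sum-cong-≋ {n} (λ i → interchange α (F i) β (H i)))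
    (sym (*-distribˡ-sum {n} (α * β) (λ i → F i * H i)))

nCk*k![n∸k]!≡n! : ∀ {n k} → k ℕ.≤ n → (n C k) ℕ.* (k ! ℕ.* (n ∸ k) !) ≡ n !
nCk*k![n∸k]!≡n! {n} {k} k≤n = ≡.trans
  (≡.cong (ℕ._* (k ! ℕ.* (n ∸ k) !)) (nCk≡n!/k![n-k]! k≤n))
  (ℕ.m/n*n≡m {{k ℕ.!* (n ∸ k) !≢0}} (k![n∸k]!∣n! k≤n))

-- Cancellation in the field of reals

module FieldProperties {r ℓ₁ ℓ₂ : Level} (R : Reals r ℓ₁ ℓ₂) where
  open Reals R
  open CommutativeRing commutativeRing hiding (zero; _+_; _*_; -_; _≈_; 0#; 1#; _-_; semiring)
  open OrderProperties R
  open SumRearrangements commutativeRing using (×≈×1*)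
  open SemiringMult semiring using (×1-homo-*) renaming (_×_ to _×′_)
  open SetoidReasoning setoid

  *-inverseˡ : ∀ {x} → ¬ (x ≈ 0#) → x ⁻¹ * x ≈ 1#
  *-inverseˡ x≉0 = trans (*-comm _ _) (*-inverseʳ _ x≉0)

  *-cancelˡ-≉0 : ∀ {x y z} → ¬ (x ≈ 0#) → x * y ≈ x * z → y ≈ z
  *-cancelˡ-≉0 {x} {y} {z} x≉0 xy≈xz = begin
    y                ≈⟨ *-identityˡ y ⟨
    1# * y           ≈⟨ *-congʳ (*-inverseˡ x≉0) ⟨
    x ⁻¹ * x * y     ≈⟨ *-assoc _ _ _ ⟩
    x ⁻¹ * (x * y)   ≈⟨ *-congˡ xy≈xz ⟩
    x ⁻¹ * (x * z)   ≈⟨ *-assoc _ _ _ ⟨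
    x ⁻¹ * x * z     ≈⟨ *-congʳ (*-inverseˡ x≉0) ⟩
    1# * z           ≈⟨ *-identityˡ z ⟩
    z                ∎

  *-≉0 : ∀ {x y} → ¬ (x ≈ 0#) → ¬ (y ≈ 0#) → ¬ (x * y ≈ 0#)
  *-≉0 x≉0 y≉0 xy≈0 = y≉0 (*-cancelˡ-≉0 x≉0 (trans xy≈0 (sym (zeroʳ _))))

  ^-≉0 : ∀ {x} n → ¬ (x ≈ 0#) → ¬ (x ^ n ≈ 0#)
  ^-≉0 zero    x≉0 eq = 0≉1 (sym eq)
  ^-≉0 (suc n) x≉0 eq = *-≉0 x≉0 (^-≉0 n x≉0) eq

  ×≈fromℕ* : ∀ n x → n ×′ x ≈ fromℕ n * x
  ×≈fromℕ* = ×≈×1*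

  fromℕ-* : ∀ m n → fromℕ (m ℕ.* n) ≈ fromℕ m * fromℕ n
  fromℕ-* = ×1-homo-*

  torsionFree : ∀ n {x y} → suc n ×′ x ≈ suc n ×′ y → x ≈ y
  torsionFree n {x} {y} eq = *-cancelˡ-≉0 (fromℕ-suc≉0 n)
    (trans (sym (×≈fromℕ* (suc n) x)) (trans eq (×≈fromℕ* (suc n) y)))

-- From the generating functions to functional equations

module BernoulliSeries {r ℓ₁ ℓ₂ : Level} (R : Reals r ℓ₁ ℓ₂) where
  open Reals R
  open CommutativeRing commutativeRing hiding (zero; _+_; _*_; -_; _≈_; 0#; 1#; _-_; semiring)
  open OrderProperties R
  open IntegerEmbedding R
  open FieldProperties R
  open PowerSeries R using (_⊛_; egf; one; t⊛; _⊖_) renaming (exp to expₒ; _⊕_ to _⊕ₒ_)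
  open BernoulliEuler R
  open GeneratingFunctions R
  open Hurwitz commutativeRing
  open SemiringMult semiring using () renaming (_×_ to _×′_)
  open SemiringSum semiring using (sum-cong-≋; *-distribʳ-sum)
  open SetoidReasoning setoid
  private module H₁ = CommutativeRing hurwitzRing

  !⁻¹-product : ∀ {n k} → k ℕ.≤ n →
    fromℕ (n C k) * fromℕ (n !) ⁻¹ ≈ fromℕ (k !) ⁻¹ * fromℕ ((n ∸ k) !) ⁻¹
  !⁻¹-product {n} {k} k≤n = *-cancelˡ-≉0 (*-≉0 I≉0 J≉0) (begin
    I * J * (c * N ⁻¹)          ≈⟨ solve 4 (λ I J c N → I :* J :* (c :* N) := c :* (I :* J) :* N) refl I J c (N ⁻¹) ⟩
    c * (I * J) * N ⁻¹          ≈⟨ *-congʳ c*IJ≈N ⟩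
    N * N ⁻¹                    ≈⟨ *-inverseʳ N (fromℕ-!≉0 n) ⟩
    1#                          ≈⟨ *-identityˡ 1# ⟨
    1# * 1#                     ≈⟨ *-cong (*-inverseʳ I I≉0) (*-inverseʳ J J≉0) ⟨
    (I * I ⁻¹) * (J * J ⁻¹)     ≈⟨ solve 4 (λ I I′ J J′ → (I :* I′) :* (J :* J′) := I :* J :* (I′ :* J′)) refl I (I ⁻¹) J (J ⁻¹) ⟩
    I * J * (I ⁻¹ * J ⁻¹)       ∎)
    where
    I J N c : ℝ
    I = fromℕ (k !)
    J = fromℕ ((n ∸ k) !)
    N = fromℕ (n !)
    c = fromℕ (n C k)
    I≉0 : ¬ (I ≈ 0#)
    I≉0 = fromℕ-!≉0 k
    J≉0 : ¬ (J ≈ 0#)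
    J≉0 = fromℕ-!≉0 (n ∸ k)
    c*IJ≈N : c * (I * J) ≈ N
    c*IJ≈N = trans (*-congˡ (sym (fromℕ-* (k !) ((n ∸ k) !))))
      (trans (sym (fromℕ-* (n C k) (k ! ℕ.* (n ∸ k) !)))
             (reflexive (≡.cong fromℕ (nCk*k![n∸k]!≡n! k≤n))))

  -- The bridge between the Cauchy product, in which the definitions are stated, and the Leibniz
  -- product: (n choose i)/n! is 1/(i! (n - i)!).
  egf-⊛ : ∀ f g n → (egf f ⊛ egf g) n ≈ egf (f ⋆ g) n
  egf-⊛ f g n = sym (trans (*-congʳ (⋆≋binomialSum f g n)) (trans
    (*-distribʳ-sum {suc n} (fromℕ (n !) ⁻¹) (λ i → (n C toℕ i) ×′ (f (toℕ i) * g (n ∸ toℕ i))))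
    (sum-cong-≋ {suc n} λ i → term (toℕ i) (ℕ.≤-pred (toℕ<n i)))))
    where
    term : ∀ i → i ℕ.≤ n → (n C i) ×′ (f i * g (n ∸ i)) * fromℕ (n !) ⁻¹ ≈ egf f i * egf g (n ∸ i)
    term i i≤n = begin
      (n C i) ×′ (f i * g (n ∸ i)) * fromℕ (n !) ⁻¹
        ≈⟨ *-congʳ (×≈fromℕ* (n C i) _) ⟩
      fromℕ (n C i) * (f i * g (n ∸ i)) * fromℕ (n !) ⁻¹
        ≈⟨ solve 4 (λ c f g N → c :* (f :* g) :* N := f :* g :* (c :* N)) refl
             (fromℕ (n C i)) (f i) (g (n ∸ i)) (fromℕ (n !) ⁻¹) ⟩
      f i * g (n ∸ i) * (fromℕ (n C i) * fromℕ (n !) ⁻¹)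
        ≈⟨ *-congˡ (!⁻¹-product i≤n) ⟩
      f i * g (n ∸ i) * (fromℕ (i !) ⁻¹ * fromℕ ((n ∸ i) !) ⁻¹)
        ≈⟨ solve 4 (λ f g I J → f :* g :* (I :* J) := f :* I :* (g :* J)) refl
             (f i) (g (n ∸ i)) (fromℕ (i !) ⁻¹) (fromℕ ((n ∸ i) !) ⁻¹) ⟩
      egf f i * egf g (n ∸ i) ∎

  egf-injective : ∀ {f g} → (∀ n → egf f n ≈ egf g n) → f ≋ g
  egf-injective {f} {g} eq n = *-cancelˡ-≉0 !⁻¹≉0
    (trans (*-comm _ _) (trans (eq n) (*-comm _ _)))
    where
    !⁻¹≉0 : ¬ (fromℕ (n !) ⁻¹ ≈ 0#)
    !⁻¹≉0 eq′ = 0≉1 (trans (sym (zeroʳ _)) (trans (*-congˡ (sym eq′)) (*-inverseʳ _ (fromℕ-!≉0 n))))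

  egf-one : ∀ n → one n ≈ egf (const 1#) n
  egf-one zero    = sym (trans (*-identityˡ _) 1/1≈1)
  egf-one (suc n) = sym (zeroˡ _)

  egf-t⋆ : ∀ f n → t⊛ (egf f) n ≈ egf (t ⋆ f) n
  egf-t⋆ f zero    = sym (trans (*-congʳ (zeroˡ _)) (zeroˡ _))
  egf-t⋆ f (suc n) = sym (begin
    (t ⋆ f) (suc n) * fromℕ (suc n !) ⁻¹
      ≈⟨ *-congʳ (trans (t⋆ f n) (×≈fromℕ* (suc n) (f n))) ⟩
    fromℕ (suc n) * f n * fromℕ (suc n !) ⁻¹
      ≈⟨ solve 3 (λ k f N → k :* f :* N := f :* (k :* N)) refl (fromℕ (suc n)) (f n) (fromℕ (suc n !) ⁻¹) ⟩
    f n * (fromℕ (suc n) * fromℕ (suc n !) ⁻¹)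
      ≈⟨ *-congˡ (*-cancelˡ-≉0 (fromℕ-!≉0 n) (begin
           fromℕ (n !) * (fromℕ (suc n) * fromℕ (suc n !) ⁻¹)
             ≈⟨ solve 3 (λ m k N → m :* (k :* N) := (k :* m) :* N) refl
                  (fromℕ (n !)) (fromℕ (suc n)) (fromℕ (suc n !) ⁻¹) ⟩
           fromℕ (suc n) * fromℕ (n !) * fromℕ (suc n !) ⁻¹
             ≈⟨ *-congʳ (fromℕ-* (suc n) (n !)) ⟨
           fromℕ (suc n !) * fromℕ (suc n !) ⁻¹
             ≈⟨ *-inverseʳ _ (fromℕ-!≉0 (suc n)) ⟩
           1#
             ≈⟨ *-inverseʳ _ (fromℕ-!≉0 n) ⟨
           fromℕ (n !) * fromℕ (n !) ⁻¹ ∎)) ⟩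
    f n * fromℕ (n !) ⁻¹ ∎)

  ⊛-congʳ : ∀ {f g} h → (∀ n → f n ≈ g n) → ∀ n → (f ⊛ h) n ≈ (g ⊛ h) n
  ⊛-congʳ h f≈g n = sum-cong-≋ {suc n} λ i → *-congʳ {h (n ∸ toℕ i)} (f≈g (toℕ i))

  bernoulliSeries eulerSeries : ℝ → Series
  bernoulliSeries x n = bernoulli n x
  eulerSeries     x n = euler n x

  bernoulli-difference : ∀ x → exp 1# ⋆ bernoulliSeries x ≋ bernoulliSeries x ⊕ t ⋆ exp x
  bernoulli-difference x = H₁.trans (⋆-cong e≋ (H₁.refl {bernoulliSeries x}))
    (H₁.trans (⋆-distribʳ-⊕ (bernoulliSeries x) (const 1#) e-1)
      (H₁.+-cong (one⋆ (bernoulliSeries x)) e-1⋆b))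
    where
    e-1 : Series
    e-1 n = exp 1# n - const 1# n
    e≋ : exp 1# ≋ const 1# ⊕ e-1
    e≋ n = solve 2 (λ e c → e := c :+ (e :- c)) refl (exp 1# n) (const 1# n)
    egf-e-1 : ∀ n → (expₒ 1# ⊖ one) n ≈ egf e-1 n
    egf-e-1 n = trans (+-congˡ (-‿cong (egf-one n)))
      (solve 3 (λ e c N → e :* N :- c :* N := (e :- c) :* N) refl (exp 1# n) (const 1# n) (fromℕ (n !) ⁻¹))
    e-1⋆b : e-1 ⋆ bernoulliSeries x ≋ t ⋆ exp x
    e-1⋆b = egf-injective λ n → begin
      egf (e-1 ⋆ bernoulliSeries x) n              ≈⟨ egf-⊛ e-1 (bernoulliSeries x) n ⟨
      (egf e-1 ⊛ egf (bernoulliSeries x)) n        ≈⟨ ⊛-congʳ (egf (bernoulliSeries x)) egf-e-1 n ⟨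
      ((expₒ 1# ⊖ one) ⊛ egf (bernoulliSeries x)) n ≈⟨ bernoulli-egf x n ⟩
      t⊛ (expₒ x) n                                ≈⟨ egf-t⋆ (exp x) n ⟩
      egf (t ⋆ exp x) n                            ∎

  euler-sum : ∀ x → (exp 1# ⊕ const 1#) ⋆ eulerSeries x ≋ const (fromℕ 2) ⋆ exp x
  euler-sum x = egf-injective λ n → begin
    egf ((exp 1# ⊕ const 1#) ⋆ eulerSeries x) n        ≈⟨ egf-⊛ (exp 1# ⊕ const 1#) (eulerSeries x) n ⟨
    (egf (exp 1# ⊕ const 1#) ⊛ egf (eulerSeries x)) n  ≈⟨ ⊛-congʳ (egf (eulerSeries x)) egf-e+1 n ⟨
    ((expₒ 1# ⊕ₒ one) ⊛ egf (eulerSeries x)) n         ≈⟨ euler-egf x n ⟩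
    fromℕ 2 * (exp x n * fromℕ (n !) ⁻¹)               ≈⟨ *-assoc _ _ _ ⟨
    fromℕ 2 * exp x n * fromℕ (n !) ⁻¹                 ≈⟨ *-congʳ (const⋆ (fromℕ 2) (exp x) n) ⟨
    egf (const (fromℕ 2) ⋆ exp x) n                    ∎
    where
    egf-e+1 : ∀ n → (expₒ 1# ⊕ₒ one) n ≈ egf (exp 1# ⊕ const 1#) n
    egf-e+1 n = trans (+-congˡ (egf-one n)) (sym (distribʳ _ _ _))

-- Bernoulli and Euler functions on the whole line

module PeriodicFormulas {r ℓ₁ ℓ₂ : Level} (R : Reals r ℓ₁ ℓ₂) where
  open Reals R
  open CommutativeRing commutativeRing hiding (zero; _+_; _*_; -_; _≈_; 0#; 1#; _-_; semiring)
  open OrderProperties R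
  open IntegerEmbedding R
  open FractionalPart R
  open FieldProperties R
  open BernoulliSeries R
  open BernoulliEuler R
  open GeneratingFunctions R using (1#^n≈1)
  open Hurwitz commutativeRing
  open SemiringMult semiring using () renaming (_×_ to _×′_)
  open SemiringSum semiring using (sum-cong-≋; *-distribˡ-sum)
  open RingProperties ring using (+-cancelʳ)
  open GeometricQuotients commutativeRing using (sum-shift)
  open Bivariate commutativeRing
  open TorsionFree torsionFree
  open AppellBernoulli bernoulliSeries bernoulli-difference using (reflected; averaged)
  open Distribution commutativeRing
  open WithBernoulli torsionFree bernoulliSeries bernoulli-difference
  open AppellEuler eulerSeries euler-sum
  open IsDecTotalOrder isDecTotalOrder
    using (total; antisym; ≤-respʳ-≈; ≤-respˡ-≈) renaming (trans to ≤-trans)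
  open SetoidReasoning setoid

  bernoulliFun-cong : ∀ n {x y} → x ≈ y → bernoulliFun n x ≈ bernoulliFun n y
  bernoulliFun-cong n x≈y = b-cong (frac-cong x≈y) n

  bernoulliFun-+1 : ∀ n x → bernoulliFun n (x + 1#) ≈ bernoulliFun n x
  bernoulliFun-+1 n x = b-cong (frac-unique (ℤ.suc (floor x))
    (trans (solve 3 (λ x m one → x :+ one := (x :- m) :+ (one :+ m)) refl x (fromℤ (floor x)) 1#)
           (+-congˡ (sym (fromℤ-suc (floor x)))))
    (frac-inUnit x)) n

  quasiPeriodic-ℕ : ∀ {s} (A : ℝ → ℝ) → (∀ {x y} → x ≈ y → A x ≈ A y) →
    (∀ w → A (w + 1#) ≈ s * A w) → ∀ n w → A (w + fromℕ n) ≈ s ^ n * A w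
  quasiPeriodic-ℕ A cong shift zero    w = trans (cong (+-identityʳ w)) (sym (*-identityˡ _))
  quasiPeriodic-ℕ {s} A cong shift (suc n) w = begin
    A (w + (1# + fromℕ n))  ≈⟨ cong (solve 3 (λ w o n → w :+ (o :+ n) := w :+ n :+ o) refl w 1# (fromℕ n)) ⟩
    A (w + fromℕ n + 1#)    ≈⟨ shift _ ⟩
    s * A (w + fromℕ n)     ≈⟨ *-congˡ (quasiPeriodic-ℕ A cong shift n w) ⟩
    s * (s ^ n * A w)       ≈⟨ *-assoc _ _ _ ⟨
    s * s ^ n * A w         ∎

  quasiPeriodic : ∀ {s} (A : ℝ → ℝ) → ¬ (s ≈ 0#) → (∀ {x y} → x ≈ y → A x ≈ A y) →
    (∀ w → A (w + 1#) ≈ s * A w) → ∀ m w → A (w + fromℤ m) ≈ s ^ℤ m * A w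
  quasiPeriodic A s≉0 cong shift (ℤ.+ n)  w = quasiPeriodic-ℕ A cong shift n w
  quasiPeriodic {s} A s≉0 cong shift -[1+ n ] w = *-cancelˡ-≉0 sᴺ≉0 (begin
    s ^ suc n * A (w - N)            ≈⟨ quasiPeriodic-ℕ A cong shift (suc n) (w - N) ⟨
    A (w - N + N)                    ≈⟨ cong (solve 2 (λ w N → w :- N :+ N := w) refl w N) ⟩
    A w                              ≈⟨ *-identityˡ _ ⟨
    1# * A w                         ≈⟨ *-congʳ (*-inverseʳ _ sᴺ≉0) ⟨
    s ^ suc n * (s ^ suc n) ⁻¹ * A w ≈⟨ *-assoc _ _ _ ⟩
    s ^ suc n * ((s ^ suc n) ⁻¹ * A w) ∎)
    where
    N : ℝ
    N = fromℕ (suc n)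
    sᴺ≉0 : ¬ (s ^ suc n ≈ 0#)
    sᴺ≉0 = ^-≉0 (suc n) s≉0

  0≤⁻¹ : ∀ n → 0# ≤ fromℕ (suc n) ⁻¹
  0≤⁻¹ n with total 0# (fromℕ (suc n) ⁻¹)
  ... | inj₁ 0≤ = 0≤
  ... | inj₂ ≤0 = contradiction (antisym 0≤1 1≤0) 0≉1
    where
    0≤-1 : 0# ≤ - 1#
    0≤-1 = ≤-respʳ-≈ (trans (solve 2 (λ c k → c :* (:- k) := :- (c :* k)) refl (fromℕ (suc n)) (fromℕ (suc n) ⁻¹))
                            (-‿cong (*-inverseʳ _ (fromℕ-suc≉0 n))))
      (*-nonNeg (fromℕ-mono {0} {suc n} ℕ.z≤n) (x≤0⇒0≤-x ≤0))
    1≤0 : 1# ≤ 0#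
    1≤0 = ≤-resp (+-identityˡ 1#) (-‿inverseˡ 1#) (+-monoˡ-≤ 1# 0≤-1)

  -- For a shift in [0,1) none of the points (i + f)/N leaves [0,1), so there the periodic functions
  -- are the polynomials and the polynomial formulas apply.
  fraction-inUnit : ∀ {n i f} → i ℕ.< suc n → InUnit f → InUnit ((fromℕ i + f) / fromℕ (suc n))
  fraction-inUnit {n} {i} {f} i<1+n (0≤f , 1≰f) =
      *-nonNeg (≤-trans 0≤f (≤-respˡ-≈ (+-identityˡ f) (+-monoˡ-≤ f (fromℕ-mono {0} {i} ℕ.z≤n)))) (0≤⁻¹ n)
    , λ 1≤x → 1≰f (≤-resp (solve 2 (λ o i → o :+ i :- i := o) refl 1# (fromℕ i))
                          (solve 2 (λ f i → i :+ f :- i := f) refl f (fromℕ i))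
                          (+-monoˡ-≤ (- fromℕ i) (≤-trans (fromℕ-mono i<1+n) (N≤i+f 1≤x))))
    where
    N = fromℕ (suc n)
    N≤i+f : 1# ≤ (fromℕ i + f) / N → N ≤ fromℕ i + f
    N≤i+f 1≤x = ≤-resp (+-identityˡ N)
      (begin
        N * ((fromℕ i + f) * N ⁻¹ - 1#) + N
          ≈⟨ solve 4 (λ N y k o → N :* (y :* k :- o) :+ N := y :* (N :* k) :+ (N :- N :* o)) refl
               N (fromℕ i + f) (N ⁻¹) 1# ⟩
        (fromℕ i + f) * (N * N ⁻¹) + (N - N * 1#)
          ≈⟨ +-cong (trans (*-congˡ (*-inverseʳ N (fromℕ-suc≉0 n))) (*-identityʳ _))
                    (trans (+-congˡ (-‿cong (*-identityʳ N))) (-‿inverseʳ N)) ⟩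
        fromℕ i + f + 0#
          ≈⟨ +-identityʳ _ ⟩
        fromℕ i + f ∎)
      (+-monoˡ-≤ N (*-nonNeg (fromℕ-mono {0} {suc n} ℕ.z≤n)
        (≤-respˡ-≈ (-‿inverseʳ 1#) (+-monoˡ-≤ (- 1#) 1≤x))))

  frac-fraction : ∀ {n i f} → i ℕ.< suc n → InUnit f →
    frac ((fromℕ i + f) / fromℕ (suc n)) ≈ (fromℕ i + f) / fromℕ (suc n)
  frac-fraction i<1+n f∈ = frac-unique (ℤ.+ 0) (sym (+-identityʳ _)) (fraction-inUnit i<1+n f∈)

  fraction-* : ∀ n x → fromℕ (suc n) * (x / fromℕ (suc n)) ≈ x
  fraction-* n x = trans (solve 3 (λ N x k → N :* (x :* k) := x :* (N :* k)) refl
                            (fromℕ (suc n)) x (fromℕ (suc n) ⁻¹))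
                         (trans (*-congˡ (*-inverseʳ _ (fromℕ-suc≉0 n))) (*-identityʳ x))

  -- Serves to reduce an arbitrary shift w to its fractional part. The case s = 1 belongs to the
  -- multiplication formula. For s = -1, where `sᶜ≈1` is the evenness of the modulus, the sum
  -- changes sign under w ↦ w + 1 just as `eulerFun` does.
  module TwistedSum (F : ℝ → ℝ) (F-cong : ∀ {x y} → x ≈ y → F x ≈ F y) (F-+1 : ∀ x → F (x + 1#) ≈ F x)
    (s : ℝ) (s*s≈1 : s * s ≈ 1#) (c : ℕ) (sᶜ≈1 : s ^ suc c ≈ 1#) where
    private
      N = fromℕ (suc c)

    twisted : ℝ → ℝ
    twisted w = ∑[ i < suc c ] (s ^ toℕ i * F ((fromℕ (toℕ i) + w) / N))

    s≉0 : ¬ (s ≈ 0#)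
    s≉0 s≈0 = 0≉1 (trans (sym (zeroˡ s)) (trans (*-congʳ (sym s≈0)) s*s≈1))

    twisted-cong : ∀ {x y} → x ≈ y → twisted x ≈ twisted y
    twisted-cong {x} {y} x≈y = sum-cong-≋ {suc c} λ i → *-congˡ {s ^ toℕ i}
      (F-cong (*-congʳ {N ⁻¹} (+-congˡ {fromℕ (toℕ i)} x≈y)))

    -- Adding 1 to w moves every index up by one. The term that leaves the range returns as term 0,
    -- by `sᶜ≈1` and the period of F, so s times the shifted sum is the old sum; and s is its own
    -- inverse.
    twisted-+1 : ∀ w → twisted (w + 1#) ≈ s * twisted w
    twisted-+1 w = begin
      twisted (w + 1#)              ≈⟨ *-identityˡ (twisted (w + 1#)) ⟨
      1# * twisted (w + 1#)         ≈⟨ *-congʳ s*s≈1 ⟨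
      s * s * twisted (w + 1#)      ≈⟨ *-assoc s s (twisted (w + 1#)) ⟩
      s * (s * twisted (w + 1#))    ≈⟨ *-congˡ s*shifted ⟩
      s * twisted w                 ∎
      where
      G : ℕ → ℝ
      G i = s ^ i * F ((fromℕ i + w) / N)
      Gᶜ≈G⁰ : G (suc c) ≈ G 0
      Gᶜ≈G⁰ = *-cong sᶜ≈1 (trans
        (F-cong (begin
          (N + w) * N ⁻¹              ≈⟨ distribʳ _ _ _ ⟩
          N * N ⁻¹ + w * N ⁻¹         ≈⟨ +-cong (*-inverseʳ N (fromℕ-suc≉0 c)) (*-congʳ (sym (+-identityˡ w))) ⟩
          1# + (0# + w) * N ⁻¹        ≈⟨ +-comm _ _ ⟩
          (0# + w) * N ⁻¹ + 1#        ∎))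
        (F-+1 ((0# + w) * N ⁻¹)))
      s*shifted : s * twisted (w + 1#) ≈ twisted w
      s*shifted = begin
        s * twisted (w + 1#)
          ≈⟨ *-distribˡ-sum {suc c} s
               (λ i → s ^ toℕ i * F ((fromℕ (toℕ i) + (w + 1#)) / N)) ⟩
        ∑[ i < suc c ] (s * (s ^ toℕ i * F ((fromℕ (toℕ i) + (w + 1#)) / N)))
          ≈⟨ sum-cong-≋ {suc c} (λ i → trans
               (sym (*-assoc s (s ^ toℕ i) (F ((fromℕ (toℕ i) + (w + 1#)) / N))))
               (*-congˡ {s * s ^ toℕ i}
                 (F-cong (*-congʳ {N ⁻¹} (solve 3 (λ i w o → i :+ (w :+ o) := o :+ i :+ w) refl
                   (fromℕ (toℕ i)) w 1#))))) ⟩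
        ∑[ i < suc c ] G (suc (toℕ i))
          ≈⟨ +-cancelʳ (G 0) _ _ (trans (sum-shift G (suc c)) (+-congˡ Gᶜ≈G⁰)) ⟩
        twisted w ∎

    twisted-frac : ∀ w → twisted w ≈ s ^ℤ floor w * twisted (frac w)
    twisted-frac w = trans (twisted-cong (frac+floor w))
      (quasiPeriodic twisted s≉0 twisted-cong twisted-+1 (floor w) (frac w))

  bernoulliFun-fraction : ∀ n {a i} w → i ℕ.< suc a →
    bernoulliFun n ((fromℕ i + frac w) / fromℕ (suc a)) ≈ bernoulli n ((fromℕ i + frac w) / fromℕ (suc a))
  bernoulliFun-fraction n {a} {i} w i<1+a =
    b-cong {frac ((fromℕ i + frac w) / fromℕ (suc a))} {(fromℕ i + frac w) / fromℕ (suc a)}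
      (frac-fraction i<1+a (frac-inUnit w)) n

  bernoulliFun-multiplication : ∀ a n w →
    fromℕ (suc a) ^ n * (∑[ i < suc a ] bernoulliFun n ((fromℕ (toℕ i) + w) / fromℕ (suc a)))
      ≈ fromℕ (suc a) * bernoulliFun n w
  bernoulliFun-multiplication a n w = begin
    N ^ n * (∑[ i < suc a ] bernoulliFun n ((fromℕ (toℕ i) + w) / N))
      ≈⟨ *-congˡ (sum-cong-≋ {suc a} λ i → 1^i* (toℕ i) (bernoulliFun n ((fromℕ (toℕ i) + w) / N))) ⟨
    N ^ n * twisted w
      ≈⟨ *-congˡ (trans (twisted-frac w) (trans (*-congʳ (1^ℤ (floor w))) (*-identityˡ (twisted (frac w))))) ⟩
    N ^ n * twisted (frac w)
      ≈⟨ *-congˡ (sum-cong-≋ {suc a} λ i → trans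
           (1^i* (toℕ i) (bernoulliFun n ((fromℕ (toℕ i) + frac w) / N)))
           (bernoulliFun-fraction n w (toℕ<n i))) ⟩
    N ^ n * (∑[ i < suc a ] bernoulli n ((fromℕ (toℕ i) + frac w) / N))
      ≈⟨ multiplication-formula a (frac w) (λ i → (fromℕ i + frac w) / N)
           (λ i → fraction-* a (fromℕ i + frac w)) n ⟩
    N * bernoulliFun n w ∎
    where
    N : ℝ
    N = fromℕ (suc a)
    open TwistedSum (bernoulliFun n) (bernoulliFun-cong n) (bernoulliFun-+1 n)
      1# (*-identityˡ 1#) a (1#^n≈1 (suc a))
    1^i* : ∀ i y → 1# ^ i * y ≈ y
    1^i* i y = trans (*-congʳ (1#^n≈1 i)) (*-identityˡ y)
    1^ℤ : ∀ m → 1# ^ℤ m ≈ 1#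
    1^ℤ (ℤ.+ n)  = 1#^n≈1 n
    1^ℤ -[1+ n ] = trans (sym (*-identityˡ _)) (trans (*-congʳ (sym (1#^n≈1 (suc n))))
      (*-inverseʳ _ (^-≉0 (suc n) (λ 1≈0 → 0≉1 (sym 1≈0)))))

  module Alternating (c : ℕ) (even : (- 1#) ^ suc c ≈ 1#) where
    private
      N : ℝ
      N = fromℕ (suc c)
      -1*-1≈1 : - 1# * - 1# ≈ 1#
      -1*-1≈1 = trans (solve 1 (λ o → :- o :* :- o := o :* o) refl 1#) (*-identityˡ 1#)

    module _ (n : ℕ) where
      open TwistedSum (bernoulliFun n) (bernoulliFun-cong n) (bernoulliFun-+1 n)
        (- 1#) -1*-1≈1 c even public

    scaledEuler : ℝ → Series
    scaledEuler w n = - (fromℕ 2 ⁻¹ * (N ^ n) ⁻¹ * eulerFun n w)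

    -- Both terms acquire the same sign (-1)^{[w]} when w is replaced by its fractional part, so the
    -- formula for polynomials extends to all w.
    eulerFun-alternating : ∀ n w →
      fromℕ 2 * (N ^ n * twisted n w) + N * (t ⋆ (λ i → eulerFun i w)) n ≈ 0#
    eulerFun-alternating n w = begin
      fromℕ 2 * (N ^ n * twisted n w) + N * (t ⋆ (λ i → eulerFun i w)) n
        ≈⟨ +-cong (*-congˡ (*-congˡ (trans (twisted-frac n w) (*-congˡ {σʷ} toPolynomial))))
                  (*-congˡ (⋆scale σʷ t (eulerSeries (frac w)) n)) ⟩
      fromℕ 2 * (N ^ n * (σʷ * S)) + N * (σʷ * T)
        ≈⟨ factor (fromℕ 2) (N ^ n) σʷ S N T ⟩
      σʷ * (fromℕ 2 * (N ^ n * S) + N * T)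
        ≈⟨ *-congˡ (alternating-formula c (frac w) (λ i → (fromℕ i + frac w) / N)
                      (λ i → fraction-* c (fromℕ i + frac w)) even n) ⟩
      σʷ * 0#
        ≈⟨ zeroʳ σʷ ⟩
      0# ∎
      where
      σʷ S T : ℝ
      σʷ = (- 1#) ^ℤ floor w
      S = ∑[ i < suc c ] ((- 1#) ^ toℕ i * bernoulli n ((fromℕ (toℕ i) + frac w) / N))
      T = (t ⋆ eulerSeries (frac w)) n
      toPolynomial : twisted n (frac w) ≈ S
      toPolynomial = sum-cong-≋ {suc c} λ i → *-congˡ {(- 1#) ^ toℕ i} (bernoulliFun-fraction n w (toℕ<n i))
      factor : ∀ two Nⁿ s S N T → two * (Nⁿ * (s * S)) + N * (s * T) ≈ s * (two * (Nⁿ * S) + N * T)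
      factor = solve 6 (λ two Nⁿ s S N T → two :* (Nⁿ :* (s :* S)) :+ N :* (s :* T)
                          := s :* (two :* (Nⁿ :* S) :+ N :* T)) refl

    -- The divisibility by t demanded by `averaged`. At n = 0 it says that the signs cancel. In the
    -- proof both sides, scaled by 2 N^n, are compared through the common term `N * (t ⋆ E) n`,
    -- which completes each of them to 0.
    twisted≈t⋆scaledEuler : ∀ w n → twisted n w ≈ (t ⋆ scaledEuler w) n
    twisted≈t⋆scaledEuler w n = *-cancelˡ-≉0 (fromℕ-suc≉0 1) (*-cancelˡ-≉0 (^-≉0 n (fromℕ-suc≉0 c))
      (+-cancelʳ (N * (t ⋆ E) n) (N ^ n * (fromℕ 2 * twisted n w)) (N ^ n * (fromℕ 2 * (t ⋆ scaledEuler w) n))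
        (trans (trans (+-congʳ (swap (N ^ n) (fromℕ 2) (twisted n w))) (eulerFun-alternating n w))
               (sym (cancels n)))))
      where
      E : Series
      E i = eulerFun i w
      swap : ∀ x y z → x * (y * z) ≈ y * (x * z)
      swap = solve 3 (λ x y z → x :* (y :* z) := y :* (x :* z)) refl
      regroup : ∀ N Nᵐ two M h k e → N * Nᵐ * (two * (M * - (h * k * e))) + N * (M * e) ≈
                N * (M * e) - (two * h) * (Nᵐ * k) * (N * (M * e))
      regroup = solve 7 (λ N Nᵐ two M h k e →
        N :* Nᵐ :* (two :* (M :* :- (h :* k :* e))) :+ N :* (M :* e)
        := N :* (M :* e) :- (two :* h) :* (Nᵐ :* k) :* (N :* (M :* e))) refl
      0⋆0 : ∀ x y → x * (0# * y) ≈ 0#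
      0⋆0 x y = trans (*-congˡ (zeroˡ y)) (zeroʳ x)
      cancels : ∀ n → N ^ n * (fromℕ 2 * (t ⋆ scaledEuler w) n) + N * (t ⋆ E) n ≈ 0#
      cancels zero    = trans
        (+-cong (trans (*-congˡ (0⋆0 (fromℕ 2) (scaledEuler w 0))) (zeroʳ 1#)) (0⋆0 N (E 0)))
        (+-identityˡ 0#)
      cancels (suc m) = begin
        N * N ^ m * (fromℕ 2 * (t ⋆ scaledEuler w) (suc m)) + N * (t ⋆ E) (suc m)
          ≈⟨ +-cong (*-congˡ (*-congˡ (trans (t⋆ (scaledEuler w) m) (×≈fromℕ* (suc m) (scaledEuler w m)))))
                    (*-congˡ (trans (t⋆ E m) (×≈fromℕ* (suc m) (E m)))) ⟩
        N * N ^ m * (fromℕ 2 * (M * scaledEuler w m)) + N * (M * E m)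
          ≈⟨ regroup N (N ^ m) (fromℕ 2) M (fromℕ 2 ⁻¹) ((N ^ m) ⁻¹) (E m) ⟩
        N * (M * E m) - (fromℕ 2 * fromℕ 2 ⁻¹) * (N ^ m * (N ^ m) ⁻¹) * (N * (M * E m))
          ≈⟨ +-congˡ (-‿cong (trans (*-congʳ (trans (*-cong (*-inverseʳ _ (fromℕ-suc≉0 1))
               (*-inverseʳ _ (^-≉0 m (fromℕ-suc≉0 c)))) (*-identityˡ 1#))) (*-identityˡ (N * (M * E m))))) ⟩
        N * (M * E m) - N * (M * E m)
          ≈⟨ -‿inverseʳ (N * (M * E m)) ⟩
        0# ∎
        where
        M : ℝ
        M = fromℕ (suc m)

    -- The coefficient at `suc p`, `suc q` of the averaged addition formula. The sign (-1)^h in the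
    -- second sum is that of `reflected`.
    alternating-product : ∀ p q u v →
      ∑[ i < suc c ] ((- 1#) ^ toℕ i *
        (bernoulliFun (suc p) ((fromℕ (toℕ i) + u) / N) * bernoulliFun (suc q) ((fromℕ (toℕ i) + v) / N)))
      ≈ suc q ×′ (∑[ j ≤ suc p ] ((suc p C toℕ j) ×′
            (bernoulliFun (toℕ j) ((u - v) / N) * scaledEuler v (suc p ∸ toℕ j ℕ.+ q))))
        + suc p ×′ (∑[ h ≤ suc q ] ((suc q C toℕ h) ×′
            ((- 1#) ^ toℕ h * bernoulliFun (toℕ h) ((u - v) / N) * scaledEuler u (p ℕ.+ (suc q ∸ toℕ h)))))
    alternating-product p q u v = trans
      (averaged {suc c} (λ i → (- 1#) ^ toℕ i)
        (λ i → frac ((fromℕ (toℕ i) + u) / N)) (λ i → frac ((fromℕ (toℕ i) + v) / N)) δ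
        (scaledEuler u) (scaledEuler v)
        -- Whether a carry occurs may depend on i, but the third point δ does not.
        (λ i → frac-+ {(fromℕ (toℕ i) + u) / N} {(fromℕ (toℕ i) + v) / N} {(u - v) / N}
                 (difference (fromℕ (toℕ i)) u v (N ⁻¹)))
        (twisted≈t⋆scaledEuler u) (twisted≈t⋆scaledEuler v) (suc p) (suc q))
      (+-cong (coefficient-V (bernoulliSeries δ) (scaledEuler v) (suc p) q)
              (coefficient-U (scaledEuler u) (reflected δ) p (suc q)))
      where
      δ : ℝ
      δ = frac ((u - v) / N)
      difference : ∀ i u v k → (i + u) * k ≈ (i + v) * k + (u - v) * k
      difference = solve 4 (λ i u v k → (i :+ u) :* k := (i :+ v) :* k :+ (u :- v) :* k) refl

-- Powers with integer exponents

module IntegerPowers {r ℓ₁ ℓ₂ : Level} (R : Reals r ℓ₁ ℓ₂) where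
  open Reals R
  open CommutativeRing commutativeRing hiding (zero; _+_; _*_; -_; _≈_; 0#; 1#; _-_; semiring)
  open FieldProperties R
  open IntegerEmbedding R using (solve; _:*_; _:=_)
  open SemiringExp semiring using (^-homo-*)
  open SetoidReasoning setoid

  ^ℤ-⊖ : ∀ {x} → ¬ (x ≈ 0#) → ∀ m n → x ^ℤ (m ℤ.⊖ n) * x ^ n ≈ x ^ m
  ^ℤ-⊖ x≉0 m       zero    = *-identityʳ _
  ^ℤ-⊖ x≉0 zero    (suc n) = *-inverseˡ (^-≉0 (suc n) x≉0)
  ^ℤ-⊖ {x} x≉0 (suc m) (suc n) = begin
    x ^ℤ (suc m ℤ.⊖ suc n) * (x * x ^ n)  ≡⟨ ≡.cong (λ i → x ^ℤ i * (x * x ^ n)) (ℤ.[1+m]⊖[1+n]≡m⊖n m n) ⟩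
    x ^ℤ (m ℤ.⊖ n) * (x * x ^ n)          ≈⟨ swap (x ^ℤ (m ℤ.⊖ n)) x (x ^ n) ⟩
    x * (x ^ℤ (m ℤ.⊖ n) * x ^ n)          ≈⟨ *-congˡ (^ℤ-⊖ x≉0 m n) ⟩
    x * x ^ m                             ∎
    where
    swap : ∀ x y z → x * (y * z) ≈ y * (x * z)
    swap = solve 3 (λ x y z → x :* (y :* z) := y :* (x :* z)) refl

  ^ℤ-1-n : ∀ {x} → ¬ (x ≈ 0#) → ∀ n → x ^ n * x ^ℤ (+ 1 ℤ.- + n) ≈ x
  ^ℤ-1-n {x} x≉0 n = trans (*-comm _ _) (trans
    (*-congʳ (reflexive (≡.cong (x ^ℤ_) (ℤ.m-n≡m⊖n 1 n))))
    (trans (^ℤ-⊖ x≉0 1 n) (*-identityʳ x)))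

  -- The hypothesis gives n = p + q - j - 1 without truncated subtraction, so the integer exponent
  -- on the right is -n.
  ^-⁻¹≈^ℤ : ∀ {x} → ¬ (x ≈ 0#) → ∀ j p q n → p ℕ.+ q ≡ suc j ℕ.+ n →
    (x ^ n) ⁻¹ ≈ x ^ℤ (+ 1 ℤ.+ + j ℤ.- + p ℤ.- + q)
  ^-⁻¹≈^ℤ {x} x≉0 j p q n eq = *-cancelˡ-≉0 (^-≉0 n x≉0) (*-cancelˡ-≉0 (^-≉0 (suc j) x≉0) (begin
    x ^ suc j * (x ^ n * (x ^ n) ⁻¹)     ≈⟨ *-congˡ (*-inverseʳ _ (^-≉0 n x≉0)) ⟩
    x ^ suc j * 1#                       ≈⟨ *-identityʳ _ ⟩
    x ^ suc j                            ≈⟨ ^ℤ-⊖ x≉0 (suc j) (p ℕ.+ q) ⟨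
    x ^ℤ (suc j ℤ.⊖ (p ℕ.+ q)) * x ^ (p ℕ.+ q)
      ≈⟨ *-cong (reflexive (≡.cong (x ^ℤ_) (≡.sym exponent)))
                (trans (reflexive (≡.cong (x ^_) eq)) (^-homo-* x (suc j) n)) ⟩
    x ^ℤ (+ 1 ℤ.+ + j ℤ.- + p ℤ.- + q) * (x ^ suc j * x ^ n)
      ≈⟨ rotate (x ^ℤ (+ 1 ℤ.+ + j ℤ.- + p ℤ.- + q)) (x ^ suc j) (x ^ n) ⟩
    x ^ suc j * (x ^ n * x ^ℤ (+ 1 ℤ.+ + j ℤ.- + p ℤ.- + q)) ∎))
    where
    rotate : ∀ x y z → x * (y * z) ≈ y * (z * x)
    rotate = solve 3 (λ x y z → x :* (y :* z) := y :* (z :* x)) refl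
    exponent : + 1 ℤ.+ + j ℤ.- + p ℤ.- + q ≡ suc j ℤ.⊖ (p ℕ.+ q)
    exponent = ≡.trans (ℤ.+-assoc (+ suc j) (ℤ.- + p) (ℤ.- + q))
      (≡.trans (≡.cong (λ i → + suc j ℤ.+ i) (≡.sym (ℤ.neg-distrib-+ (+ p) (+ q))))
               (ℤ.m-n≡m⊖n (suc j) (p ℕ.+ q)))

-- The reciprocity law

module Reciprocity {ℓ₀ ℓ₁ ℓ₂ : Level} (R : Reals ℓ₀ ℓ₁ ℓ₂) where
  open Reals R
  open CommutativeRing commutativeRing hiding (zero; _+_; _*_; -_; _≈_; 0#; 1#; _-_; semiring)
  open OrderProperties R
  open IntegerEmbedding R
  open FieldProperties R
  open BernoulliEuler R
  open PeriodicFormulas R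
  open IntegerPowers R
  open SumRearrangements commutativeRing
  open RingProperties ring using (-‿distribˡ-*)
  open GeneratingFunctions R using (1#^n≈1)
  open SemiringExp semiring using (^-congˡ; ^-assocʳ)
  open SemiringMult semiring using (×-homo-+) renaming (_×_ to _×′_)
  open SemiringSum semiring using (sum-cong-≋; *-distribˡ-sum; ∑-comm; ∑-distrib-+; ∑-permute)
  open SetoidReasoning setoid

  -1^even : ∀ {c} → 2 ∣ c → (- 1#) ^ c ≈ 1#
  -1^even (divides k ≡.refl) = begin
    (- 1#) ^ (k ℕ.* 2)    ≡⟨ ≡.cong ((- 1#) ^_) (ℕ.*-comm k 2) ⟩
    (- 1#) ^ (2 ℕ.* k)    ≈⟨ ^-assocʳ (- 1#) 2 k ⟨
    ((- 1#) ^ 2) ^ k      ≈⟨ ^-congˡ k -1²≈1 ⟩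
    1# ^ k                ≈⟨ 1#^n≈1 k ⟩
    1#                    ∎
    where
    -1²≈1 : - 1# * (- 1# * 1#) ≈ 1#
    -1²≈1 = trans (*-congˡ (*-identityʳ (- 1#)))
      (trans (solve 1 (λ o → :- o :* :- o := o :* o) refl 1#) (*-identityˡ 1#))

  distribution : ∀ a n w → ∑[ i < suc a ] bernoulliFun n ((fromℕ (toℕ i) + w) / fromℕ (suc a)) ≈
    fromℕ (suc a) ^ℤ (+ 1 ℤ.- + n) * bernoulliFun n w
  distribution a n w = *-cancelˡ-≉0 (^-≉0 n (fromℕ-suc≉0 a)) (begin
    A ^ n * (∑[ i < suc a ] bernoulliFun n ((fromℕ (toℕ i) + w) / A))
      ≈⟨ bernoulliFun-multiplication a n w ⟩
    A * bernoulliFun n w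
      ≈⟨ *-congʳ (^ℤ-1-n (fromℕ-suc≉0 a) n) ⟨
    A ^ n * A ^ℤ (+ 1 ℤ.- + n) * bernoulliFun n w
      ≈⟨ *-assoc _ _ _ ⟩
    A ^ n * (A ^ℤ (+ 1 ℤ.- + n) * bernoulliFun n w) ∎)
    where
    A : ℝ
    A = fromℕ (suc a)

  bernoulliFun-+ℕ : ∀ n m w → bernoulliFun n (w + fromℕ m) ≈ bernoulliFun n w
  bernoulliFun-+ℕ n m w = trans
    (quasiPeriodic-ℕ {1#} (bernoulliFun n) (bernoulliFun-cong n)
      (λ x → trans (bernoulliFun-+1 n x) (sym (*-identityˡ (bernoulliFun n x)))) m w)
    (trans (*-congʳ (1#^n≈1 m)) (*-identityˡ (bernoulliFun n w)))

  -- Reversing the order of summation replaces -i by i - a, and the integer shift by a is absorbed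
  -- by periodicity. It is needed because ν enters A - B with a minus sign.
  distribution-reversed : ∀ a n w → ∑[ i < suc a ] bernoulliFun n ((w - fromℕ (toℕ i)) / fromℕ (suc a)) ≈
    fromℕ (suc a) ^ℤ (+ 1 ℤ.- + n) * bernoulliFun n w
  distribution-reversed a n w = begin
    ∑[ i < suc a ] bernoulliFun n ((w - fromℕ (toℕ i)) / A)
      ≈⟨ ∑-permute {suc a} (λ i → bernoulliFun n ((w - fromℕ (toℕ i)) / A)) reverse ⟩
    ∑[ i < suc a ] bernoulliFun n ((w - fromℕ (toℕ (opposite i))) / A)
      ≈⟨ sum-cong-≋ {suc a} (λ i → bernoulliFun-cong n (*-congʳ {A ⁻¹} (opp i))) ⟩
    ∑[ i < suc a ] bernoulliFun n ((fromℕ (toℕ i) + (w - fromℕ a)) / A)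
      ≈⟨ distribution a n (w - fromℕ a) ⟩
    A ^ℤ (+ 1 ℤ.- + n) * bernoulliFun n (w - fromℕ a)
      ≈⟨ *-congˡ (trans (sym (bernoulliFun-+ℕ n a (w - fromℕ a)))
           (bernoulliFun-cong n (solve 2 (λ w a → w :- a :+ a := w) refl w (fromℕ a)))) ⟩
    A ^ℤ (+ 1 ℤ.- + n) * bernoulliFun n w ∎
    where
    A : ℝ
    A = fromℕ (suc a)
    opp : ∀ (i : Fin (suc a)) → w - fromℕ (toℕ (opposite i)) ≈ fromℕ (toℕ i) + (w - fromℕ a)
    opp i = begin
      w - fromℕ (toℕ (opposite i))
        ≡⟨ ≡.cong (λ k → w - fromℕ k) (opposite-prop i) ⟩
      w - fromℕ (a ∸ toℕ i)
        ≈⟨ solve 3 (λ w d i → w :- d := i :+ (w :- (d :+ i))) refl w (fromℕ (a ∸ toℕ i)) (fromℕ (toℕ i)) ⟩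
      fromℕ (toℕ i) + (w - (fromℕ (a ∸ toℕ i) + fromℕ (toℕ i)))
        ≈⟨ +-congˡ (+-congˡ (-‿cong (trans (sym (×-homo-+ 1# (a ∸ toℕ i) (toℕ i)))
             (reflexive (≡.cong fromℕ (ℕ.m∸n+n≡m (ℕ.≤-pred (toℕ<n i)))))))) ⟩
      fromℕ (toℕ i) + (w - fromℕ a) ∎

  -- From here on a, b, c, p, q are the predecessors of the numbers in the theorem.
  module _ (a b c : ℕ) (even : (- 1#) ^ suc c ≈ 1#) (p q : ℕ) (x y z : ℝ) where
    open Alternating c even using (scaledEuler; alternating-product)
    private
      A B N : ℝ
      A = fromℕ (suc a)
      B = fromℕ (suc b)
      N = fromℕ (suc c)

      -- `u` and `v` absorb the shifts, so that the points A and B are (μ + u)/N and (μ + v)/N. They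
      -- are also the arguments at which the Euler functions of `S⁽¹⁾` are evaluated.
      r s u v τ : ℕ → ℝ
      r i = (fromℕ i + x) / A
      s i = (fromℕ i + y) / B
      u i = N * r i + z
      v i = N * s i + z
      τ i = (fromℕ i + z) / N

      N*N⁻¹≈1 : N * N ⁻¹ ≈ 1#
      N*N⁻¹≈1 = *-inverseʳ N (fromℕ-suc≉0 c)

      -- One point read in two ways: on the left as a term of the alternating sum over k, on the
      -- right as a term of the multiplication formula over l.
      point : ∀ d e l k → (fromℕ k + (N * ((fromℕ l + e) / fromℕ (suc d)) + z)) / N ≈
                          (fromℕ l + (fromℕ (suc d) * ((fromℕ k + z) / N) + e)) / fromℕ (suc d)
      point d e l k = begin
        (K + (N * ((L + e) * D ⁻¹) + z)) * N ⁻¹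
          ≈⟨ expand K N L e (D ⁻¹) z (N ⁻¹) ⟩
        (K + z) * N ⁻¹ + (N * N ⁻¹) * ((L + e) * D ⁻¹)
          ≈⟨ +-cong (trans (sym (*-identityˡ _)) (*-congʳ (sym (*-inverseʳ D (fromℕ-suc≉0 d)))))
                    (trans (*-congʳ N*N⁻¹≈1) (*-identityˡ _)) ⟩
        D * D ⁻¹ * ((K + z) * N ⁻¹) + (L + e) * D ⁻¹
          ≈⟨ collect D (D ⁻¹) ((K + z) * N ⁻¹) L e ⟩
        (L + (D * ((K + z) * N ⁻¹) + e)) * D ⁻¹ ∎
        where
        K L D : ℝ
        K = fromℕ k
        L = fromℕ l
        D = fromℕ (suc d)
        expand : ∀ K N L e D′ z N′ →
          (K + (N * ((L + e) * D′) + z)) * N′ ≈ (K + z) * N′ + (N * N′) * ((L + e) * D′)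
        expand = solve 7 (λ K N L e D′ z N′ → (K :+ (N :* ((L :+ e) :* D′) :+ z)) :* N′
                            := (K :+ z) :* N′ :+ (N :* N′) :* ((L :+ e) :* D′)) refl
        collect : ∀ D D′ T L e → D * D′ * T + (L + e) * D′ ≈ (L + (D * T + e)) * D′
        collect = solve 5 (λ D D′ T L e → D :* D′ :* T :+ (L :+ e) :* D′ := (L :+ (D :* T :+ e)) :* D′) refl

      u-v : ∀ l k → (u l - v k) / N ≈ r l - s k
      u-v l k = trans (expand N (r l) (s k) z (N ⁻¹)) (trans (*-congʳ N*N⁻¹≈1) (*-identityˡ _))
        where
        expand : ∀ N r s z N′ → ((N * r + z) - (N * s + z)) * N′ ≈ (N * N′) * (r - s)
        expand = solve 5 (λ N r s z N′ → ((N :* r :+ z) :- (N :* s :+ z)) :* N′ := (N :* N′) :* (r :- s)) refl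

      -- A - B as a term of a sum over λ modulo a, with ν fixed; this is how the parameters -a and x
      -- of the first `S⁽¹⁾` arise.
      r-s-A : ∀ l k → r l - s k ≈ (fromℕ l + (- A * s k + x)) / A
      r-s-A l k = trans
        (+-congˡ (-‿cong (trans (sym (*-identityˡ (s k))) (*-congʳ (sym (*-inverseʳ A (fromℕ-suc≉0 a)))))))
        (collect (fromℕ l) x (A ⁻¹) A (s k))
        where
        collect : ∀ L x A′ A S → (L + x) * A′ - A * A′ * S ≈ (L + (- A * S + x)) * A′
        collect = solve 5 (λ L x A′ A S → (L :+ x) :* A′ :- A :* A′ :* S := (L :+ (:- A :* S :+ x)) :* A′) refl

      -- A - B as a term of a sum over ν modulo b, with λ fixed; the parameters b and -y of the
      -- second `S⁽¹⁾` arise here, and the index enters negatively.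
      r-s-B : ∀ l k → r l - s k ≈ ((B * r l + - y) - fromℕ k) / B
      r-s-B l k = trans
        (+-congʳ (trans (sym (*-identityˡ (r l))) (*-congʳ (sym (*-inverseʳ B (fromℕ-suc≉0 b))))))
        (collect (fromℕ k) y (B ⁻¹) B (r l))
        where
        collect : ∀ K y B′ B r → B * B′ * r - (K + y) * B′ ≈ ((B * r + - y) - K) * B′
        collect = solve 5 (λ K y B′ B r → B :* B′ :* r :- (K :+ y) :* B′ := ((B :* r :+ :- y) :- K) :* B′) refl

      kA kB : ℕ → ℝ
      kA n = A ^ℤ (+ 1 ℤ.- + n)
      kB n = B ^ℤ (+ 1 ℤ.- + n)

      half : ℝ
      half = fromℕ 2 ⁻¹

    -- For each fixed sign index the triple sum factors, and the multiplication formula in each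
    -- factor yields the powers of a and b.
    left : kA (suc p) * kB (suc q) * S⁽²⁾ (suc p) (suc q) (+ suc a) (+ suc b) (suc c) x y z ≈
      ∑[ i < suc a ] ∑[ j < suc b ] ∑[ k < suc c ] ((- 1#) ^ toℕ k *
        (bernoulliFun (suc p) ((fromℕ (toℕ k) + u (toℕ i)) / N) *
         bernoulliFun (suc q) ((fromℕ (toℕ k) + v (toℕ j)) / N)))
    left = sym (begin
      ∑[ i < suc a ] ∑[ j < suc b ] ∑[ k < suc c ] ((- 1#) ^ toℕ k * (P i k * Q j k))
        ≈⟨ sum-product (λ k → (- 1#) ^ toℕ k) P Q ⟩
      ∑[ k < suc c ] ((- 1#) ^ toℕ k * (∑[ i < suc a ] P i k) * (∑[ j < suc b ] Q j k))
        ≈⟨ sum-cong-≋ {suc c} (λ k → *-cong (*-congˡ {(- 1#) ^ toℕ k} (sumP k)) (sumQ k)) ⟩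
      ∑[ k < suc c ] ((- 1#) ^ toℕ k * (kA (suc p) * P′ k) * (kB (suc q) * Q′ k))
        ≈⟨ sum-cong-≋ {suc c} (λ k → rearrange ((- 1#) ^ toℕ k) (kA (suc p)) (P′ k) (kB (suc q)) (Q′ k)) ⟩
      ∑[ k < suc c ] (kA (suc p) * kB (suc q) * ((- 1#) ^ toℕ k * P′ k * Q′ k))
        ≈⟨ *-distribˡ-sum {suc c} (kA (suc p) * kB (suc q)) (λ k → (- 1#) ^ toℕ k * P′ k * Q′ k) ⟨
      kA (suc p) * kB (suc q) * S⁽²⁾ (suc p) (suc q) (+ suc a) (+ suc b) (suc c) x y z ∎)
      where
      P : Fin (suc a) → Fin (suc c) → ℝ
      P i k = bernoulliFun (suc p) ((fromℕ (toℕ k) + u (toℕ i)) / N)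
      Q : Fin (suc b) → Fin (suc c) → ℝ
      Q j k = bernoulliFun (suc q) ((fromℕ (toℕ k) + v (toℕ j)) / N)
      P′ Q′ : Fin (suc c) → ℝ
      P′ k = bernoulliFun (suc p) (A * τ (toℕ k) + x)
      Q′ k = bernoulliFun (suc q) (B * τ (toℕ k) + y)
      sumP : ∀ k → ∑[ i < suc a ] P i k ≈ kA (suc p) * P′ k
      sumP k = trans (sum-cong-≋ {suc a} (λ i → bernoulliFun-cong (suc p) (point a x (toℕ i) (toℕ k))))
                     (distribution a (suc p) (A * τ (toℕ k) + x))
      sumQ : ∀ k → ∑[ j < suc b ] Q j k ≈ kB (suc q) * Q′ k
      sumQ k = trans (sum-cong-≋ {suc b} (λ j → bernoulliFun-cong (suc q) (point b y (toℕ j) (toℕ k))))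
                     (distribution b (suc q) (B * τ (toℕ k) + y))
      rearrange : ∀ s k P l Q → s * (k * P) * (l * Q) ≈ k * l * (s * P * Q)
      rearrange = solve 5 (λ s k P l Q → s :* (k :* P) :* (l :* Q) := k :* l :* (s :* P :* Q)) refl

    private
      collapse : ∀ {n} κ k {K K′} (E β : Fin n → ℝ) → K ≈ K′ →
        κ * (sum (λ i → - (half * K * E i) * (k * β i))) ≈ - (half * (κ * k * K′ * sum (λ i → E i * β i)))
      collapse {n} κ k {K} {K′} E β K≈K′ = begin
        κ * sum (λ i → - (half * K * E i) * (k * β i))
          ≈⟨ *-congˡ (sum-cong-≋ {n} (λ i → *-congʳ {k * β i} (-‿distribˡ-* (half * K) (E i)))) ⟩
        κ * sum (λ i → - (half * K) * E i * (k * β i))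
          ≈⟨ *-congˡ (sum-scale (- (half * K)) k E β) ⟩
        κ * (- (half * K) * k * S)
          ≈⟨ *-congˡ (*-congʳ (*-congʳ (-‿cong (*-congˡ K≈K′)))) ⟩
        κ * (- (half * K′) * k * S)
          ≈⟨ rearrange κ half K′ k S ⟩
        - (half * (κ * k * K′ * S)) ∎
        where
        S : ℝ
        S = sum (λ i → E i * β i)
        rearrange : ∀ κ h K k S → κ * (- (h * K) * k * S) ≈ - (h * (κ * k * K * S))
        rearrange = solve 5 (λ κ h K k S → κ :* (:- (h :* K) :* k :* S) := :- (h :* (κ :* k :* K :* S))) refl

      factor-half : ∀ {n} d (T : Fin n → ℝ) → d * sum (λ i → - (half * T i)) ≈ - (d / fromℕ 2 * sum T)
      factor-half {n} d T = begin
        d * sum (λ i → - (half * T i))  ≈⟨ *-congˡ (sum-cong-≋ {n} (λ i → -‿distribˡ-* half (T i))) ⟩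
        d * sum (λ i → - half * T i)    ≈⟨ *-congˡ (*-distribˡ-sum {n} (- half) T) ⟨
        d * (- half * sum T)            ≈⟨ rearrange d half (sum T) ⟩
        - (d * half * sum T)            ∎
        where
        rearrange : ∀ d h T → d * (- h * T) ≈ - (d * h * T)
        rearrange = solve 3 (λ d h T → d :* (:- h :* T) := :- (d :* h :* T)) refl

      eulerIndex : ∀ P Q j n → P ℕ.+ Q ≡ suc j ℕ.+ n → n ≡ P ℕ.+ Q ∸ j ∸ 1
      eulerIndex P Q j n eq = ≡.sym (≡.cong (_∸ 1) (≡.trans (≡.cong (_∸ j) (≡.trans eq (≡.sym (ℕ.+-suc j n))))
                                                            (ℕ.m+n∸m≡n j (suc n))))

      splitˡ : ∀ P q j → j ℕ.≤ P → P ℕ.+ suc q ≡ suc j ℕ.+ (P ∸ j ℕ.+ q)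
      splitˡ P q j j≤P = ≡.trans (ℕ.+-suc P q) (≡.cong suc
        (≡.trans (≡.cong (ℕ._+ q) (≡.sym (ℕ.m+[n∸m]≡n j≤P))) (ℕ.+-assoc j (P ∸ j) q)))

      splitʳ : ∀ p Q h → h ℕ.≤ Q → suc p ℕ.+ Q ≡ suc h ℕ.+ (p ℕ.+ (Q ∸ h))
      splitʳ p Q h h≤Q = ≡.cong suc (≡.trans (≡.cong (p ℕ.+_) (≡.sym (ℕ.m+[n∸m]≡n h≤Q)))
        (≡.trans (≡.sym (ℕ.+-assoc p h (Q ∸ h))) (≡.trans (≡.cong (ℕ._+ (Q ∸ h)) (ℕ.+-comm p h))
                 (ℕ.+-assoc h p (Q ∸ h)))))

    right₁ : ∑[ i < suc a ] ∑[ j < suc b ] (suc q ×′ (∑[ l ≤ suc p ] ((suc p C toℕ l) ×′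
        (bernoulliFun (toℕ l) ((u (toℕ i) - v (toℕ j)) / N) * scaledEuler (v (toℕ j)) (suc p ∸ toℕ l ℕ.+ q)))))
      ≈ - (fromℕ (suc q) / fromℕ 2 * (∑[ l ≤ suc p ] (fromℕ (suc p C toℕ l) * kA (toℕ l)
          * N ^ℤ (+ 1 ℤ.+ + toℕ l ℤ.- + suc p ℤ.- + suc q)
          * S⁽¹⁾ (suc p ℕ.+ suc q ∸ toℕ l) (toℕ l) (+ suc c) (ℤ.- (+ suc a)) (suc b) z x y)))
    right₁ = begin
      ∑[ i < suc a ] ∑[ j < suc b ] (suc q ×′ (∑[ l ≤ suc p ] ((suc p C toℕ l) ×′ (g l j i * f l j))))
        -- The Euler factor depends on ν only, so the sum over λ is moved inside to act on the
        -- Bernoulli factor alone.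
        ≈⟨ ∑-comm {suc a} {suc b} (λ i j → suc q ×′ (∑[ l ≤ suc p ] ((suc p C toℕ l) ×′ (g l j i * f l j)))) ⟩
      ∑[ j < suc b ] ∑[ i < suc a ] (suc q ×′ (∑[ l ≤ suc p ] ((suc p C toℕ l) ×′ (g l j i * f l j))))
        ≈⟨ sum-collect (suc q) (λ l → suc p C toℕ l) f g ⟩
      fromℕ (suc q) * (∑[ l ≤ suc p ] (fromℕ (suc p C toℕ l) * (∑[ j < suc b ] (f l j * (∑[ i < suc a ] g l j i)))))
        ≈⟨ *-congˡ (sum-cong-≋ {suc (suc p)} term) ⟩
      fromℕ (suc q) * (∑[ l ≤ suc p ] (- (half * T l)))
        ≈⟨ factor-half (fromℕ (suc q)) T ⟩
      - (fromℕ (suc q) / fromℕ 2 * (∑[ l ≤ suc p ] T l)) ∎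
      where
      f : Fin (suc (suc p)) → Fin (suc b) → ℝ
      f l j = scaledEuler (v (toℕ j)) (suc p ∸ toℕ l ℕ.+ q)
      g : Fin (suc (suc p)) → Fin (suc b) → Fin (suc a) → ℝ
      g l j i = bernoulliFun (toℕ l) ((u (toℕ i) - v (toℕ j)) / N)
      T : Fin (suc (suc p)) → ℝ
      T l = fromℕ (suc p C toℕ l) * kA (toℕ l) * N ^ℤ (+ 1 ℤ.+ + toℕ l ℤ.- + suc p ℤ.- + suc q)
          * S⁽¹⁾ (suc p ℕ.+ suc q ∸ toℕ l) (toℕ l) (+ suc c) (ℤ.- (+ suc a)) (suc b) z x y
      module _ (l : Fin (suc (suc p))) where
        n : ℕ
        n = suc p ∸ toℕ l ℕ.+ q
        split : suc p ℕ.+ suc q ≡ suc (toℕ l) ℕ.+ n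
        split = splitˡ (suc p) q (toℕ l) (ℕ.≤-pred (toℕ<n l))
        β : Fin (suc b) → ℝ
        -- `- A` is what `fromℤ (ℤ.- (+ suc a))` reduces to, so this is literally the Bernoulli
        -- factor of `S⁽¹⁾`.
        β j = bernoulliFun (toℕ l) (- A * s (toℕ j) + x)
        E : ℕ → Fin (suc b) → ℝ
        E n j = eulerFun n (v (toℕ j))
        inner : ∀ j → ∑[ i < suc a ] g l j i ≈ kA (toℕ l) * β j
        inner j = trans
          (sum-cong-≋ {suc a} (λ i → bernoulliFun-cong (toℕ l)
            (trans (u-v (toℕ i) (toℕ j)) (r-s-A (toℕ i) (toℕ j)))))
          (distribution a (toℕ l) (- A * s (toℕ j) + x))
        term : fromℕ (suc p C toℕ l) * (∑[ j < suc b ] (f l j * (∑[ i < suc a ] g l j i))) ≈ - (half * T l)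
        term = begin
          fromℕ (suc p C toℕ l) * (∑[ j < suc b ] (f l j * (∑[ i < suc a ] g l j i)))
            ≈⟨ *-congˡ (sum-cong-≋ {suc b} (λ j → *-congˡ {f l j} (inner j))) ⟩
          fromℕ (suc p C toℕ l) * (∑[ j < suc b ] (f l j * (kA (toℕ l) * β j)))
            ≈⟨ collapse (fromℕ (suc p C toℕ l)) (kA (toℕ l)) (E n) β
                 (^-⁻¹≈^ℤ (fromℕ-suc≉0 c) (toℕ l) (suc p) (suc q) n split) ⟩
          - (half * (fromℕ (suc p C toℕ l) * kA (toℕ l) * N ^ℤ (+ 1 ℤ.+ + toℕ l ℤ.- + suc p ℤ.- + suc q)
            * (∑[ j < suc b ] (E n j * β j))))
            ≈⟨ -‿cong (*-congˡ (*-congˡ (reflexive (≡.cong (λ m → ∑[ j < suc b ] (E m j * β j))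
                 (eulerIndex (suc p) (suc q) (toℕ l) n split))))) ⟩
          - (half * T l) ∎

    -- Here the Euler factor depends on λ, so the sums are already in the right order, and it is the
    -- sum over ν that collapses, through `distribution-reversed`.
    right₂ : ∑[ i < suc a ] ∑[ j < suc b ] (suc p ×′ (∑[ h ≤ suc q ] ((suc q C toℕ h) ×′
        ((- 1#) ^ toℕ h * bernoulliFun (toℕ h) ((u (toℕ i) - v (toℕ j)) / N)
          * scaledEuler (u (toℕ i)) (p ℕ.+ (suc q ∸ toℕ h))))))
      ≈ - (fromℕ (suc p) / fromℕ 2 * (∑[ h ≤ suc q ] (fromℕ (suc q C toℕ h) * (- 1#) ^ toℕ h * kB (toℕ h)
          * N ^ℤ (+ 1 ℤ.+ + toℕ h ℤ.- + suc p ℤ.- + suc q)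
          * S⁽¹⁾ (suc p ℕ.+ suc q ∸ toℕ h) (toℕ h) (+ suc c) (+ suc b) (suc a) z (- y) x)))
    right₂ = begin
      ∑[ i < suc a ] ∑[ j < suc b ] (suc p ×′ (∑[ h ≤ suc q ] ((suc q C toℕ h) ×′ (g h i j * f h i))))
        ≈⟨ sum-collect (suc p) (λ h → suc q C toℕ h) f g ⟩
      fromℕ (suc p) * (∑[ h ≤ suc q ] (fromℕ (suc q C toℕ h) * (∑[ i < suc a ] (f h i * (∑[ j < suc b ] g h i j)))))
        ≈⟨ *-congˡ (sum-cong-≋ {suc (suc q)} term) ⟩
      fromℕ (suc p) * (∑[ h ≤ suc q ] (- (half * T h)))
        ≈⟨ factor-half (fromℕ (suc p)) T ⟩
      - (fromℕ (suc p) / fromℕ 2 * (∑[ h ≤ suc q ] T h)) ∎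
      where
      f : Fin (suc (suc q)) → Fin (suc a) → ℝ
      f h i = scaledEuler (u (toℕ i)) (p ℕ.+ (suc q ∸ toℕ h))
      g : Fin (suc (suc q)) → Fin (suc a) → Fin (suc b) → ℝ
      g h i j = (- 1#) ^ toℕ h * bernoulliFun (toℕ h) ((u (toℕ i) - v (toℕ j)) / N)
      T : Fin (suc (suc q)) → ℝ
      T h = fromℕ (suc q C toℕ h) * (- 1#) ^ toℕ h * kB (toℕ h) * N ^ℤ (+ 1 ℤ.+ + toℕ h ℤ.- + suc p ℤ.- + suc q)
          * S⁽¹⁾ (suc p ℕ.+ suc q ∸ toℕ h) (toℕ h) (+ suc c) (+ suc b) (suc a) z (- y) x
      module _ (h : Fin (suc (suc q))) where
        n : ℕ
        n = p ℕ.+ (suc q ∸ toℕ h)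
        split : suc p ℕ.+ suc q ≡ suc (toℕ h) ℕ.+ n
        split = splitʳ p (suc q) (toℕ h) (ℕ.≤-pred (toℕ<n h))
        σ : ℝ
        σ = (- 1#) ^ toℕ h
        β : Fin (suc a) → ℝ
        β i = bernoulliFun (toℕ h) (B * r (toℕ i) + - y)
        E : ℕ → Fin (suc a) → ℝ
        E n i = eulerFun n (u (toℕ i))
        inner : ∀ i → ∑[ j < suc b ] g h i j ≈ σ * kB (toℕ h) * β i
        inner i = begin
          ∑[ j < suc b ] g h i j
            ≈⟨ *-distribˡ-sum {suc b} σ (λ j → bernoulliFun (toℕ h) ((u (toℕ i) - v (toℕ j)) / N)) ⟨
          σ * (∑[ j < suc b ] bernoulliFun (toℕ h) ((u (toℕ i) - v (toℕ j)) / N))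
            ≈⟨ *-congˡ (trans
                 (sum-cong-≋ {suc b} (λ j → bernoulliFun-cong (toℕ h)
                   (trans (u-v (toℕ i) (toℕ j)) (r-s-B (toℕ i) (toℕ j)))))
                 (distribution-reversed b (toℕ h) (B * r (toℕ i) + - y))) ⟩
          σ * (kB (toℕ h) * β i)
            ≈⟨ *-assoc σ (kB (toℕ h)) (β i) ⟨
          σ * kB (toℕ h) * β i ∎
        term : fromℕ (suc q C toℕ h) * (∑[ i < suc a ] (f h i * (∑[ j < suc b ] g h i j))) ≈ - (half * T h)
        term = begin
          fromℕ (suc q C toℕ h) * (∑[ i < suc a ] (f h i * (∑[ j < suc b ] g h i j)))
            ≈⟨ *-congˡ (sum-cong-≋ {suc a} (λ i → *-congˡ {f h i} (inner i))) ⟩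
          fromℕ (suc q C toℕ h) * (∑[ i < suc a ] (f h i * (σ * kB (toℕ h) * β i)))
            ≈⟨ collapse (fromℕ (suc q C toℕ h)) (σ * kB (toℕ h)) (E n) β
                 (^-⁻¹≈^ℤ (fromℕ-suc≉0 c) (toℕ h) (suc p) (suc q) n split) ⟩
          - (half * (fromℕ (suc q C toℕ h) * (σ * kB (toℕ h)) * N ^ℤ (+ 1 ℤ.+ + toℕ h ℤ.- + suc p ℤ.- + suc q)
            * (∑[ i < suc a ] (E n i * β i))))
            ≈⟨ -‿cong (*-congˡ (*-cong (*-congʳ (sym (*-assoc (fromℕ (suc q C toℕ h)) σ (kB (toℕ h)))))
                 (reflexive (≡.cong (λ m → ∑[ i < suc a ] (E m i * β i))
                   (eulerIndex (suc p) (suc q) (toℕ h) n split))))) ⟩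
          - (half * T h) ∎

    reciprocity : kA (suc p) * kB (suc q) * S⁽²⁾ (suc p) (suc q) (+ suc a) (+ suc b) (suc c) x y z ≈
      - (fromℕ (suc q) / fromℕ 2 * (∑[ l ≤ suc p ] (fromℕ (suc p C toℕ l) * kA (toℕ l)
          * N ^ℤ (+ 1 ℤ.+ + toℕ l ℤ.- + suc p ℤ.- + suc q)
          * S⁽¹⁾ (suc p ℕ.+ suc q ∸ toℕ l) (toℕ l) (+ suc c) (ℤ.- (+ suc a)) (suc b) z x y)))
      - fromℕ (suc p) / fromℕ 2 * (∑[ h ≤ suc q ] (fromℕ (suc q C toℕ h) * (- 1#) ^ toℕ h * kB (toℕ h)
          * N ^ℤ (+ 1 ℤ.+ + toℕ h ℤ.- + suc p ℤ.- + suc q)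
          * S⁽¹⁾ (suc p ℕ.+ suc q ∸ toℕ h) (toℕ h) (+ suc c) (+ suc b) (suc a) z (- y) x))
    reciprocity = trans left (trans
      (sum-cong-≋ {suc a} (λ i → trans
        (sum-cong-≋ {suc b} (λ j → alternating-product p q (u (toℕ i)) (v (toℕ j))))
        (∑-distrib-+ {suc b} (X i) (Y i))))
      (trans (∑-distrib-+ {suc a} (λ i → sum (X i)) (λ i → sum (Y i))) (+-cong right₁ right₂)))
      where
      X Y : Fin (suc a) → Fin (suc b) → ℝ
      X i j = suc q ×′ (∑[ l ≤ suc p ] ((suc p C toℕ l) ×′
        (bernoulliFun (toℕ l) ((u (toℕ i) - v (toℕ j)) / N) * scaledEuler (v (toℕ j)) (suc p ∸ toℕ l ℕ.+ q))))
      Y i j = suc p ×′ (∑[ h ≤ suc q ] ((suc q C toℕ h) ×′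
        ((- 1#) ^ toℕ h * bernoulliFun (toℕ h) ((u (toℕ i) - v (toℕ j)) / N)
          * scaledEuler (u (toℕ i)) (p ℕ.+ (suc q ∸ toℕ h)))))

open import Data.Nat using (_≤_)

theorem4 : {r ℓ₁ ℓ₂ : Level} (R : Reals r ℓ₁ ℓ₂) →
    let open Reals R hiding (_≤_)
        open BernoulliEuler R
    in
    (a b c : ℕ) → 1 ≤ a → 1 ≤ b → 1 ≤ c → 2 ∣ c →
    (p q : ℕ) → 1 ≤ p → 1 ≤ q →
    (x y z : ℝ) →
    fromℕ a ^ℤ (+ 1 ℤ.- + p) * fromℕ b ^ℤ (+ 1 ℤ.- + q) * S⁽²⁾ p q (+ a) (+ b) c x y z
    ≈
    - (fromℕ q / fromℕ 2 * (∑[ i ≤ p ] (let j = toℕ i in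
        fromℕ (p C j)
          * fromℕ a ^ℤ (+ 1 ℤ.- + j)
          * fromℕ c ^ℤ (+ 1 ℤ.+ + j ℤ.- + p ℤ.- + q)
          * S⁽¹⁾ (p ℕ.+ q ∸ j) j (+ c) (ℤ.- (+ a)) b z x y)))
    - fromℕ p / fromℕ 2 * (∑[ i ≤ q ] (let h = toℕ i in
        fromℕ (q C h)
          * (- 1#) ^ h
          * fromℕ b ^ℤ (+ 1 ℤ.- + h)
          * fromℕ c ^ℤ (+ 1 ℤ.+ + h ℤ.- + p ℤ.- + q)
          * S⁽¹⁾ (p ℕ.+ q ∸ h) h (+ c) (+ b) a z (- y) x))
theorem4 R (suc a) (suc b) (suc c) _ _ _ 2∣c (suc p) (suc q) _ _ x y z =
  reciprocity a b c (-1^even 2∣c) p q x y z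
  where open Reciprocity R
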